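{- Let $\Gamma$ be a finite, simple, strongly connected digraph with at least $2$ vertices which is vertex-transitive. Then $\dim(\Gamma)=1$ if and only if $\Gamma$ is isomorphic to one of the following Cayley digraphs: (i) $\mathrm{Cay}(\mathbb{Z}_n,\{1\})$, where $n\geq 2$; (ii) $\mathrm{Cay}(\mathbb{Z}_{2n},\{1,2\})$, where $n\geq 2$; (iii) $\mathrm{Cay}(\mathbb{Z}_2\oplus\mathbb{Z}_n,\{(1,0),(0,1)\})$, where $n\geq 3$; (iv) $\mathrm{Cay}(\mathbb{Z}_2\oplus\mathbb{Z}_{2n},\{(1,0),(0,1),(0,2)\})$, where $n\geq 3$.
   Context: All digraphs are finite, simple (no loops, at most one arc from $x$ to $y$ for each ordered pair) and strongly connected. For vertices $x,y$, $\partial(x,y)$ is the length of a shortest directed path from $x$ to $y$, and the two way distance is $\tilde\partial(x,y)=(\partial(x,y),\partial(y,x))$. A subset $\{w_1,\dots,w_m\}\subseteq V(\Gamma)$ is a weakly resolving set if $(\tilde\partial(w_1,u),\dots,\tilde\partial(w_m,u))\neq(\tilde\partial(w_1,v),\dots,\tilde\partial(w_m,v))$ for all distinct $u,v\in V(\Gamma)$; the weak metric dimension $\dim(\Gamma)$ is the minimum cardinality of a weakly resolving set. $\Gamma$ is vertex-transitive if its full automorphism group acts transitively on $V(\Gamma)$. For a finite (additive) group $G$ and a generating subset $S$ not containing $0$, the Cayley digraph $\mathrm{Cay}(G,S)$ has vertex set $G$ and arc set $\{(x,x+s)\mid x\in G,s\in S\}$. $\mathbb{Z}_n$ is the additive group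 of integers modulo $n$. -}

module Defs where

open import Data.Bool using (Bool; true; false)
open import Data.Nat using (ℕ; zero; suc; _+_; _*_; _≤_; _/_; _%_)
import Data.Nat as ℕ
open import Data.Fin using (Fin; toℕ)
open import Data.Fin.Subset using (Subset; _∈_; ∣_∣)
open import Data.List using (List)
open import Data.Bool.ListAction using (any)
open import Data.Product using (Σ; ∃; ∃-syntax; _×_; _,_)
open import Data.Sum using (_⊎_)
open import Function.Bundles using (Bijection)
open import Relation.Binary.PropositionalEquality using (_≡_; _≢_)
open import Relation.Nullary using (¬_)
open import Relation.Nullary.Decidable using (⌊_⌋)

-- A finite digraph on the vertex set Fin N with (Boolean) arc relation.
-- Using a relation automatically gives at most one arc x → y per ordered pair.
record Digraph : Set where
  field
    N   : ℕ
    adj : Fin N → Fin N → Bool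

open Digraph public

Loopless : Digraph → Set
Loopless Γ = ∀ x → adj Γ x x ≡ false

data Walk (Γ : Digraph) : Fin (N Γ) → Fin (N Γ) → ℕ → Set where
  nil  : ∀ {x} → Walk Γ x x 0
  cons : ∀ {x y z k} → adj Γ x y ≡ true → Walk Γ y z k → Walk Γ x z (suc k)

StronglyConnected : Digraph → Set
StronglyConnected Γ = ∀ x y → ∃[ k ] Walk Γ x y k

IsDist : (Γ : Digraph) → Fin (N Γ) → Fin (N Γ) → ℕ → Set
IsDist Γ x y d = Walk Γ x y d × (∀ k → Walk Γ x y k → d ≤ k)

TwoWayDiffer : (Γ : Digraph) → (w u v : Fin (N Γ)) → Set
TwoWayDiffer Γ w u v =
  (∃[ d ] ∃[ e ] (IsDist Γ w u d × IsDist Γ w v e × d ≢ e))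
  ⊎ (∃[ d ] ∃[ e ] (IsDist Γ u w d × IsDist Γ v w e × d ≢ e))

WeaklyResolving : (Γ : Digraph) → Subset (N Γ) → Set
WeaklyResolving Γ W = ∀ u v → u ≢ v → ∃[ w ] (w ∈ W × TwoWayDiffer Γ w u v)

WeakMetricDim : Digraph → ℕ → Set
WeakMetricDim Γ m =
  (∃[ W ] (WeaklyResolving Γ W × ∣ W ∣ ≡ m))
  × (∀ W → WeaklyResolving Γ W → m ≤ ∣ W ∣)

Iso : Digraph → Digraph → Set
Iso Γ Δ = Σ (Bijection (≡-setoid′ (N Γ)) (≡-setoid′ (N Δ))) λ f →
            ∀ x y → adj Γ x y ≡ adj Δ (Bijection.to f x) (Bijection.to f y)
  where
  open import Relation.Binary.PropositionalEquality using () renaming (setoid to ≡-setoid)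
  ≡-setoid′ : ℕ → _
  ≡-setoid′ n = ≡-setoid (Fin n)

Automorphism : Digraph → Set
Automorphism Γ = Iso Γ Γ

VertexTransitive : Digraph → Set
VertexTransitive Γ = ∀ x y → Σ (Automorphism Γ) λ φ →
  Bijection.to (Data.Product.proj₁ φ) x ≡ y
  where import Data.Product

-- Cay(ℤ_n, S): vertex x ∈ Fin n represents the residue toℕ x; the
-- connection set S is given by representatives in ℕ (reduced mod n).
-- Arc x → y iff y = x + s (mod n) for some s ∈ S.
CayZ : (n : ℕ) → List ℕ → Digraph
CayZ zero    S = record { N = zero ; adj = λ () }
CayZ (suc m) S = record
  { N = suc m
  ; adj = λ x y → any (λ s → ⌊ toℕ y ℕ.≟ (toℕ x + s) % suc m ⌋) S }

-- Cay(ℤ_2 ⊕ ℤ_n, S): vertex v ∈ Fin (2 * n) represents the pair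
-- (toℕ v / n , toℕ v % n); S is a list of pairs of representatives.
-- Arc (a,b) → (a',b') iff a' = a + s₁ (mod 2) and b' = b + s₂ (mod n)
-- for some (s₁,s₂) ∈ S.
CayZ2Zn : (n : ℕ) → List (ℕ × ℕ) → Digraph
CayZ2Zn zero    S = record { N = 2 * zero ; adj = λ () }
CayZ2Zn (suc m) S = record
  { N = 2 * suc m
  ; adj = λ x y → any (λ { (s₁ , s₂) →
        ⌊ toℕ y / suc m ℕ.≟ (toℕ x / suc m + s₁) % 2 ⌋
        Data.Bool.∧ ⌊ toℕ y % suc m ℕ.≟ (toℕ x % suc m + s₂) % suc m ⌋ }) S }
  where import Data.Bool

{-# OPTIONS --safe #-}

-- If one vertex resolves Γ, then by transitivity every vertex does, so an automorphism is determined
-- by the image of one vertex and Γ = Cay(G , S) for a group G in which g is determined by the pair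
-- (ℓ(g) , ℓ(g⁻¹)) of word lengths.  In particular the letters s ∈ S are separated by m(s) = 1 + ℓ(s⁻¹),
-- the length of a shortest circuit (word with value ε) through s.
--
-- An involution a ∈ S is central: in a shortest circuit with a factor ac or ca where c does not commute
-- with a, all such factors have the same pair of lengths, hence are equal, and a can be rotated around
-- the circuit.  The other letters are compared by y ~ y² (when y² ∈ S has order m(y²) = m(y) - 1).  In a
-- shortest circuit with inequivalent letters x, c (or with an odd number of a's) the products of adjacent
-- inequivalent letters coincide, so the circuit can be brought to the form z x^i c^j with z ∈ {ε , a};
-- then xxc, xcc and axc have inverses of the same length, so their lengths must differ, which is
-- impossible.  Hence the non-involutions of S are {y} or {y , y²}, which gives the four families.
--
-- Conversely, α + κ(β) is the distance from the origin to (α , β), where κ(β) is the number of steps from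
-- {1}, respectively {1 , 2}, needed to make up β.
module Submission where

open import Defs
open import Data.Nat using (ℕ; _≤_; _*_)
open import Data.Product using (∃-syntax; _×_; _,_)
open import Data.Sum using (_⊎_)
open import Data.List using (_∷_; [])
open import Function.Bundles using (_⇔_)

open import Level using (0ℓ)
open import Algebra.Bundles using (Group)
open import Algebra.Structures using (IsGroup)
import Algebra.Construct.Flip.Op as Flip
import Algebra.Properties.Group
open import Data.Bool using (true; false; T; _∧_)
open import Data.Bool.Properties using (T-≡) renaming (_≟_ to _≟ᵇ_)
open import Data.Empty using (⊥; ⊥-elim)
open import Data.Fin as Fin using (Fin; toℕ; fromℕ<)
open import Data.Fin.Properties using (any?; toℕ-injective; toℕ<n; toℕ-fromℕ<) renaming (_≟_ to _≟ᶠ_)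
open import Data.Fin.Subset using (Subset; ∣_∣; _-_; ⁅_⁆) renaming (_∈_ to _∈ˢ_)
open import Data.Fin.Subset.Properties using (x∈p⇒∣p-x∣<∣p∣; x∈p∧x≢y⇒x∈p-y; x∈⁅x⁆; ∣⁅x⁆∣≡1)
open import Data.List using (List; _++_; foldr; length; map; replicate; reverse; [_])
open import Data.List.Membership.Propositional using (_∈_; find; lose)
open import Data.List.Membership.Propositional.Properties using (∈-∃++; ∈-insert; ∈-++⁺ˡ; ∈-++⁺ʳ; ∈-map⁺; ∈-map⁻)
open import Data.List.Properties using (length-++; length-++-comm; length-replicate; length-reverse; unfold-reverse; reverse-involutive; ++-assoc)
open import Data.List.Relation.Unary.All as All using (All; []; _∷_)
import Data.List.Relation.Unary.All.Properties as Allₚ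
open import Data.List.Relation.Unary.Any using (here; there)
open import Data.List.Relation.Unary.Any.Properties using (any⁺; any⁻)
open import Data.Nat using (zero; suc; _+_; _∸_; _<_; _/_; _%_; z≤n; s≤s; ⌊_/2⌋; ⌈_/2⌉)
open import Data.Nat.DivMod
open import Data.Nat.Divisibility using (divides-refl)
open import Data.Nat.Induction using (<-rec)
open import Data.Nat.Properties as ℕₚ using (≤-trans; ≤-refl; ≤-reflexive; ≤-antisym; m≤n⇒m<n∨m≡n; suc-injective; <-irrefl)
open import Data.Nat.Solver using (module +-*-Solver)
open import Data.Product using (∃; proj₁; proj₂)
open import Data.Sum using (inj₁; inj₂)
open import Function using (flip; case_of_)
open import Function.Bundles using (Bijection; Equivalence; mk⇔)
open import Relation.Binary.Definitions using (DecidableEquality; Tri; tri<; tri≈; tri>)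
open import Relation.Binary.PropositionalEquality hiding ([_])
open import Relation.Nullary using (¬_; Dec; yes; no)
open import Relation.Nullary.Decidable using (_⊎-dec_; _×-dec_; ¬?; map′; toWitness; fromWitness; ⌊_⌋)
open import Relation.Unary using (Decidable)
open +-*-Solver using (solve; _:+_; _:=_; con)

-- Groups in which the word lengths of g and g⁻¹ determine g

-- Minimality supplies the equations. Let `g` be a factor that by itself makes a circuit of length
-- `K` exceptional. A complement of `g` shorter than the one in the circuit would close up with `g`
-- to a shorter exceptional circuit, so `ℓ (g ⁻¹)` is `K` minus the length of the factor. Thinness
-- then identifies any two such factors of equal length on which `ℓ` agrees. The obstacle is the
-- value of `ℓ`: a product of two letters may again be a letter, a product of three may be shorter
-- still, and most of the work is to exclude such coincidences by contracting the product inside the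
-- circuit. Contraction and completion may create or cancel the central involution; so circuits are
-- counted with at most one copy of it, and its parity has to be controlled along with the
-- inequivalent letters. The clauses of `QP` on orders and lengths, not merely `y² = z`, keep each
-- class to at most two letters: a circuit within one class is then a power of one letter, or
-- contains a letter together with its square.

record ThinGroup : Set₁ where
  infixr 7 _∙_
  infix 8 _⁻¹
  field
    G       : Set
    _∙_     : G → G → G
    ε       : G
    _⁻¹     : G → G
    isGroup : IsGroup _≡_ _∙_ ε _⁻¹
    _≟_     : DecidableEquality G
    S       : G → Set
    S?      : Decidable S
    ε∉S     : ¬ S ε
    ℓ       : G → ℕ

  ev : List G → G
  ev = foldr _∙_ ε

  field
    -- Together the next two fields make `ℓ g` the least length of a word over `S` with value `g`;
    -- in particular `S` generates the group without inverses.
    geodesic : ∀ g → ∃[ w ] (All S w × ev w ≡ g × length w ≡ ℓ g)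
    ℓ-ev≤    : ∀ {w} → All S w → ℓ (ev w) ≤ length w
    thin     : ∀ {g h} → ℓ g ≡ ℓ h → ℓ (g ⁻¹) ≡ ℓ (h ⁻¹) → g ≡ h

module Basics (T : ThinGroup) where
  open ThinGroup T public
  open IsGroup isGroup public using (assoc; identityˡ; identityʳ; inverseˡ; inverseʳ)

  private
    grp : Group 0ℓ 0ℓ
    grp = record { isGroup = isGroup }

  open Algebra.Properties.Group grp public
    using (∙-cancelˡ; ∙-cancelʳ; inverseˡ-unique; inverseʳ-unique; ε⁻¹≈ε; ⁻¹-involutive)

  cancelˡ : ∀ {x y z} → x ∙ y ≡ x ∙ z → y ≡ z
  cancelˡ = ∙-cancelˡ _ _ _

  cancelʳ : ∀ {x y z} → y ∙ x ≡ z ∙ x → y ≡ z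
  cancelʳ = ∙-cancelʳ _ _ _

  fixˡ : ∀ {x y} → x ∙ y ≡ y → x ≡ ε
  fixˡ {x} {y} e = cancelʳ (trans e (sym (identityˡ y)))

  fixʳ : ∀ {x y} → x ∙ y ≡ x → y ≡ ε
  fixʳ {x} {y} e = cancelˡ (trans e (sym (identityʳ x)))

  ∙ε-comm : ∀ {x y} → x ∙ y ≡ ε → y ∙ x ≡ ε
  ∙ε-comm {x} {y} e = trans (cong (y ∙_) (inverseˡ-unique x y e)) (inverseʳ y)

  inv≡ : ∀ {x y} → x ∙ y ≡ ε → x ⁻¹ ≡ y
  inv≡ e = sym (inverseʳ-unique _ _ e)

  merge : ∀ {x y u} t → x ∙ y ≡ u → x ∙ y ∙ t ≡ u ∙ t
  merge {x} {y} t e = trans (sym (assoc x y t)) (cong (_∙ t) e)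

  swap : ∀ {x y} t → x ∙ y ≡ y ∙ x → x ∙ y ∙ t ≡ y ∙ x ∙ t
  swap {x} {y} t e = trans (merge t e) (assoc y x t)

  comm-∙ : ∀ {x y z} → x ∙ y ≡ y ∙ x → x ∙ z ≡ z ∙ x → x ∙ y ∙ z ≡ (y ∙ z) ∙ x
  comm-∙ {x} {y} {z} p q = trans (swap z p) (trans (cong (y ∙_) q) (sym (assoc y z x)))

  comm-ev : ∀ {x w} → All (λ y → x ∙ y ≡ y ∙ x) w → x ∙ ev w ≡ ev w ∙ x
  comm-ev {x} [] = trans (identityʳ x) (sym (identityˡ x))
  comm-ev (p ∷ ps) = comm-∙ p (comm-ev ps)

  -- The centraliser of `x` is closed under inverses, and `y` is the inverse of `z`.
  comm-inv : ∀ {x y z} → y ∙ z ≡ ε → x ∙ z ≡ z ∙ x → x ∙ y ≡ y ∙ x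
  comm-inv {x} {y} {z} e q = cancelʳ (begin
    (x ∙ y) ∙ z  ≡⟨ assoc x y z ⟩
    x ∙ y ∙ z    ≡⟨ cong (x ∙_) e ⟩
    x ∙ ε        ≡⟨ identityʳ x ⟩
    x            ≡⟨ identityˡ x ⟨
    ε ∙ x        ≡⟨ cong (_∙ x) e ⟨
    (y ∙ z) ∙ x  ≡⟨ assoc y z x ⟩
    y ∙ z ∙ x    ≡⟨ cong (y ∙_) q ⟨
    y ∙ x ∙ z    ≡⟨ assoc y x z ⟨
    (y ∙ x) ∙ z  ∎)
    where open ≡-Reasoning

  ev-++ : ∀ u v → ev (u ++ v) ≡ ev u ∙ ev v
  ev-++ [] v = sym (identityˡ (ev v))
  ev-++ (x ∷ u) v = trans (cong (x ∙_) (ev-++ u v)) (sym (assoc x (ev u) (ev v)))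

  ev-rotate : ∀ u v → ev (u ++ v) ≡ ε → ev (v ++ u) ≡ ε
  ev-rotate u v e = trans (ev-++ v u) (∙ε-comm (trans (sym (ev-++ u v)) e))

  ev-singleton : ∀ x → ev [ x ] ≡ x
  ev-singleton x = identityʳ x

  ℓ⁻¹≤ : ∀ {g w} → All S w → g ∙ ev w ≡ ε → ℓ (g ⁻¹) ≤ length w
  ℓ⁻¹≤ Sw e = subst (λ h → ℓ h ≤ _) (sym (inv≡ e)) (ℓ-ev≤ Sw)

  close : ∀ g → ∃[ w ] (All S w × g ∙ ev w ≡ ε × length w ≡ ℓ (g ⁻¹))
  close g with geodesic (g ⁻¹)
  ... | w , Sw , e , l = w , Sw , trans (cong (g ∙_) e) (inverseʳ g) , l

  ℓ≡0 : ∀ {g} → ℓ g ≡ 0 → g ≡ ε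
  ℓ≡0 {g} l with geodesic g
  ... | [] , _ , e , _ = sym e
  ... | _ ∷ _ , _ , _ , l′ with trans l′ l
  ...   | ()

  ℓ≡1 : ∀ {g} → ℓ g ≡ 1 → S g
  ℓ≡1 {g} l with geodesic g
  ... | x ∷ [] , Sx ∷ [] , e , _ = subst S (trans (sym (ev-singleton x)) e) Sx
  ... | [] , _ , e , l′ with trans l′ l
  ...   | ()
  ℓ≡1 {g} l | x ∷ y ∷ w , _ , e , l′ with trans l′ l
  ...   | ()

  S⇒ℓ≡1 : ∀ {x} → S x → ℓ x ≡ 1
  S⇒ℓ≡1 {x} Sx with ℓ x in l | subst (λ g → ℓ g ≤ 1) (ev-singleton x) (ℓ-ev≤ (Sx ∷ []))
  ... | zero | _ = ⊥-elim (ε∉S (subst S (ℓ≡0 l) Sx))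
  ... | suc zero | _ = refl
  ... | suc (suc _) | s≤s ()

  ℓ≡2 : ∀ {g} → ℓ g ≡ 2 → ∃[ x ] ∃[ y ] (S x × S y × g ≡ x ∙ y)
  ℓ≡2 {g} l with geodesic g
  ... | x ∷ y ∷ [] , Sx ∷ Sy ∷ [] , e , _ = x , y , Sx , Sy , trans (sym e)
    (cong (x ∙_) (ev-singleton y))
  ... | [] , _ , e , l′ with trans l′ l
  ...   | ()
  ℓ≡2 {g} l | _ ∷ [] , _ , _ , l′ with trans l′ l
  ...   | ()
  ℓ≡2 {g} l | _ ∷ _ ∷ _ ∷ _ , _ , _ , l′ with trans l′ l
  ...   | ()

  ℓ₂≤2 : ∀ {x y} → S x → S y → ℓ (x ∙ y) ≤ 2
  ℓ₂≤2 {x} {y} Sx Sy = subst (λ g → ℓ (x ∙ g) ≤ 2) (ev-singleton y) (ℓ-ev≤ (Sx ∷ Sy ∷ []))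

  ℓ₃≤3 : ∀ {x y z} → S x → S y → S z → ℓ (x ∙ y ∙ z) ≤ 3
  ℓ₃≤3 {x} {y} {z} Sx Sy Sz = subst (λ g → ℓ (x ∙ y ∙ g) ≤ 3) (ev-singleton z)
    (ℓ-ev≤ (Sx ∷ Sy ∷ Sz ∷ []))

  ℓ≤2-cases : ∀ {g} → ℓ g ≤ 2 → g ≡ ε ⊎ S g ⊎ ℓ g ≡ 2
  ℓ≤2-cases {g} p with ℓ g in l | p
  ... | 0 | _ = inj₁ (ℓ≡0 l)
  ... | 1 | _ = inj₂ (inj₁ (ℓ≡1 l))
  ... | 2 | _ = inj₂ (inj₂ refl)
  ... | suc (suc (suc _)) | s≤s (s≤s ())

  -- The length of a shortest circuit through a letter.
  m : G → ℕ
  m x = suc (ℓ (x ⁻¹))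

  m≤ : ∀ {x t} → All S t → x ∙ ev t ≡ ε → m x ≤ suc (length t)
  m≤ St e = s≤s (ℓ⁻¹≤ St e)

  -- A circuit stays a circuit when rotated, so any of its letters may be taken as the first.
  m≤∈ : ∀ {x w} → All S w → ev w ≡ ε → x ∈ w → m x ≤ length w
  m≤∈ {x} {w} Sw e x∈w with ∈-∃++ x∈w
  ... | u , v , refl = subst (m x ≤_) l
    (m≤ {x} {v ++ u} (Allₚ.++⁺ (All.tail (Allₚ.++⁻ʳ u Sw)) (Allₚ.++⁻ˡ u Sw)) (ev-rotate u (x ∷ v) e))
    where
    l : suc (length (v ++ u)) ≡ length (u ++ x ∷ v)
    l = begin
      suc (length (v ++ u))          ≡⟨ cong suc (length-++ v) ⟩
      length (x ∷ v) + length u      ≡⟨ ℕₚ.+-comm (length (x ∷ v)) _ ⟩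
      length u + length (x ∷ v)      ≡⟨ length-++ u ⟨
      length (u ++ x ∷ v)            ∎
      where open ≡-Reasoning

  m-inj : ∀ {x y} → S x → S y → m x ≡ m y → x ≡ y
  m-inj Sx Sy e = thin (trans (S⇒ℓ≡1 Sx) (sym (S⇒ℓ≡1 Sy))) (ℕₚ.suc-injective e)

  S⇒m≥2 : ∀ {x} → S x → 2 ≤ m x
  S⇒m≥2 {x} Sx with ℓ (x ⁻¹) in l
  ... | zero = ⊥-elim (ε∉S (subst S (trans (sym (⁻¹-involutive x)) (trans (cong _⁻¹ (ℓ≡0 l)) ε⁻¹≈ε))
    Sx))
  ... | suc _ = s≤s (s≤s z≤n)

  m≡2 : ∀ {x y} → S x → S y → x ∙ y ≡ ε → m x ≡ 2
  m≡2 {x} {y} Sx Sy e = cong suc (trans (cong ℓ (inv≡ e)) (S⇒ℓ≡1 Sy))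

  -- Both letters have `m` equal to 2, and `m` is injective on `S`. Thus a letter whose inverse is a
  -- letter is an involution.
  mutually-inverse⇒≡ : ∀ {x y} → S x → S y → x ∙ y ≡ ε → x ≡ y
  mutually-inverse⇒≡ Sx Sy e = m-inj Sx Sy (trans (m≡2 Sx Sy e) (sym (m≡2 Sy Sx (∙ε-comm e))))

  involution-unique : ∀ {a b} → S a → S b → a ∙ a ≡ ε → b ∙ b ≡ ε → a ≡ b
  involution-unique Sa Sb ea eb = m-inj Sa Sb (trans (m≡2 Sa Sa ea) (sym (m≡2 Sb Sb eb)))

-- Reversal of words and the opposite group

All-reverse : ∀ {A : Set} {P : A → Set} {w} → All P w → All P (reverse w)
All-reverse [] = []
All-reverse {w = x ∷ w} (p ∷ ps) = subst (All _) (sym (unfold-reverse x w))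
  (Allₚ.++⁺ (All-reverse ps) (p ∷ []))

module Opposite (T : ThinGroup) where
  open Basics T

  ev-flip : ∀ w → foldr (flip _∙_) ε w ≡ ev (reverse w)
  ev-flip [] = refl
  ev-flip (x ∷ w) = begin
    foldr (flip _∙_) ε w ∙ x  ≡⟨ cong (_∙ x) (ev-flip w) ⟩
    ev (reverse w) ∙ x        ≡⟨ cong (ev (reverse w) ∙_) (ev-singleton x) ⟨
    ev (reverse w) ∙ ev [ x ] ≡⟨ ev-++ (reverse w) [ x ] ⟨
    ev (reverse w ++ [ x ])   ≡⟨ cong ev (unfold-reverse x w) ⟨
    ev (reverse (x ∷ w))      ∎
    where open ≡-Reasoning

  ev-flip-reverse : ∀ w → foldr (flip _∙_) ε (reverse w) ≡ ev w
  ev-flip-reverse w = trans (ev-flip (reverse w)) (cong ev (reverse-involutive w))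

  -- Reversing words preserves lengths and exchanges the factors `ac` and `ca` of circuits, so a
  -- statement about `R` yields the one about `L`.
  opposite : ThinGroup
  opposite = record
    { G = G ; _∙_ = flip _∙_ ; ε = ε ; _⁻¹ = _⁻¹
    ; isGroup = Flip.isGroup isGroup
    ; _≟_ = _≟_ ; S = S ; S? = S? ; ε∉S = ε∉S ; ℓ = ℓ
    ; geodesic = λ g → let w , Sw , e , l = geodesic g in
        reverse w , All-reverse Sw , trans (ev-flip-reverse w) e , trans (length-reverse w) l
    ; ℓ-ev≤ = λ {w} Sw → subst₂ _≤_ (cong ℓ (sym (ev-flip w))) (length-reverse w)
      (ℓ-ev≤ (All-reverse Sw))
    ; thin = thin }

-- Involutory letters are central

module CentralInvolution (T : ThinGroup) (a : ThinGroup.G T) where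
  open Basics T

  NC : G → Set
  NC c = S c × a ∙ c ≢ c ∙ a

  -- No circuit of length K contains the factor ac (R), respectively ca (L), with c not commuting with a.
  R L : ℕ → Set
  R K = ∀ {c t} → NC c → All S t → a ∙ c ∙ ev t ≡ ε → 2 + length t ≡ K → ⊥
  L K = ∀ {c t} → NC c → All S t → c ∙ a ∙ ev t ≡ ε → 2 + length t ≡ K → ⊥

  Comm : G → Set
  Comm x = a ∙ x ≡ x ∙ a

  ev-pull : ∀ {w} r → All Comm w → ev (w ++ a ∷ r) ≡ a ∙ ev (w ++ r)
  ev-pull r [] = refl
  ev-pull {x ∷ w} r (c ∷ cs) = trans (cong (x ∙_) (ev-pull r cs)) (sym (swap _ c))

  -- Prepares a rotation: when the part of a circuit `a w` before `e` is moved to the end, `a`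
  -- stands behind letters commuting with it and can be pulled forward until it follows `e`
  -- directly.
  last-N : ∀ w → All S w →
    All Comm w ⊎ (∃[ w₁ ] ∃[ e ] ∃[ w₂ ] (w ≡ w₁ ++ e ∷ w₂ × NC e × All Comm w₂))
  last-N [] [] = inj₁ []
  last-N (x ∷ w) (Sx ∷ Sw) with last-N w Sw
  ... | inj₂ (w₁ , e , w₂ , refl , Ne , cs) = inj₂ (x ∷ w₁ , e , w₂ , refl , Ne , cs)
  ... | inj₁ cs with (a ∙ x) ≟ (x ∙ a)
  ...   | yes c = inj₁ (c ∷ cs)
  ...   | no ¬c = inj₂ ([] , x , w , refl , (Sx , ¬c) , cs)

  module Step (Sa : S a) (aa : a ∙ a ≡ ε) (K : ℕ)
    (IHR : ∀ {K′} → K′ < K → R K′) (IHL : ∀ {K′} → K′ < K → L K′) where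

    a≢ε : a ≢ ε
    a≢ε refl = ε∉S Sa

    aaˡ : ∀ g → a ∙ a ∙ g ≡ g
    aaˡ g = trans (merge g aa) (identityˡ g)

    aaʳ : ∀ g → (g ∙ a) ∙ a ≡ g
    aaʳ g = trans (assoc g a a) (trans (cong (g ∙_) aa) (identityʳ g))

    -- A shorter complement of `ac` would close up to a shorter circuit with the same factor,
    -- excluded by induction. With `exactL` this gives all such products the same inverse length,
    -- and only their lengths remain to be compared.
    exactR : ∀ {c t} → NC c → All S t → a ∙ c ∙ ev t ≡ ε → 2 + length t ≡ K → 2 + ℓ ((a ∙ c) ⁻¹) ≡ K
    exactR {c} {t} Nc St e l
      with m≤n⇒m<n∨m≡n (≤-trans (s≤s (s≤s (ℓ⁻¹≤ St (trans (assoc a c (ev t)) e)))) (≤-reflexive l))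
    ... | inj₂ eq = eq
    ... | inj₁ lt with close (a ∙ c)
    ...   | t′ , St′ , e′ , l′ = ⊥-elim
      (IHR lt Nc St′ (trans (sym (assoc a c (ev t′))) e′) (cong (2 +_) l′))

    exactL : ∀ {c t} → NC c → All S t → c ∙ a ∙ ev t ≡ ε → 2 + length t ≡ K → 2 + ℓ ((c ∙ a) ⁻¹) ≡ K
    exactL {c} {t} Nc St e l
      with m≤n⇒m<n∨m≡n (≤-trans (s≤s (s≤s (ℓ⁻¹≤ St (trans (assoc c a (ev t)) e)))) (≤-reflexive l))
    ... | inj₂ eq = eq
    ... | inj₁ lt with close (c ∙ a)
    ...   | t′ , St′ , e′ , l′ = ⊥-elim
      (IHL lt Nc St′ (trans (sym (assoc c a (ev t′))) e′) (cong (2 +_) l′))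

    N≢a : ∀ {c} → NC c → c ≢ a
    N≢a (_ , nc) refl = nc refl

    ℓ2R : ∀ {c} → NC c → ¬ S (a ∙ c) → ℓ (a ∙ c) ≡ 2
    ℓ2R Nc ns with ℓ≤2-cases (ℓ₂≤2 Sa (proj₁ Nc))
    ... | inj₁ e = ⊥-elim (N≢a Nc (sym (mutually-inverse⇒≡ Sa (proj₁ Nc) e)))
    ... | inj₂ (inj₁ s) = ⊥-elim (ns s)
    ... | inj₂ (inj₂ l) = l

    ℓ2L : ∀ {c} → NC c → ¬ S (c ∙ a) → ℓ (c ∙ a) ≡ 2
    ℓ2L Nc ns with ℓ≤2-cases (ℓ₂≤2 (proj₁ Nc) Sa)
    ... | inj₁ e = ⊥-elim (N≢a Nc (mutually-inverse⇒≡ (proj₁ Nc) Sa e))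
    ... | inj₂ (inj₁ s) = ⊥-elim (ns s)
    ... | inj₂ (inj₂ l) = l

    -- If u = ax were a letter, then every letter of w not commuting with a would be u.
    module LengthOne {x w} (Nx : NC x) (Sw : All S w) (circ : a ∙ x ∙ ev w ≡ ε) (lK : 2 + length w ≡ K)
      (Su : S (a ∙ x)) where

      u : G
      u = a ∙ x

      au : a ∙ u ≡ x
      au = aaˡ x

      uw : u ∙ ev w ≡ ε
      uw = trans (assoc a x (ev w)) circ

      Nu : NC u
      Nu = Su , λ e → proj₂ Nx (sym (trans (cong (_∙ a) (trans (sym au) e)) (aaʳ u)))

      mu : suc (m u) ≡ K
      mu = exactR Nx Sw circ lK

      by-m : ∀ {v} → S v → suc (m v) ≡ K → v ≡ u
      by-m Sv e = m-inj Sv Su (suc-injective (trans e (sym mu)))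

      -- The circuit gives `m x ≤ K`. The value `K - 1` would give `x = u`; below that, `x = au`
      -- turns a shortest circuit through `x` into one with the factor `au` that is shorter than
      -- `K`.
      mx : m x ≡ K
      mx with m≤n⇒m<n∨m≡n (subst (m x ≤_) lK (m≤∈ (Sa ∷ proj₁ Nx ∷ Sw) circ (there (here refl))))
      ... | inj₂ e = e
      ... | inj₁ lt with m≤n⇒m<n∨m≡n lt
      ...   | inj₂ e = ⊥-elim (a≢ε (fixˡ (sym (by-m (proj₁ Nx) e))))
      ...   | inj₁ lt′ with close x
      ...     | t , St , e , l = ⊥-elim
        (IHR lt′ Nu St (trans (cong (a ∙_) (assoc a x (ev t))) (trans (aaˡ _) e)) (cong (2 +_) l))

      -- If `m e < m u`, inserting `aa` into a shortest circuit `e t` yields both `a e t a` and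
      -- `e a a t`. By induction they cannot be shorter than `K`, so `ae` and `ea` have the same
      -- inverse length; neither is a letter, so they would be equal.
      only-u : ∀ {e} → NC e → e ∈ w → e ≡ u
      only-u {e} Ne e∈w with m≤n⇒m<n∨m≡n
        (≤-trans (m≤∈ (Su ∷ Sw) uw (there e∈w)) (≤-reflexive (suc-injective (trans lK (sym mu)))))
      ... | inj₂ eq = m-inj (proj₁ Ne) Su eq
      ... | inj₁ lt with close e
      ...   | t , St , et , l = ⊥-elim
        (proj₂ Ne (thin (trans lR (sym lL)) (suc-injective (suc-injective (trans eR (sym eL))))))
        where
        bound : suc (suc (m e)) ≤ K
        bound = subst (suc (suc (m e)) ≤_) mu (s≤s lt)
        ae-circ : a ∙ e ∙ ev (t ++ [ a ]) ≡ ε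
        ae-circ = begin
          a ∙ e ∙ ev (t ++ [ a ])   ≡⟨ cong (λ h → a ∙ e ∙ h)
            (trans (ev-++ t [ a ]) (cong (ev t ∙_) (ev-singleton a))) ⟩
          a ∙ e ∙ ev t ∙ a          ≡⟨ cong (a ∙_) (merge a et) ⟩
          a ∙ ε ∙ a                 ≡⟨ cong (a ∙_) (identityˡ a) ⟩
          a ∙ a                     ≡⟨ aa ⟩
          ε                         ∎
          where open ≡-Reasoning
        ea-circ : e ∙ a ∙ ev (a ∷ t) ≡ ε
        ea-circ = trans (cong (e ∙_) (aaˡ (ev t))) et
        lenL : 2 + length (a ∷ t) ≡ suc (suc (m e))
        lenL = cong (3 +_) l
        lenR : 2 + length (t ++ [ a ]) ≡ suc (suc (m e))
        lenR = trans (cong (2 +_) (length-++-comm t [ a ])) lenL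
        tight : suc (suc (m e)) ≡ K
        tight with m≤n⇒m<n∨m≡n bound
        ... | inj₂ eq = eq
        ... | inj₁ lt′ = ⊥-elim (IHL lt′ Ne (Sa ∷ St) ea-circ lenL)
        eR : 2 + ℓ ((a ∙ e) ⁻¹) ≡ K
        eR = exactR Ne (Allₚ.++⁺ St (Sa ∷ [])) ae-circ (trans lenR tight)
        eL : 2 + ℓ ((e ∙ a) ⁻¹) ≡ K
        eL = exactL Ne (Sa ∷ St) ea-circ (trans lenL tight)
        lR : ℓ (a ∙ e) ≡ 2
        lR = ℓ2R Ne λ s → <-irrefl mx (subst (λ h → m h < K) (cancelˡ (by-m s eR))
          (≤-trans (ℕₚ.n≤1+n _) bound))
        lL : ℓ (e ∙ a) ≡ 2
        lL = ℓ2L Ne λ s → IHL bound Nu St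
          (trans (sym (assoc u a (ev t)))
            (trans (cong (_∙ ev t) (trans (cong (_∙ a) (sym (by-m s eL))) (aaʳ e))) et))
          (cong (2 +_) l)

      -- Some letter of `w` fails to commute with `a`, for otherwise `u`, the inverse of `ev w`,
      -- would commute too. The last such letter is `u`, and rotation brings the leading `a`
      -- directly behind it.
      type-ua : 2 + ℓ ((u ∙ a) ⁻¹) ≡ K × ℓ (u ∙ a) ≡ 2
      type-ua with last-N w Sw
      ... | inj₁ cs = ⊥-elim (proj₂ Nu (comm-inv uw (comm-ev cs)))
      ... | inj₂ (w₁ , e , w₂ , refl , Ne , cs) with only-u Ne (∈-insert w₁)
      ...   | refl = tight , ℓ2L Nu λ s → a≢ε (fixʳ (by-m s tight))
        where
        Sr : All S (w₂ ++ x ∷ w₁)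
        Sr = Allₚ.++⁺ (All.tail (Allₚ.++⁻ʳ w₁ Sw)) (proj₁ Nx ∷ Allₚ.++⁻ˡ w₁ Sw)
        er : u ∙ a ∙ ev (w₂ ++ x ∷ w₁) ≡ ε
        er = trans (cong (u ∙_) (sym (ev-pull (x ∷ w₁) cs))) (ev-rotate (a ∷ x ∷ w₁) (u ∷ w₂) circ)
        lr : 2 + length (w₂ ++ x ∷ w₁) ≡ K
        lr = trans (cong suc (length-++-comm (u ∷ w₂) (x ∷ w₁))) lK
        tight : 2 + ℓ ((u ∙ a) ⁻¹) ≡ K
        tight = exactL Nu Sr er lr

    -- Let `y` follow `x`. Since `m x = K`, the product `xy` has inverse length `K - 2`, as `u` and
    -- `ua` have. So either `xy = u`, which leaves a shorter circuit with the factor `au`, or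
    -- `xy = ua`, which is refuted by computing with relations.
    ax∉S : ∀ {x w} → NC x → All S w → a ∙ x ∙ ev w ≡ ε → 2 + length w ≡ K → ¬ S (a ∙ x)
    ax∉S {x} {[]} Nx Sw circ lK Su = ε∉S (subst S (trans (cong (a ∙_) (sym (identityʳ x))) circ) Su)
    ax∉S {x} {y ∷ w} Nx (Sy ∷ Sw) circ lK Su = absurd (ℓ≤2-cases (ℓ₂≤2 Sx Sy))
      where
      open LengthOne Nx (Sy ∷ Sw) circ lK Su
      Sx : S x
      Sx = proj₁ Nx
      m≢2 : m x ≢ 2
      m≢2 e with trans lK (trans (sym mx) e)
      ... | ()
      xy-circ : (x ∙ y) ∙ ev (w ++ [ a ]) ≡ ε
      xy-circ = trans (assoc x y _) (ev-rotate [ a ] (x ∷ y ∷ w) circ)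
      xy-exact : 2 + ℓ ((x ∙ y) ⁻¹) ≡ K
      xy-exact = ≤-antisym
        (≤-trans (s≤s (s≤s (ℓ⁻¹≤ (Allₚ.++⁺ Sw (Sa ∷ [])) xy-circ)))
                 (≤-reflexive (trans (cong (2 +_) (length-++-comm w [ a ])) lK)))
        (lower (close (x ∙ y)))
        where
        lower : ∃[ t ] (All S t × (x ∙ y) ∙ ev t ≡ ε × length t ≡ ℓ ((x ∙ y) ⁻¹)) → K ≤ 2 + ℓ
          ((x ∙ y) ⁻¹)
        lower (t , St , e , l) = subst₂ _≤_ mx (cong (2 +_) l)
          (m≤ (Sy ∷ St) (trans (sym (assoc x y _)) e))
      contra : x ∙ y ≡ u ∙ a → ⊥
      contra e with (a ∙ y) ≟ (y ∙ a)
      -- With `y = u`, conjugation by `a` squares `u`. Applied twice it gives `u = u⁴`, so `u³ = ε`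
      -- and `x² = auau = u³ = ε`, against `m x = K ≥ 3`.
      ... | no nc with only-u (Sy , nc) (here refl)
      ...   | refl = m≢2 (m≡2 Sx Sx xx)
        where
        open ≡-Reasoning
        aua : a ∙ u ∙ a ≡ u ∙ u
        aua = trans (cong (a ∙_) (trans (sym e) (cong (_∙ u) (sym au))))
          (trans (cong (a ∙_) (assoc a u u)) (aaˡ _))
        uuuu : u ≡ u ∙ u ∙ u ∙ u
        uuuu = begin
          u                              ≡⟨ aaʳ u ⟨
          (u ∙ a) ∙ a                    ≡⟨ aaˡ _ ⟨
          a ∙ a ∙ (u ∙ a) ∙ a            ≡⟨ cong (a ∙_) (assoc a (u ∙ a) a) ⟨
          a ∙ (a ∙ u ∙ a) ∙ a            ≡⟨ cong (λ h → a ∙ h ∙ a) aua ⟩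
          a ∙ (u ∙ u) ∙ a                ≡⟨ cong (λ h → a ∙ h) (assoc u u a) ⟩
          a ∙ u ∙ u ∙ a                  ≡⟨ cong (λ h → a ∙ u ∙ h) (aaˡ (u ∙ a)) ⟨
          a ∙ u ∙ a ∙ a ∙ u ∙ a          ≡⟨ cong (λ h → a ∙ u ∙ a ∙ h) aua ⟩
          a ∙ u ∙ a ∙ u ∙ u              ≡⟨ cong (a ∙_) (assoc u a _) ⟨
          a ∙ (u ∙ a) ∙ u ∙ u            ≡⟨ assoc a (u ∙ a) _ ⟨
          (a ∙ u ∙ a) ∙ u ∙ u            ≡⟨ cong (_∙ (u ∙ u)) aua ⟩
          (u ∙ u) ∙ u ∙ u                ≡⟨ assoc u u _ ⟩
          u ∙ u ∙ u ∙ u                  ∎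
        xx : x ∙ x ≡ ε
        xx = begin
          x ∙ x                ≡⟨ cong₂ _∙_ (sym au) (sym au) ⟩
          (a ∙ u) ∙ a ∙ u      ≡⟨ assoc a u _ ⟩
          a ∙ u ∙ a ∙ u        ≡⟨ cong (a ∙_) (assoc u a u) ⟨
          a ∙ (u ∙ a) ∙ u      ≡⟨ assoc a (u ∙ a) u ⟨
          (a ∙ u ∙ a) ∙ u      ≡⟨ cong (_∙ u) aua ⟩
          (u ∙ u) ∙ u          ≡⟨ assoc u u u ⟩
          u ∙ u ∙ u            ≡⟨ fixʳ (sym uuuu) ⟩
          ε                    ∎
      -- Here `uy = aua`, and as `y` commutes with `a`, `uyy = u`. So `y` is an involutory letter,
      -- that is `y = a`, and then `ua = aua`.
      contra e | yes c = a≢ε (fixˡ (cancelʳ (trans aua-eq (sym ua-id))))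
        where
        open ≡-Reasoning
        uy : u ∙ y ≡ a ∙ u ∙ a
        uy = begin
          u ∙ y            ≡⟨ aaˡ _ ⟨
          a ∙ a ∙ u ∙ y    ≡⟨ cong (a ∙_) (assoc a u y) ⟨
          a ∙ (a ∙ u) ∙ y  ≡⟨ cong (λ h → a ∙ h ∙ y) au ⟩
          a ∙ x ∙ y        ≡⟨ cong (a ∙_) e ⟩
          a ∙ u ∙ a        ∎
        yy : y ∙ y ≡ ε
        yy = fixʳ (begin
          u ∙ y ∙ y          ≡⟨ assoc u y y ⟨
          (u ∙ y) ∙ y        ≡⟨ cong (_∙ y) uy ⟩
          (a ∙ u ∙ a) ∙ y    ≡⟨ trans (assoc a _ y) (cong (a ∙_) (assoc u a y)) ⟩
          a ∙ u ∙ a ∙ y      ≡⟨ cong (λ h → a ∙ u ∙ h) c ⟩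
          a ∙ u ∙ y ∙ a      ≡⟨ cong (a ∙_) (assoc u y a) ⟨
          a ∙ (u ∙ y) ∙ a    ≡⟨ cong (λ h → a ∙ h ∙ a) uy ⟩
          a ∙ (a ∙ u ∙ a) ∙ a ≡⟨ cong (a ∙_) (trans (assoc a _ a) (cong (a ∙_) (aaʳ u))) ⟩
          a ∙ a ∙ u          ≡⟨ aaˡ u ⟩
          u                  ∎)
        y≡a : y ≡ a
        y≡a = involution-unique Sy Sa yy aa
        aua-eq : (a ∙ u) ∙ a ≡ u ∙ y
        aua-eq = trans (assoc a u a) (sym uy)
        ua-id : u ∙ a ≡ u ∙ y
        ua-id = cong (u ∙_) (sym y≡a)
      absurd : x ∙ y ≡ ε ⊎ S (x ∙ y) ⊎ ℓ (x ∙ y) ≡ 2 → ⊥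
      absurd (inj₁ e) = m≢2 (m≡2 Sx Sy e)
      absurd (inj₂ (inj₁ s)) = IHR (≤-reflexive lK) Nu Sw
        (trans (cong (λ h → a ∙ h ∙ ev w) (sym (by-m s xy-exact)))
          (trans (cong (a ∙_) (assoc x y _)) circ)) refl
      absurd (inj₂ (inj₂ l)) = contra (thin (trans l (sym (proj₂ type-ua)))
        (suc-injective (suc-injective (trans xy-exact (sym (proj₁ type-ua))))))

    module Rotation
      (¬SR : ∀ {x w} → NC x → All S w → a ∙ x ∙ ev w ≡ ε → 2 + length w ≡ K → ¬ S (a ∙ x))
      (¬SL : ∀ {x w} → NC x → All S w → x ∙ a ∙ ev w ≡ ε → 2 + length w ≡ K → ¬ S (x ∙ a)) where

      RC LC : G → Set
      RC x = NC x × ∃[ t ] (All S t × a ∙ x ∙ ev t ≡ ε × 2 + length t ≡ K)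
      LC x = NC x × ∃[ t ] (All S t × x ∙ a ∙ ev t ≡ ε × 2 + length t ≡ K)

      RC-LC : ∀ {x y} → RC x → LC y → a ∙ x ≡ y ∙ a
      RC-LC (Nx , t , St , e , l) (Ny , t′ , St′ , e′ , l′) = thin
        (trans (ℓ2R Nx (¬SR Nx St e l)) (sym (ℓ2L Ny (¬SL Ny St′ e′ l′))))
        (suc-injective (suc-injective (trans (exactR Nx St e l) (sym (exactL Ny St′ e′ l′)))))

      -- All products ax and xa in circuits of length K are equal, so a can be moved around the circuit,
      -- each letter x ∈ NC that it passes being replaced by d, until it stands in front of d.
      push : ∀ {d} → LC d → ∀ v₁ v₂ → All S (v₁ ++ d ∷ v₂) → a ∙ ev (v₁ ++ d ∷ v₂) ≡ ε →
             suc (length (v₁ ++ d ∷ v₂)) ≡ K → ⊥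
      push ld [] v₂ (Sd ∷ Sv) e l = proj₂ (proj₁ ld) (RC-LC (proj₁ ld , v₂ , Sv , e , l) ld)
      push {d} ld (x ∷ v₁) v₂ (Sx ∷ Sv) e l = turn ((a ∙ x) ≟ (x ∙ a))
        where
        V : List G
        V = v₁ ++ d ∷ v₂
        next : ∀ z → S z → z ∙ a ∙ ev V ≡ ε → ⊥
        next z Sz ez = push ld v₁ (v₂ ++ [ z ])
          (subst (All S) (++-assoc v₁ _ _) (Allₚ.++⁺ Sv (Sz ∷ [])))
          (subst (λ h → a ∙ ev h ≡ ε) (++-assoc v₁ _ _) (ev-rotate [ z ] (a ∷ V) ez))
          (trans (cong (λ h → suc (length h)) (sym (++-assoc v₁ (d ∷ v₂) [ z ])))
            (trans (cong suc (length-++-comm V [ z ])) l))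
        turn : Dec (a ∙ x ≡ x ∙ a) → ⊥
        turn (yes c) = next x Sx (trans (sym (swap _ c)) e)
        turn (no nc) = next d (proj₁ (proj₁ ld))
          (trans (sym (trans (merge _ (RC-LC ((Sx , nc) , V , Sv , e , l) ld)) (assoc d a _))) e)

      -- Taking for `d` the last letter that does not commute with `a`, rotation produces a circuit
      -- with the factor `da`, which is what `push` needs to start.
      stepR : R K
      stepR {c} {t} Nc St e l with last-N (c ∷ t) (proj₁ Nc ∷ St)
      ... | inj₁ (cc ∷ _) = proj₂ Nc cc
      ... | inj₂ (w₁ , d , w₂ , eq , Nd , cs) = push
        (Nd , w₂ ++ w₁ , Allₚ.++⁺ (All.tail (Allₚ.++⁻ʳ w₁ Sv)) (Allₚ.++⁻ˡ w₁ Sv) ,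
          trans (cong (d ∙_) (sym (ev-pull w₁ cs))) (ev-rotate (a ∷ w₁) (d ∷ w₂) ev≡) ,
          trans (cong suc (length-++-comm (d ∷ w₂) w₁)) len) w₁ w₂ Sv ev≡ len
        where
        Sv : All S (w₁ ++ d ∷ w₂)
        Sv = subst (All S) eq (proj₁ Nc ∷ St)
        ev≡ : a ∙ ev (w₁ ++ d ∷ w₂) ≡ ε
        ev≡ = subst (λ h → a ∙ ev h ≡ ε) eq e
        len : suc (length (w₁ ++ d ∷ w₂)) ≡ K
        len = trans (cong (λ h → suc (length h)) (sym eq)) l

module _ (T : ThinGroup) {a : ThinGroup.G T} where
  open Basics T
  open Opposite T
  private
    module C = CentralInvolution T a
    module Cᵒ = CentralInvolution opposite a

  private
    unflip-circ : ∀ {x y w} → (ThinGroup.ev opposite w ∙ x) ∙ y ≡ ε → x ∙ y ∙ ev (reverse w) ≡ ε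
    unflip-circ {x} {y} {w} e = trans (cong (λ h → x ∙ y ∙ h) (sym (ev-flip w)))
      (trans (sym (assoc x y _)) (∙ε-comm (trans (sym (assoc _ x y)) e)))

    flip-circ : ∀ {x y w} → x ∙ y ∙ ev w ≡ ε → (ThinGroup.ev opposite (reverse w) ∙ x) ∙ y ≡ ε
    flip-circ {x} {y} {w} e = trans (cong (λ h → (h ∙ x) ∙ y) (ev-flip-reverse w))
      (trans (assoc _ x y) (∙ε-comm (trans (assoc x y _) e)))

  -- `R` and `L` go through one strong induction, because the step for either uses shorter circuits
  -- of both kinds; the `L` half is the `R` half in the opposite group.
  involution-central : S a → a ∙ a ≡ ε → ∀ {c} → S c → a ∙ c ≡ c ∙ a
  involution-central Sa aa {c} Sc with (a ∙ c) ≟ (c ∙ a)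
  ... | yes e = e
  ... | no nc with close (a ∙ c)
  ...   | t , St , e , l = ⊥-elim
    (proj₁ (all (2 + length t)) (Sc , nc) St (trans (sym (assoc a c _)) e) refl)
    where
    flipN : ∀ {x} → C.NC x → Cᵒ.NC x
    flipN (s , n) = s , λ e → n (sym e)
    unflipN : ∀ {x} → Cᵒ.NC x → C.NC x
    unflipN (s , n) = s , λ e → n (sym e)
    len : ∀ {K} (t : List G) → 2 + length t ≡ K → 2 + length (reverse t) ≡ K
    len t l = trans (cong (2 +_) (length-reverse t)) l
    step : ∀ K → (∀ {K′} → K′ < K → C.R K′ × C.L K′) → C.R K × C.L K
    step K IH = Rot.stepR , λ {_} {t} Nc St e l → Rotᵒ.stepR (flipN Nc) (All-reverse St)
      (flip-circ {w = t} e) (len t l)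
      where
      module St = C.Step Sa aa K (λ lt → proj₁ (IH lt)) (λ lt → proj₂ (IH lt))
      module Stᵒ = Cᵒ.Step Sa aa K
        (λ lt {_} {t} Nc St e l → proj₂ (IH lt) (unflipN Nc) (All-reverse St) (unflip-circ {w = t} e)
          (len t l))
        (λ lt {_} {t} Nc St e l → proj₁ (IH lt) (unflipN Nc) (All-reverse St) (unflip-circ {w = t} e)
          (len t l))
      module Rot = St.Rotation St.ax∉S
        (λ {_} {t} Nc St e l → Stᵒ.ax∉S (flipN Nc) (All-reverse St) (flip-circ {w = t} e) (len t l))
      module Rotᵒ = Stᵒ.Rotation Stᵒ.ax∉S
        (λ {_} {t} Nc St′ e l → St.ax∉S (unflipN Nc) (All-reverse St′) (unflip-circ {w = t} e)
          (len t l))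
    all : ∀ K → C.R K × C.L K
    all = <-rec _ (λ K IH → step K IH)

-- Letters and their equivalence

module Letters (T : ThinGroup) where
  open Basics T public

  ℓε : ℓ ε ≡ 0
  ℓε = ℕₚ.n≤0⇒n≡0 (ℓ-ev≤ [])

  ℓε⁻¹ : ∀ {g} → g ≡ ε → ℓ (g ⁻¹) ≡ 0
  ℓε⁻¹ e = trans (cong ℓ (trans (cong _⁻¹ e) ε⁻¹≈ε)) ℓε

  central : ∀ {a} → S a → a ∙ a ≡ ε → ∀ g → a ∙ g ≡ g ∙ a
  central {a} Sa aa g with geodesic g
  ... | w , Sw , e , _ = subst (λ h → a ∙ h ≡ h ∙ a) e
    (comm-ev (All.map (involution-central T Sa aa) Sw))

  S′ : G → Set
  S′ x = S x × x ∙ x ≢ ε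

  -- Words are taken modulo the central involution: a central factor z of cost k and a list of letters of S′.
  data Cent : G → ℕ → Set where
    one : Cent ε 0
    inv : ∀ {a} → S a → a ∙ a ≡ ε → Cent a 1

  Cent-central : ∀ {z k} → Cent z k → ∀ g → z ∙ g ≡ g ∙ z
  Cent-central one g = trans (identityˡ g) (sym (identityʳ g))
  Cent-central (inv Sa aa) g = central Sa aa g

  Cent-swap : ∀ {z k} → Cent z k → ∀ g h → z ∙ g ∙ h ≡ g ∙ z ∙ h
  Cent-swap Z g h = swap h (Cent-central Z g)

  S′≢inv : ∀ {x a} → S′ x → a ∙ a ≡ ε → x ≢ a
  S′≢inv (_ , n) aa refl = n aa

  S′≢ε : ∀ {x} → S′ x → x ≢ ε
  S′≢ε (s , _) refl = ε∉S s

  rot : ∀ {z k} → Cent z k → ∀ u v → z ∙ ev (u ++ v) ≡ ε → z ∙ ev (v ++ u) ≡ ε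
  rot {z} Z u v e = begin
    z ∙ ev (v ++ u)    ≡⟨ cong (z ∙_) (ev-++ v u) ⟩
    z ∙ ev v ∙ ev u    ≡⟨ Cent-swap Z (ev v) (ev u) ⟩
    ev v ∙ z ∙ ev u    ≡⟨ ∙ε-comm (trans (assoc z _ _) (trans (cong (z ∙_) (sym (ev-++ u v))) e)) ⟩
    ε                  ∎
    where open ≡-Reasoning

  -- All involutory letters are one and the same central element, so they collect in front and
  -- cancel in pairs; only this cancellation shortens the word.
  normalise : ∀ w → All S w → ∃[ z ] ∃[ k ] ∃[ v ]
    (Cent z k × All S′ v × z ∙ ev v ≡ ev w × k + length v ≤ length w)
  normalise [] [] = ε , 0 , [] , one , [] , identityˡ ε , z≤n
  normalise (x ∷ w) (Sx ∷ Sw) with normalise w Sw | (x ∙ x) ≟ ε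
  ... | z , k , v , Z , Sv , e , l | no n = z , k , x ∷ v , Z , (Sx , n) ∷ Sv ,
        trans (Cent-swap Z x (ev v)) (cong (x ∙_) e) , ≤-trans (≤-reflexive (ℕₚ.+-suc k (length v)))
          (s≤s l)
  ... | _ , _ , v , one , Sv , e , l | yes xx = x , 1 , v , inv Sx xx , Sv , cong (x ∙_)
    (trans (sym (identityˡ _)) e) , s≤s l
  ... | a , _ , v , inv Sa aa , Sv , e , l | yes xx = ε , 0 , v , one , Sv ,
        trans (sym (trans (sym (assoc x a _))
          (cong (_∙ ev v) (trans (cong (x ∙_) (involution-unique Sa Sx aa xx)) xx)))) (cong (x ∙_) e) ,
        ≤-trans (ℕₚ.n≤1+n _) (≤-trans l (ℕₚ.n≤1+n _))

  complete : ∀ g → ∃[ z ] ∃[ k ] ∃[ t ]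
    (Cent z k × All S′ t × z ∙ g ∙ ev t ≡ ε × k + length t ≤ ℓ (g ⁻¹))
  complete g with close g
  ... | w , Sw , e , l with normalise w Sw
  ...   | z , k , t , Z , St , e′ , l′ = z , k , t , Z , St ,
          trans (Cent-swap Z g (ev t)) (trans (cong (g ∙_) e′) e) , ≤-trans l′ (≤-reflexive l)

  ℓ≤ : ∀ {z k t} → Cent z k → All S′ t → ℓ (z ∙ ev t) ≤ k + length t
  ℓ≤ {t = t} one St = subst (λ h → ℓ h ≤ length t) (sym (identityˡ _)) (ℓ-ev≤ (All.map proj₁ St))
  ℓ≤ (inv Sa _) St = ℓ-ev≤ (Sa ∷ All.map proj₁ St)

  upper : ∀ {z k g t} → Cent z k → All S′ t → z ∙ g ∙ ev t ≡ ε → ℓ (g ⁻¹) ≤ k + length t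
  upper {z} {k} {g} {t} Z St e = subst (λ h → ℓ h ≤ k + length t)
    (sym (inv≡ (trans (sym (Cent-swap Z g (ev t))) e))) (ℓ≤ Z St)

  m-upper₁ : ∀ {z k x t} → Cent z k → All S′ t → z ∙ x ∙ ev t ≡ ε → m x ≤ k + suc (length t)
  m-upper₁ {k = k} {t = t} Z St e = ≤-trans (s≤s (upper Z St e))
    (≤-reflexive (sym (ℕₚ.+-suc k (length t))))

  m-upper : ∀ {z k x v} → Cent z k → All S′ v → z ∙ ev v ≡ ε → x ∈ v → m x ≤ k + length v
  m-upper {k = k} {x} Z Sv e x∈v with ∈-∃++ x∈v
  ... | u , v , refl = ≤-trans
    (m-upper₁ {t = v ++ u} Z (Allₚ.++⁺ (All.tail (Allₚ.++⁻ʳ u Sv)) (Allₚ.++⁻ˡ u Sv))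
      (rot Z u (x ∷ v) e))
    (≤-reflexive (cong (k +_) (length-++-comm (x ∷ v) u)))

  m-complete : ∀ x → ∃[ z ] ∃[ k ] ∃[ t ]
    (Cent z k × All S′ t × z ∙ x ∙ ev t ≡ ε × k + suc (length t) ≡ m x)
  m-complete x with complete x
  ... | z , k , t , Z , St , e , l = z , k , t , Z , St , e ,
    ≤-antisym (≤-trans (≤-reflexive (ℕₚ.+-suc k _)) (s≤s l)) (m-upper₁ Z St e)

  S′⇒m≥3 : ∀ {x} → S′ x → 3 ≤ m x
  S′⇒m≥3 {x} (Sx , n) with m≤n⇒m<n∨m≡n (S⇒m≥2 Sx)
  ... | inj₁ lt = lt
  ... | inj₂ e = ⊥-elim (n (trans
    (cong (x ∙_) (mutually-inverse⇒≡ Sx (ℓ≡1 (suc-injective (sym e))) (inverseʳ x))) (inverseʳ x)))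

  root⇒m≡3 : ∀ {a x} → S a → a ∙ a ≡ ε → S′ x → x ∙ x ≡ a → m x ≡ 3
  root⇒m≡3 {a} {x} Sa aa Sx e = ≤-antisym
    (m-upper (inv Sa aa) (Sx ∷ Sx ∷ [])
      (trans (cong (λ h → a ∙ x ∙ h) (identityʳ x)) (trans (cong (a ∙_) e) aa)) (here refl))
    (S′⇒m≥3 Sx)

  root-unique : ∀ {a x y} → S a → a ∙ a ≡ ε → S′ x → S′ y → x ∙ x ≡ a → y ∙ y ≡ a → x ≡ y
  root-unique Sa aa Sx Sy ex ey = m-inj (proj₁ Sx) (proj₁ Sy)
    (trans (root⇒m≡3 Sa aa Sx ex) (sym (root⇒m≡3 Sa aa Sy ey)))

  pow : G → ℕ → G
  pow x n = ev (replicate n x)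

  pow-+ : ∀ x i j → pow x (i + j) ≡ pow x i ∙ pow x j
  pow-+ x zero j = sym (identityˡ _)
  pow-+ x (suc i) j = trans (cong (x ∙_) (pow-+ x i j)) (sym (assoc x _ _))

  pow-drop : ∀ {x q n} → pow x q ≡ ε → q ≤ n → pow x n ≡ pow x (n ∸ q)
  pow-drop {x} {q} {n} e le = begin
    pow x n                  ≡⟨ cong (pow x) (ℕₚ.m+[n∸m]≡n le) ⟨
    pow x (q + (n ∸ q))      ≡⟨ pow-+ x q _ ⟩
    pow x q ∙ pow x (n ∸ q)  ≡⟨ cong (_∙ pow x (n ∸ q)) e ⟩
    ε ∙ pow x (n ∸ q)        ≡⟨ identityˡ _ ⟩
    pow x (n ∸ q)            ∎
    where open ≡-Reasoning

  comm-pow : ∀ {x y} n → x ∙ y ≡ y ∙ x → x ∙ pow y n ≡ pow y n ∙ x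
  comm-pow n e = comm-ev (Allₚ.replicate⁺ n e)

  pow-∙ : ∀ {x y} n → x ∙ y ≡ y ∙ x → pow (x ∙ y) n ≡ pow x n ∙ pow y n
  pow-∙ zero e = sym (identityˡ ε)
  pow-∙ {x} {y} (suc n) e = begin
    (x ∙ y) ∙ pow (x ∙ y) n     ≡⟨ cong ((x ∙ y) ∙_) (pow-∙ n e) ⟩
    (x ∙ y) ∙ pow x n ∙ pow y n ≡⟨ assoc x y _ ⟩
    x ∙ y ∙ pow x n ∙ pow y n   ≡⟨ cong (x ∙_) (swap _ (comm-pow n (sym e))) ⟩
    x ∙ pow x n ∙ y ∙ pow y n   ≡⟨ assoc x _ _ ⟨
    (x ∙ pow x n) ∙ y ∙ pow y n ∎
    where open ≡-Reasoning

  order-≥ : ∀ {x q} → S x → pow x (suc q) ≡ ε → m x ≤ suc q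
  order-≥ {x} {q} Sx e = subst (λ h → m x ≤ suc h) (length-replicate q) (m≤ (Allₚ.replicate⁺ q Sx) e)

  -- y and z = y² generate a cyclic group in which {y , z} looks like {1 , 2}.
  QP : G → G → Set
  QP y z = y ∙ y ≡ z × pow z (m z) ≡ ε × m y ≡ suc (m z)

  QP? : ∀ y z → Dec (QP y z)
  QP? y z = ((y ∙ y) ≟ z) ×-dec (pow z (m z) ≟ ε) ×-dec (m y ℕₚ.≟ suc (m z))

  infix 4 _~_
  _~_ : G → G → Set
  x ~ y = x ≡ y ⊎ QP x y ⊎ QP y x

  _~?_ : ∀ x y → Dec (x ~ y)
  x ~? y = (x ≟ y) ⊎-dec (QP? x y ⊎-dec QP? y x)

  ~-refl : ∀ {x} → x ~ x
  ~-refl = inj₁ refl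

  ~-sym : ∀ {x y} → x ~ y → y ~ x
  ~-sym (inj₁ e) = inj₁ (sym e)
  ~-sym (inj₂ (inj₁ q)) = inj₂ (inj₂ q)
  ~-sym (inj₂ (inj₂ q)) = inj₂ (inj₁ q)

  -- The exponent `m y = m z + 1` kills `y` and hence its square `z`; so does the exponent `m z`,
  -- and consecutive exponents force `z = ε`. This is what makes `~` transitive with classes of at
  -- most two letters.
  QP-no-chain : ∀ {x y z} → S′ z → QP x y → ¬ QP y z
  QP-no-chain {x} {y} {z} Sz (_ , oy , _) (refl , oz , my) = S′≢ε Sz (begin
    z                             ≡⟨ identityʳ z ⟨
    z ∙ ε                         ≡⟨ cong (z ∙_) oz ⟨
    pow z (suc (m z))             ≡⟨ pow-∙ (suc (m z)) refl ⟩
    pow y (suc (m z)) ∙ pow y (suc (m z)) ≡⟨ cong₂ _∙_ oy′ oy′ ⟩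
    ε ∙ ε                         ≡⟨ identityˡ ε ⟩
    ε                             ∎)
    where
    open ≡-Reasoning
    oy′ : pow y (suc (m z)) ≡ ε
    oy′ = trans (cong (pow y) (sym my)) oy

  QP-injˡ : ∀ {x y z} → S x → S y → QP x z → QP y z → x ≡ y
  QP-injˡ Sx Sy (_ , _ , e) (_ , _ , e′) = m-inj Sx Sy (trans e (sym e′))

  ~-trans : ∀ {x y z} → S′ x → S′ y → S′ z → x ~ y → y ~ z → x ~ z
  ~-trans _ _ _ (inj₁ refl) q = q
  ~-trans _ _ _ (inj₂ p) (inj₁ refl) = inj₂ p
  ~-trans _ _ Sz (inj₂ (inj₁ p)) (inj₂ (inj₁ q)) = ⊥-elim (QP-no-chain Sz p q)
  ~-trans Sx _ Sz (inj₂ (inj₁ p)) (inj₂ (inj₂ q)) = inj₁ (QP-injˡ (proj₁ Sx) (proj₁ Sz) p q)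
  ~-trans _ _ _ (inj₂ (inj₂ p)) (inj₂ (inj₁ q)) = inj₁ (trans (sym (proj₁ p)) (proj₁ q))
  ~-trans Sx _ _ (inj₂ (inj₂ p)) (inj₂ (inj₂ q)) = ⊥-elim (QP-no-chain Sx q p)

  QP-comm : ∀ {x y} → QP x y → x ∙ y ≡ y ∙ x
  QP-comm {x} (refl , _) = sym (assoc x x x)

  ~-comm : ∀ {x y} → x ~ y → x ∙ y ≡ y ∙ x
  ~-comm (inj₁ refl) = refl
  ~-comm (inj₂ (inj₁ q)) = QP-comm q
  ~-comm (inj₂ (inj₂ q)) = sym (QP-comm q)

  -- If `d = u²`, the length forces `q = m d`, so `d^q = ε` and `u = ε`. If `u = d²`, then `d` would
  -- lie on a circuit of length `m u`, although `m d = m u + 1`.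
  partner-word : ∀ {u d q} → S′ u → S′ d → u ~ d → u ≢ d → u ∙ pow d q ≡ ε → m u ≢ suc q
  partner-word _ _ (inj₁ e) n _ _ = n e
  partner-word {u} {d} {q} Su _ (inj₂ (inj₁ (_ , od , mu))) _ e eq = S′≢ε Su
    (trans (sym (trans (cong (u ∙_) (trans (cong (pow d) (suc-injective (trans (sym eq) mu))) od))
      (identityʳ u))) e)
  partner-word {u} {d} {zero} Su _ (inj₂ (inj₂ _)) _ e eq = S′≢ε Su (trans (sym (identityʳ u)) e)
  partner-word {u} {d} {suc q} Su Sd (inj₂ (inj₂ (_ , _ , md))) _ e eq = <-irrefl refl
    (≤-trans (≤-reflexive (sym md)) (≤-trans
      (m-upper one (Su ∷ Allₚ.replicate⁺ (suc q) Sd) (trans (identityˡ _) e) (there (here refl)))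
      (≤-reflexive (trans (cong suc (length-replicate (suc q))) (sym eq)))))

  -- Equivalent letters commute, being equal or one the square of the other.
  pull : ∀ {x v} → x ∈ v → All S′ v → (∀ {y} → y ∈ v → y ~ x) →
    ∃[ v′ ] (All S′ v′ × ev v ≡ x ∙ ev v′ × ev v ≡ ev v′ ∙ x × length v ≡ suc (length v′) ×
      (∀ {y} → y ∈ v′ → y ∈ v))
  pull {x} x∈v Sv all~ with ∈-∃++ x∈v
  ... | v₁ , v₂ , refl = v₁ ++ v₂ , Allₚ.++⁺ (Allₚ.++⁻ˡ v₁ Sv) (All.tail (Allₚ.++⁻ʳ v₁ Sv)) , left ,
    trans left (comm-ev {w = v₁ ++ v₂}
      (Allₚ.++⁺ {xs = v₁} (All.tabulate (λ y∈ → sym (~-comm (all~ (∈-++⁺ˡ y∈)))))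
                                  (All.tabulate (λ y∈ → sym (~-comm (all~ (∈-++⁺ʳ v₁ (there y∈)))))))) ,
    trans (length-++-comm v₁ (x ∷ v₂)) (cong suc (length-++-comm v₂ v₁)) ,
    sub v₁
    where
    open ≡-Reasoning
    left : ev (v₁ ++ x ∷ v₂) ≡ x ∙ ev (v₁ ++ v₂)
    left = begin
      ev (v₁ ++ x ∷ v₂)     ≡⟨ ev-++ v₁ (x ∷ v₂) ⟩
      ev v₁ ∙ x ∙ ev v₂     ≡⟨ swap (ev v₂)
        (comm-ev {w = v₁} (All.tabulate (λ y∈ → sym (~-comm (all~ (∈-++⁺ˡ y∈)))))) ⟨
      x ∙ ev v₁ ∙ ev v₂     ≡⟨ cong (x ∙_) (ev-++ v₁ v₂) ⟨
      x ∙ ev (v₁ ++ v₂)     ∎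
    sub : ∀ u {y} → y ∈ u ++ v₂ → y ∈ u ++ x ∷ v₂
    sub [] p = there p
    sub (_ ∷ u) (here e) = here e
    sub (_ ∷ u) (there p) = there (sub u p)

  ∈-or-avoids : ∀ x t → x ∈ t ⊎ (∀ {s} → s ∈ t → s ≢ x)
  ∈-or-avoids x [] = inj₂ λ ()
  ∈-or-avoids x (s ∷ t) with s ≟ x | ∈-or-avoids x t
  ... | yes refl | _ = inj₁ (here refl)
  ... | no _ | inj₁ p = inj₁ (there p)
  ... | no n | inj₂ f = inj₂ λ { (here refl) → n ; (there p) → f p }

  pure? : ∀ c t → t ≡ replicate (length t) c ⊎ (∃[ d ] (d ∈ t × d ≢ c))
  pure? c [] = inj₁ refl
  pure? c (d ∷ t) with d ≟ c | pure? c t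
  ... | no n | _ = inj₂ (d , here refl , n)
  ... | yes refl | inj₁ e = inj₁ (cong (c ∷_) e)
  ... | yes _ | inj₂ (d′ , p , n) = inj₂ (d′ , there p , n)

  partner-unique : ∀ {c d d′} → S′ c → S′ d → S′ d′ → d ~ c → d ≢ c → d′ ~ c → d′ ≢ c → d ≡ d′
  partner-unique _ _ _ (inj₁ e) n _ _ = ⊥-elim (n e)
  partner-unique _ _ _ (inj₂ _) _ (inj₁ e) n = ⊥-elim (n e)
  partner-unique _ Sd Sd′ (inj₂ (inj₁ p)) _ (inj₂ (inj₁ q)) _ = QP-injˡ (proj₁ Sd) (proj₁ Sd′) p q
  partner-unique _ Sd Sd′ (inj₂ (inj₁ p)) _ (inj₂ (inj₂ q)) _ = ⊥-elim (QP-no-chain Sd′ p q)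
  partner-unique _ Sd Sd′ (inj₂ (inj₂ p)) _ (inj₂ (inj₁ q)) _ = ⊥-elim (QP-no-chain Sd q p)
  partner-unique _ _ _ (inj₂ (inj₂ p)) _ (inj₂ (inj₂ q)) _ = trans (sym (proj₁ p)) (proj₁ q)

  -- A class has at most two letters, so without `u` only its partner is left.
  avoiding : ∀ {u t} → S′ u → All S′ t → (∀ {y} → y ∈ t → y ~ u) → (∀ {y} → y ∈ t → y ≢ u) →
    t ≡ [] ⊎ (∃[ d ] (d ∈ t × t ≡ replicate (length t) d))
  avoiding {u} {[]} _ _ _ _ = inj₁ refl
  avoiding {u} {d ∷ t} Su (Sd ∷ St) all~ ≢u with pure? d (d ∷ t)
  ... | inj₁ e = inj₂ (d , here refl , e)
  ... | inj₂ (d′ , p , n) = ⊥-elim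
    (n (partner-unique Su (All.lookup (Sd ∷ St) p) Sd (all~ p) (≢u p) (all~ (here refl))
      (≢u (here refl))))

  -- An odd number of involutions is compatible only with square roots of the involution, as in ℤ₄ with {1 , 2}.
  Bad : G → List G → Set
  Bad z v = (∃[ x ] ∃[ y ] (x ∈ v × y ∈ v × ¬ x ~ y)) ⊎ (z ≢ ε × ∃[ x ] (x ∈ v × x ∙ x ≢ z))

  NoBadBelow : ℕ → Set
  NoBadBelow M = ∀ {z k v} → Cent z k → All S′ v → z ∙ ev v ≡ ε → k + length v < M → ¬ Bad z v

-- A shortest bad circuit

module Minimal (T : ThinGroup) (M : ℕ)
  (IH : Letters.NoBadBelow T M) where
  open Letters T public

  good~ : ∀ {z k v} → Cent z k → All S′ v → z ∙ ev v ≡ ε → k + length v < M → ∀ {x y} → x ∈ v → y ∈ v →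
    x ~ y
  good~ Z Sv e lt {x} {y} p q with x ~? y
  ... | yes r = r
  ... | no n = ⊥-elim (IH Z Sv e lt (inj₁ (x , y , p , q , n)))

  good² : ∀ {a v} → S a → a ∙ a ≡ ε → All S′ v → a ∙ ev v ≡ ε → suc (length v) < M → ∀ {x} → x ∈ v → x ∙
    x ≡ a
  good² {a} Sa aa Sv e lt {x} p with (x ∙ x) ≟ a
  ... | yes r = r
  ... | no n = ⊥-elim (IH (inv Sa aa) Sv e lt (inj₂ ((λ { refl → ε∉S Sa }) , x , p , n)))

  -- A shorter complement of `l`, with or without the involution, would close up with `l` to a
  -- shorter circuit, still bad because the inequivalent letters lie in `l` itself.
  exact : ∀ {z k x y} l t → Cent z k → All S′ (l ++ t) → x ∈ l → y ∈ l → ¬ x ~ y →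
    z ∙ ev (l ++ t) ≡ ε → k + length (l ++ t) ≡ M → length l + ℓ (ev l ⁻¹) ≡ M
  exact {z} {k} {x} {y} l t Z Slt x∈ y∈ n e len with m≤n⇒m<n∨m≡n le
    where
    le : length l + ℓ (ev l ⁻¹) ≤ M
    le = begin
      length l + ℓ (ev l ⁻¹)     ≤⟨ ℕₚ.+-monoʳ-≤ (length l)
        (upper Z (Allₚ.++⁻ʳ l Slt) (trans (cong (z ∙_) (sym (ev-++ l t))) e)) ⟩
      length l + (k + length t)  ≡⟨ ℕₚ.+-assoc (length l) k _ ⟨
      length l + k + length t    ≡⟨ cong (_+ length t) (ℕₚ.+-comm (length l) k) ⟩
      k + length l + length t    ≡⟨ ℕₚ.+-assoc k _ _ ⟩
      k + (length l + length t)  ≡⟨ cong (k +_) (length-++ l) ⟨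
      k + length (l ++ t)        ≡⟨ len ⟩
      M                          ∎
      where open ℕₚ.≤-Reasoning
  ... | inj₂ eq = eq
  ... | inj₁ lt with complete (ev l)
  ...   | z′ , k′ , t′ , Z′ , St′ , e′ , l′ = ⊥-elim (IH Z′ (Allₚ.++⁺ (Allₚ.++⁻ˡ l Slt) St′)
            (trans (cong (z′ ∙_) (ev-++ l t′)) e′) lt′ (inj₁ (x , y , ∈-++⁺ˡ x∈ , ∈-++⁺ˡ y∈ , n)))
    where
    lt′ : k′ + length (l ++ t′) < M
    lt′ = begin-strict
      k′ + length (l ++ t′)        ≡⟨ cong (k′ +_) (length-++ l) ⟩
      k′ + (length l + length t′)  ≡⟨ ℕₚ.+-assoc k′ _ _ ⟨
      k′ + length l + length t′    ≡⟨ cong (_+ length t′) (ℕₚ.+-comm k′ (length l)) ⟩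
      length l + k′ + length t′    ≡⟨ ℕₚ.+-assoc (length l) k′ _ ⟩
      length l + (k′ + length t′)  ≤⟨ ℕₚ.+-monoʳ-≤ (length l) l′ ⟩
      length l + ℓ (ev l ⁻¹)       <⟨ lt ⟩
      M                            ∎
      where open ℕₚ.≤-Reasoning

  record Adj (x y : G) : Set where
    constructor adjacent
    field
      Sx : S′ x
      Sy : S′ y
      x≁y : ¬ x ~ y
      {z} : G
      {k} : ℕ
      t  : List G
      Z  : Cent z k
      St : All S′ t
      circ : z ∙ x ∙ y ∙ ev t ≡ ε
      len : k + suc (suc (length t)) ≡ M

  mkAdj : ∀ {z k x y} u t → Cent z k → All S′ (u ++ x ∷ y ∷ t) → ¬ x ~ y → z ∙ ev (u ++ x ∷ y ∷ t) ≡ ε →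
    k + length (u ++ x ∷ y ∷ t) ≡ M → Adj x y
  mkAdj {k = k} {x} {y} u t Z S n e len with Allₚ.++⁻ˡ u S | Allₚ.++⁻ʳ u S
  ... | Su | Sx ∷ Sy ∷ St = adjacent Sx Sy n (t ++ u) Z (Allₚ.++⁺ St Su) (rot Z u (x ∷ y ∷ t) e)
        (trans (cong (k +_) (length-++-comm (x ∷ y ∷ t) u)) len)

  adj-exact : ∀ {x y} → Adj x y → 2 + ℓ ((x ∙ y) ⁻¹) ≡ M
  adj-exact {x} {y} (adjacent Sx Sy n t Z St e len) = subst (λ h → 2 + ℓ ((x ∙ h) ⁻¹) ≡ M) (identityʳ y)
    (exact (x ∷ y ∷ []) t Z (Sx ∷ Sy ∷ St) (here refl) (there (here refl)) n e len)

  adj-≢ε : ∀ {x y} → Adj x y → x ∙ y ≢ ε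
  adj-≢ε A e = x≁y (inj₁ (mutually-inverse⇒≡ (proj₁ Sx) (proj₁ Sy) e))
    where open Adj A

  adj-ℓ′ : ∀ {x y} → Adj x y → ¬ S (x ∙ y) → ℓ (x ∙ y) ≡ 2
  adj-ℓ′ A n with ℓ≤2-cases (ℓ₂≤2 (proj₁ (Adj.Sx A)) (proj₁ (Adj.Sy A)))
  ... | inj₁ e = ⊥-elim (adj-≢ε A e)
  ... | inj₂ (inj₁ s) = ⊥-elim (n s)
  ... | inj₂ (inj₂ l) = l

  adj-≡′ : ∀ {x y x′ y′} → Adj x y → Adj x′ y′ → ¬ S (x ∙ y) → ¬ S (x′ ∙ y′) → x ∙ y ≡ x′ ∙ y′
  adj-≡′ A A′ n n′ = thin (trans (adj-ℓ′ A n) (sym (adj-ℓ′ A′ n′)))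
    (suc-injective (suc-injective (trans (adj-exact A) (sym (adj-exact A′)))))

  Cent-letter : ∀ {z k u} → Cent z k → S u → z ∙ u ≡ ε → ¬ u ∙ u ≢ ε
  Cent-letter {u = u} one Su e _ = ε∉S (subst S (trans (sym (identityˡ u)) e) Su)
  Cent-letter (inv Sa aa) Su e n = n (subst (λ h → h ∙ h ≡ ε) (mutually-inverse⇒≡ Sa Su e) aa)

  -- If u = xy were a letter, contracting xy to u would give a circuit of the class of u.
  adj-∉S : ∀ {x y} → Adj x y → ¬ S (x ∙ y)
  adj-∉S {x} {y} A Su = go ((u ∙ u) ≟ ε)
    where
    open Adj A
    u : G
    u = x ∙ y
    mu : suc (m u) ≡ M
    mu = adj-exact A
    by-m : ∀ {v} → S v → suc (m v) ≡ M → v ≡ u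
    by-m Sv e = m-inj Sv Su (suc-injective (trans e (sym mu)))
    zut : z ∙ u ∙ ev t ≡ ε
    zut = trans (cong (z ∙_) (assoc x y _)) circ
    go : Dec (u ∙ u ≡ ε) → ⊥
    -- `m u = 2` gives `M = 3`, so the circuit has one element besides `x` and `y`: a letter of `S′`
    -- inverse to the involution `u`, or the involution, and then `m x = m y = 3`.
    go (yes uu) = small t Z St zut circ (trans len (trans (sym mu) (cong suc (m≡2 Su Su uu))))
      where
      small : ∀ {z k} t → Cent z k → All S′ t → z ∙ u ∙ ev t ≡ ε → z ∙ x ∙ y ∙ ev t ≡ ε → k + suc
        (suc (length t)) ≡ 3 → ⊥
      small (s ∷ []) one (Ss ∷ []) e _ _ = S′≢inv Ss uu (sym (mutually-inverse⇒≡ Su (proj₁ Ss)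
        (trans (cong (u ∙_) (sym (identityʳ s))) (trans (sym (identityˡ _)) e))))
      small [] (inv Sa aa) [] _ e _ = x≁y
        (inj₁ (m-inj (proj₁ Sx) (proj₁ Sy)
          (trans (three Sx (here refl)) (sym (three Sy (there (here refl)))))))
        where
        three : ∀ {s} → S′ s → s ∈ (x ∷ y ∷ []) → m s ≡ 3
        three Ss p = ≤-antisym (m-upper (inv Sa aa) (Sx ∷ Sy ∷ []) e p) (S′⇒m≥3 Ss)
      small [] one _ _ _ ()
      small (_ ∷ _ ∷ _) one _ _ _ ()
      small (_ ∷ _) (inv _ _) _ _ _ ()
    go (no uu) = cases (∈-or-avoids u t)
      where
      Su′ : S′ u
      Su′ = Su , uu
      lt : k + length (u ∷ t) < M
      lt = ≤-reflexive (trans (sym (ℕₚ.+-suc k _)) len)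
      ~u : ∀ {s} → s ∈ t → s ~ u
      ~u p = good~ Z (Su′ ∷ St) zut lt (there p) (here refl)
      y≢ε : y ≢ ε
      y≢ε = S′≢ε Sy
      x≁u : ¬ x ~ u
      x≁u (inj₁ e) = y≢ε (fixʳ (sym e))
      x≁u (inj₂ (inj₁ q)) = x≁y (inj₁ (cancelˡ (proj₁ q)))
      x≁u (inj₂ (inj₂ (q , _))) = uu (trans (cong (u ∙_) (mutually-inverse⇒≡ Su (proj₁ Sy) uy)) uy)
        where
        uy : u ∙ y ≡ ε
        uy = fixʳ (trans (sym (assoc u u y)) (cong (_∙ y) q))
      y≁u : ¬ y ~ u
      y≁u (inj₁ e) = S′≢ε Sx (fixˡ (sym e))
      y≁u (inj₂ (inj₁ q)) = x≁y (inj₁ (sym (cancelʳ (proj₁ q))))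
      y≁u (inj₂ (inj₂ (q , _))) = uu
        (trans (cong (u ∙_) (sym (mutually-inverse⇒≡ (proj₁ Sx) Su xu))) (∙ε-comm xu))
        where
        xu : x ∙ u ≡ ε
        xu = fixˡ (trans (assoc x u u) (cong (x ∙_) q))
      cases : (u ∈ t) ⊎ (∀ {s} → s ∈ t → s ≢ u) → ⊥
      -- The letters of `t` commute with `u`, so a copy of `u` can be placed on either side of `xy`.
      -- The adjacent pairs `yu` and `ux` are then equal; replacing one by the other gives the
      -- circuit `x u x r`, so `xu = ux` as well, and `x = y`. None of these products is a letter,
      -- since it would be `u`.
      cases (inj₁ u∈t) with pull u∈t St ~u
      ... | r , Sr , front , back , lr , _ = x≁y (inj₁ (cancelʳ (trans xu≡ux (sym yu≡ux))))
        where
        e₁ : z ∙ ev (x ∷ y ∷ u ∷ r) ≡ ε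
        e₁ = trans (cong (λ h → z ∙ x ∙ y ∙ h) (sym front)) circ
        len₁ : k + length (x ∷ y ∷ u ∷ r) ≡ M
        len₁ = trans (cong (λ h → k + suc (suc h)) (sym lr)) len
        Ayu : Adj y u
        Ayu = mkAdj (x ∷ []) r Z (Sx ∷ Sy ∷ Su′ ∷ Sr) y≁u e₁ len₁
        e₂ : z ∙ ev (u ∷ x ∷ y ∷ r) ≡ ε
        e₂ = rot Z (x ∷ y ∷ r) (u ∷ [])
          (trans (cong (λ h → z ∙ x ∙ y ∙ h)
            (trans (ev-++ r (u ∷ [])) (trans (cong (ev r ∙_) (identityʳ u)) (sym back)))) circ)
        Aux : Adj u x
        Aux = mkAdj [] (y ∷ r) Z (Su′ ∷ Sx ∷ Sy ∷ Sr) (λ q → x≁u (~-sym q)) e₂ len₁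
        yu≡ux : y ∙ u ≡ u ∙ x
        yu≡ux = adj-≡′ Ayu Aux (λ s → S′≢ε Sy (fixˡ (by-m s (adj-exact Ayu))))
          (λ s → S′≢ε Sx (fixʳ (by-m s (adj-exact Aux))))
        Axu : Adj x u
        Axu = mkAdj [] (x ∷ r) Z (Sx ∷ Su′ ∷ Sx ∷ Sr) x≁u
          (trans (cong (λ h → z ∙ x ∙ h) (sym (trans (merge (ev r) yu≡ux) (assoc u x _)))) e₁) len₁
        xu≡ux : x ∙ u ≡ u ∙ x
        xu≡ux = adj-≡′ Axu Aux (λ s → S′≢ε Sx (fixˡ (by-m s (adj-exact Axu))))
          (λ s → S′≢ε Sx (fixʳ (by-m s (adj-exact Aux))))
      cases (inj₂ ≢u) with avoiding Su′ St ~u ≢u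
      ... | inj₁ refl = Cent-letter Z Su (trans (cong (z ∙_) (sym (identityʳ u))) zut) uu
      -- Without the involution this is the situation of `partner-word`; with it, `u` and `d` are
      -- both square roots of the involution.
      ... | inj₂ (d , d∈t , pure) = by-cent Z zut lt len
        where
        Sd : S′ d
        Sd = All.lookup St d∈t
        by-cent : ∀ {z k} → Cent z k → z ∙ u ∙ ev t ≡ ε → k + length (u ∷ t) < M → k + suc
          (suc (length t)) ≡ M → ⊥
        by-cent one zut lt len = partner-word {q = length t} Su′ Sd (~-sym (~u d∈t))
          (λ e → ≢u d∈t (sym e))
          (trans (cong (λ h → u ∙ ev h) (sym pure)) (trans (sym (identityˡ _)) zut))
            (suc-injective (trans mu (sym len)))
        by-cent (inv Sa aa) zut lt len = ≢u d∈t (root-unique Sa aa Sd Su′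
          (good² Sa aa (Su′ ∷ St) zut lt (there d∈t)) (good² Sa aa (Su′ ∷ St) zut lt (here refl)))

  adj-ℓ : ∀ {x y} → Adj x y → ℓ (x ∙ y) ≡ 2
  adj-ℓ A = adj-ℓ′ A (adj-∉S A)

  adj-≡ : ∀ {x y x′ y′} → Adj x y → Adj x′ y′ → x ∙ y ≡ x′ ∙ y′
  adj-≡ A A′ = adj-≡′ A A′ (adj-∉S A) (adj-∉S A′)

  pow-snoc : ∀ e i w → pow e i ∙ e ∙ w ≡ e ∙ pow e i ∙ w
  pow-snoc e i w = swap w (sym (comm-pow i refl))

  -- The circuit c e^(i+1) w is rewritten with e h = c e, where h is the first letter of w,
  -- until a bad adjacency occurs in both orders.
  commuting : ∀ {z k c e} i w → Cent z k → S′ c → S′ e → All S′ w → ¬ c ~ e →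
    z ∙ c ∙ e ∙ ev (replicate i e ++ w) ≡ ε → k + (2 + i + length w) ≡ M → ∃[ x ] ∃[ y ]
      (Adj x y × x ∙ y ≡ y ∙ x)
  commuting {z} {k} {c} {e} i w Z Sc Se Sw n eq len = go w Sw eq len
    where
    lenL : ∀ w → length (replicate i e ++ w) ≡ i + length w
    lenL w = trans (length-++ (replicate i e)) (cong (_+ length w) (length-replicate i))
    Ace : ∀ {w} → All S′ w → z ∙ c ∙ e ∙ ev (replicate i e ++ w) ≡ ε → k + (2 + i + length w) ≡ M → Adj
      c e
    Ace {w} Sw eq len = adjacent Sc Se n (replicate i e ++ w) Z (Allₚ.++⁺ (Allₚ.replicate⁺ i Se) Sw) eq
      (trans (cong (λ h → k + suc (suc h)) (lenL w)) len)
    len-suc : ∀ h w → k + (2 + i + length (h ∷ w)) ≡ M → k + (3 + i + length w) ≡ M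
    len-suc h w l = trans (cong (λ q → k + suc (suc q)) (sym (ℕₚ.+-suc i _))) l
    go : ∀ w → All S′ w → z ∙ c ∙ e ∙ ev (replicate i e ++ w) ≡ ε → k + (2 + i + length w) ≡ M → ∃[ x ]
      ∃[ y ] (Adj x y × x ∙ y ≡ y ∙ x)
    -- The circuit is `z c e^(i+1)`, so `c` is inverse to an element that commutes with `e`.
    go [] Sw eq len = c , e , Ace Sw eq len , sym (comm-inv (trans (sym (Cent-swap Z c _)) eq)
      (sym (trans (assoc z _ e) (trans
        (cong (z ∙_) (sym (comm-ev {w = e ∷ replicate i e ++ []}
          (refl ∷ Allₚ.++⁺ (Allₚ.replicate⁺ i refl) []))))
        (Cent-swap Z e _)))))
    go (h ∷ w) (Sh ∷ Sw) eq len with h ≟ e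
    ... | yes refl = commuting (suc i) w Z Sc Se Sw n
          (trans (cong (λ q → z ∙ c ∙ e ∙ q)
            (sym (trans (ev-++ (replicate i e) (e ∷ w))
              (trans (pow-snoc e i _) (cong (e ∙_) (sym (ev-++ (replicate i e) w))))))) eq)
          (len-suc h w len)
    ... | no h≢e with h ~? e
    -- `h` moves past the powers of `e` until it follows `c`; then `ch = ce`.
    ...   | yes h~e = ⊥-elim (h≢e (cancelˡ (adj-≡ Ach (Ace (Sh ∷ Sw) eq len))))
      where
      Ach : Adj c h
      Ach = mkAdj [] (e ∷ replicate i e ++ w) Z (Sc ∷ Sh ∷ Se ∷ Allₚ.++⁺ (Allₚ.replicate⁺ i Se) Sw)
        (λ q → n (~-trans Sc Sh Se q h~e))
        (trans (cong (λ q → z ∙ c ∙ q) (trans (cong (λ q → h ∙ e ∙ q) (ev-++ (replicate i e) w))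
          (trans (swap _ (~-comm h~e)) (cong (e ∙_)
            (trans (swap _ (comm-pow i (~-comm h~e))) (sym (ev-++ (replicate i e) (h ∷ w)))))))) eq)
        (trans (cong (λ q → k + suc (suc (suc q))) (lenL w)) (len-suc h w len))
    ...   | no h≁e = branch i refl
      where
      Aeh : Adj e h
      Aeh = mkAdj (c ∷ replicate i e) w Z (Sc ∷ Allₚ.++⁺ (Allₚ.replicate⁺ i Se) (Se ∷ Sh ∷ Sw))
        (λ q → h≁e (~-sym q))
        (trans (cong (λ q → z ∙ c ∙ q)
          (trans (ev-++ (replicate i e) (e ∷ h ∷ w))
            (trans (pow-snoc e i _) (cong (e ∙_) (sym (ev-++ (replicate i e) (h ∷ w))))))) eq)
        (trans (cong (λ q → k + suc q)
          (trans (length-++ (replicate i e))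
            (trans (cong (_+ suc (suc (length w))) (length-replicate i)) (ℕₚ.+-suc i _)))) len)
      eh≡ce : e ∙ h ≡ c ∙ e
      eh≡ce = adj-≡ Aeh (Ace (Sh ∷ Sw) eq len)
      branch : ∀ j → i ≡ j → ∃[ x ] ∃[ y ] (Adj x y × x ∙ y ≡ y ∙ x)
      -- `c e h w` becomes `e h h w`: the new pair is `e`, `h`, the new exponent is 2, and the
      -- unprocessed word is shorter.
      branch zero refl = commuting 1 w Z Se Sh Sw (λ q → h≁e (~-sym q))
        (trans (cong (z ∙_) (trans (sym (assoc e h _))
          (trans (cong (_∙ (h ∙ ev w)) eh≡ce) (assoc c e _)))) eq)
        len
      -- The last two letters of `e^(j+2) h` turn into `c e`, so the circuit also has the factor
      -- `ec`.
      branch (suc j) refl = c , e , Ace (Sh ∷ Sw) eq len , adj-≡ (Ace (Sh ∷ Sw) eq len) Aec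
        where
        rest : e ∙ ev (replicate (suc j) e ++ h ∷ w) ≡ pow e (suc j) ∙ c ∙ e ∙ ev w
        rest = begin
          e ∙ ev (replicate (suc j) e ++ h ∷ w)  ≡⟨ cong (e ∙_) (ev-++ (replicate (suc j) e) (h ∷ w)) ⟩
          e ∙ pow e (suc j) ∙ h ∙ ev w           ≡⟨ pow-snoc e (suc j) _ ⟨
          pow e (suc j) ∙ e ∙ h ∙ ev w           ≡⟨ cong (pow e (suc j) ∙_)
            (trans (merge (ev w) eh≡ce) (assoc c e _)) ⟩
          pow e (suc j) ∙ c ∙ e ∙ ev w           ∎
          where open ≡-Reasoning
        Aec : Adj e c
        Aec = mkAdj (c ∷ replicate j e) (e ∷ w) Z
          (Sc ∷ Allₚ.++⁺ (Allₚ.replicate⁺ j Se) (Se ∷ Sc ∷ Se ∷ Sw)) (λ q → n (~-sym q))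
          (trans (cong (λ q → z ∙ c ∙ q)
            (trans (ev-++ (replicate j e) (e ∷ c ∷ e ∷ w))
              (trans (pow-snoc e j _) (trans (sym (assoc e _ _)) (sym rest))))) eq)
          (trans (cong (λ q → k + suc q)
            (trans (length-++ (replicate j e))
              (trans (cong (_+ (3 + length w)) (length-replicate j))
                (trans (ℕₚ.+-suc j _) (cong suc (ℕₚ.+-suc j _)))))) len)

  -- Circuits in two commuting inequivalent letters

  module Collect {x c} (Axc : Adj x c) (xc : x ∙ c ≡ c ∙ x) where
    open Adj Axc using () renaming (Sx to Sx; Sy to Sc; x≁y to x≁c)

    W : ℕ → ℕ → G
    W i j = ev (replicate i x ++ replicate j c)

    W≡ : ∀ i j → W i j ≡ pow x i ∙ pow c j
    W≡ i j = ev-++ (replicate i x) (replicate j c)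

    Wc : ∀ i j → W i (suc j) ≡ c ∙ W i j
    Wc i j = trans (W≡ i (suc j)) (trans (swap _ (sym (comm-pow i (sym xc))))
      (cong (c ∙_) (sym (W≡ i j))))

    lenW : ∀ i j → length (replicate i x ++ replicate j c) ≡ i + j
    lenW i j = trans (length-++ (replicate i x)) (cong₂ _+_ (length-replicate i) (length-replicate j))

    SW : ∀ i j → All S′ (replicate i x ++ replicate j c)
    SW i j = Allₚ.++⁺ (Allₚ.replicate⁺ i Sx) (Allₚ.replicate⁺ j Sc)

    Powers : Set
    Powers = ∃[ z ] ∃[ k ] ∃[ i ] ∃[ j ] (Cent z k × z ∙ W (suc i) (suc j) ≡ ε × k + (2 + i + j) ≡ M)

    -- The next letter `f` has to be `x` or `c`. If it is equivalent to `c`, it moves left past the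
    -- powers of `c` and `xf = xc`; otherwise a `c` is brought in front of it and `cf = xc = cx`.
    collect : ∀ {z k} i j w → Cent z k → All S′ w → z ∙ W (suc i) (suc j) ∙ ev w ≡ ε → k +
      (2 + i + j + length w) ≡ M → Powers
    collect {z} {k} i j [] Z [] e len = z , k , i , j , Z , trans (cong (z ∙_) (sym (identityʳ _))) e ,
      trans (cong (k +_) (sym (ℕₚ.+-identityʳ _))) len
    collect {z} {k} i j (f ∷ w) Z (Sf ∷ Sw) e len with f ≟ c | f ≟ x
    ... | yes refl | _ = collect i (suc j) w Z Sw
          (trans (cong (z ∙_) (trans (cong (_∙ ev w) (Wc (suc i) (suc j)))
            (trans (cong (_∙ ev w) (comm-ev {w = replicate (suc i) x ++ replicate (suc j) c}
              (Allₚ.++⁺ (Allₚ.replicate⁺ (suc i) (sym xc)) (Allₚ.replicate⁺ (suc j) refl))))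
                (assoc _ c _)))) e)
          (trans (cong (k +_) (trans (cong (λ h → suc (suc h) + length w) (ℕₚ.+-suc i j))
            (sym (ℕₚ.+-suc (2 + i + j) (length w))))) len)
    ... | no _ | yes refl = collect (suc i) j w Z Sw
          (trans (cong (z ∙_) (trans (cong (_∙ ev w)
            (comm-ev {w = replicate (suc i) x ++ replicate (suc j) c}
              (Allₚ.++⁺ (Allₚ.replicate⁺ (suc i) refl) (Allₚ.replicate⁺ (suc j) xc)))) (assoc _ x _)))
                e)
          (trans (cong (k +_) (sym (ℕₚ.+-suc (2 + i + j) (length w)))) len)
    ... | no f≢c | no f≢x with f ~? c
    ...   | yes f~c = ⊥-elim (f≢c (cancelˡ (adj-≡ Axf Axc)))
      where
      open ≡-Reasoning
      lhs : ev (replicate i x ++ x ∷ f ∷ replicate (suc j) c ++ w) ≡ W (suc i) (suc j) ∙ f ∙ ev w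
      lhs = begin
        ev (replicate i x ++ x ∷ f ∷ replicate (suc j) c ++ w)  ≡⟨ ev-++ (replicate i x) _ ⟩
        pow x i ∙ x ∙ f ∙ ev (replicate (suc j) c ++ w)         ≡⟨ pow-snoc x i _ ⟩
        x ∙ pow x i ∙ f ∙ ev (replicate (suc j) c ++ w)         ≡⟨ cong (λ h → x ∙ pow x i ∙ f ∙ h)
          (ev-++ (replicate (suc j) c) w) ⟩
        x ∙ pow x i ∙ f ∙ pow c (suc j) ∙ ev w                  ≡⟨ cong (λ h → x ∙ pow x i ∙ h)
          (swap (ev w) (comm-pow (suc j) (~-comm f~c))) ⟩
        x ∙ pow x i ∙ pow c (suc j) ∙ f ∙ ev w                  ≡⟨ cong (x ∙_)
          (trans (sym (assoc _ _ _)) (cong (_∙ (f ∙ ev w)) (sym (W≡ i (suc j))))) ⟩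
        x ∙ W i (suc j) ∙ f ∙ ev w                              ≡⟨ assoc x _ _ ⟨
        W (suc i) (suc j) ∙ f ∙ ev w                            ∎
      Axf : Adj x f
      Axf = mkAdj (replicate i x) (replicate (suc j) c ++ w) Z
        (Allₚ.++⁺ (Allₚ.replicate⁺ i Sx) (Sx ∷ Sf ∷ Allₚ.++⁺ (Allₚ.replicate⁺ (suc j) Sc) Sw))
        (λ q → x≁c (~-trans Sx Sf Sc q f~c))
        (trans (cong (z ∙_) lhs) e)
        (trans (cong (k +_) (begin
          length (replicate i x ++ x ∷ f ∷ replicate (suc j) c ++ w)  ≡⟨ length-++ (replicate i x) ⟩
          length (replicate i x) + (3 + length (replicate j c ++ w))  ≡⟨ cong₂ (λ p q → p + (3 + q))
            (length-replicate i) (trans (length-++ (replicate j c))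
              (cong (_+ length w) (length-replicate j))) ⟩
          i + (3 + (j + length w))                                    ≡⟨ solve 3
            (λ i j w → i :+ (con 3 :+ (j :+ w)) := con 2 :+ i :+ j :+ (con 1 :+ w)) refl i j (length w)
              ⟩
          2 + i + j + length (f ∷ w)                                  ∎)) len)
    ...   | no f≁c = ⊥-elim (f≢x (cancelˡ (trans (adj-≡ Acf Axc) xc)))
      where
      open ≡-Reasoning
      u : List G
      u = replicate (suc i) x ++ replicate j c
      Acf : Adj c f
      Acf = mkAdj u w Z
        (Allₚ.++⁺ (SW (suc i) j) (Sc ∷ Sf ∷ Sw)) (λ q → f≁c (~-sym q))
        (trans (cong (z ∙_) (begin
          ev (u ++ c ∷ f ∷ w)            ≡⟨ ev-++ u _ ⟩
          W (suc i) j ∙ c ∙ f ∙ ev w     ≡⟨ assoc (W (suc i) j) c _ ⟨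
          (W (suc i) j ∙ c) ∙ f ∙ ev w   ≡⟨ cong (_∙ (f ∙ ev w))
            (comm-ev {w = u} (Allₚ.++⁺ (Allₚ.replicate⁺ (suc i) (sym xc)) (Allₚ.replicate⁺ j refl))) ⟨
          (c ∙ W (suc i) j) ∙ f ∙ ev w   ≡⟨ cong (_∙ (f ∙ ev w)) (Wc (suc i) j) ⟨
          W (suc i) (suc j) ∙ f ∙ ev w   ∎)) e)
        (trans (cong (k +_) (begin
          length (u ++ c ∷ f ∷ w)            ≡⟨ length-++ u ⟩
          length u + (2 + length w)          ≡⟨ cong (_+ (2 + length w)) (lenW (suc i) j) ⟩
          suc i + j + (2 + length w)         ≡⟨ ℕₚ.+-suc (suc i + j) (suc (length w)) ⟩
          2 + i + j + length (f ∷ w)         ∎)) len)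

    powers : Powers
    powers = collect 0 0 t Z St (trans
      (cong (z ∙_) (trans (assoc x _ _)
        (cong (x ∙_) (trans (assoc c ε _) (cong (c ∙_) (identityˡ _)))))) circ) len
      where open Adj Axc

  below : ∀ n {q} → n + q ≡ M → q ≤ M
  below n e = subst (_ ≤_) e (ℕₚ.m≤n+m _ n)

  M≢3 : ∀ {g n} → g ≡ ε → 3 + ℓ (g ⁻¹) ≡ M → 4 + n ≢ M
  M≢3 e l l′ with trans l′ (trans (sym l) (cong (3 +_) (ℓε⁻¹ e)))
  ... | ()

  inv≢S′ : ∀ {a x} → S a → a ∙ a ≡ ε → S′ x → a ∙ x ≢ ε
  inv≢S′ Sa aa Sx e = S′≢inv Sx aa (sym (mutually-inverse⇒≡ Sa (proj₁ Sx) e))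

  two-letters : ∀ {g} → ℓ g ≡ 2 →
    (∃[ b ] ∃[ s ] (S b × b ∙ b ≡ ε × S′ s × g ≡ b ∙ s)) ⊎ (∃[ v ] ∃[ w ] (S′ v × S′ w × g ≡ v ∙ w))
  two-letters l with ℓ≡2 l
  ... | v , w , Sv , Sw , e with (v ∙ v) ≟ ε | (w ∙ w) ≟ ε
  ...   | no nv | no nw = inj₂ (v , w , (Sv , nv) , (Sw , nw) , e)
  ...   | yes ev | no nw = inj₁ (v , w , Sv , ev , (Sw , nw) , e)
  ...   | no nv | yes ew = inj₁ (w , v , Sw , ew , (Sv , nv) , trans e (sym (central Sw ew v)))
  ...   | yes ev | yes ew with trans (sym l)
    (trans (cong ℓ (trans e (trans (cong (v ∙_) (involution-unique Sw Sv ew ev)) ev))) ℓε)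
  ...     | ()

  -- Deleting `c^q` would leave a shorter circuit, which still contains `x` and `c` or is `zx`
  -- alone.
  no-order : ∀ {z k x c n} → Cent z k → S′ x → S′ c → ¬ x ~ c → z ∙ x ∙ pow c n ≡ ε → k + suc n ≡ M →
    ∀ {q} → 1 ≤ q → q ≤ n → pow c q ≢ ε
  no-order {z} {k} {x} {c} {n} Z Sx Sc x≁c e len {q} 1≤q q≤n o = go (n ∸ q)
    (trans (cong (λ h → z ∙ x ∙ h) (sym (pow-drop {c} {q} {n} o q≤n))) e) lt
    where
    lt : n ∸ q < n
    lt = ℕₚ.∸-monoʳ-< 1≤q q≤n
    go : ∀ r → z ∙ x ∙ pow c r ≡ ε → r < n → ⊥
    go zero e _ = Cent-letter Z (proj₁ Sx) (trans (cong (z ∙_) (sym (identityʳ x))) e) (proj₂ Sx)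
    go (suc r) e lt = IH Z (Sx ∷ Allₚ.replicate⁺ (suc r) Sc) e
      (ℕₚ.≤-trans (≤-reflexive (sym (ℕₚ.+-suc k _)))
        (ℕₚ.≤-trans (ℕₚ.+-monoʳ-≤ k (s≤s (subst (_< n) (sym (length-replicate (suc r))) lt)))
          (≤-reflexive len)))
      (inj₁ (x , c , here refl , there (here refl) , x≁c))

  no-square : ∀ {z k x c n} → Cent z k → S′ x → S′ c → ¬ x ~ c → z ∙ x ∙ pow c (2 + n) ≡ ε → k + (3 + n)
    ≡ M →
    ∀ {d} → S′ d → d ~ c → c ∙ c ≢ d
  no-square {z} {k} {x} {c} {n} Z Sx Sc x≁c e len {d} Sd d~c refl = IH Z
    (Sx ∷ Sd ∷ Allₚ.replicate⁺ n Sc)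
    (trans (cong (λ h → z ∙ x ∙ h) (assoc c c _)) e)
    (≤-reflexive (trans (sym (ℕₚ.+-suc k _))
      (trans (cong (λ h → k + suc (suc (suc h))) (length-replicate n)) len)))
    (inj₁ (x , d , here refl , there (here refl) , λ q → x≁c (~-trans Sx Sd Sc q d~c)))

  -- A letter of `t` other than `c` has to be a square root of `c`; the equivalence then carries the
  -- relation `c^(m c) = ε`, and `m c` is bounded by the circuit.
  class-order : ∀ {c t} → S′ c → All S′ t → (∀ {y} → y ∈ t → y ~ c) → ev (c ∷ t) ≡ ε →
    (∀ {d} → S′ d → d ~ c → c ∙ c ≢ d) → ∃[ q ] (1 ≤ q × q ≤ suc (length t) × pow c q ≡ ε)
  class-order {c} {t} Sc St all~ e nsq with pure? c t
  ... | inj₁ pure = suc (length t) , s≤s z≤n , ≤-refl , trans (cong (λ h → c ∙ ev h) (sym pure)) e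
  ... | inj₂ (d , d∈t , d≢c) with all~ d∈t
  ...   | inj₁ eq = ⊥-elim (d≢c eq)
  ...   | inj₂ (inj₁ (_ , oc , _)) = m c , s≤s z≤n , m≤ (All.map proj₁ St) e , oc
  ...   | inj₂ (inj₂ q) = ⊥-elim (nsq (All.lookup St d∈t) (all~ d∈t) (proj₁ q))

  module Pair {x c} (Axc : Adj x c) (xc : x ∙ c ≡ c ∙ x) where
    open Collect Axc xc public
    open Adj Axc using () renaming (Sx to Sx; Sy to Sc; x≁y to x≁c)

    x≢c : x ≢ c
    x≢c e = x≁c (inj₁ e)

    short : ∀ r i j → suc (r + (i + j)) ≤ M → r + length (replicate i x ++ replicate j c) < M
    short r i j le = subst (λ h → suc (r + h) ≤ M) (sym (lenW i j)) le

    short₁ : ∀ r i j → suc (suc (r + (i + j))) ≤ M → r + length (replicate i x ++ replicate (suc j) c) <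
      M
    short₁ r i j le = short r i (suc j)
      (subst (λ h → suc h ≤ M) (trans (sym (ℕₚ.+-suc r (i + j))) (cong (r +_) (sym (ℕₚ.+-suc i j)))) le)

    c∈ : ∀ i j → c ∈ replicate i x ++ replicate (suc j) c
    c∈ i j = ∈-++⁺ʳ (replicate i x) (here refl)

    exact-xxc : ∀ {z k} i j → Cent z k → z ∙ W (2 + i) (suc j) ≡ ε → k + (3 + (i + j)) ≡ M → 3 + ℓ
      ((x ∙ x ∙ c) ⁻¹) ≡ M
    exact-xxc {z} {k} i j Z e len = subst (λ h → 3 + ℓ ((x ∙ x ∙ h) ⁻¹) ≡ M) (identityʳ c)
      (exact (x ∷ x ∷ c ∷ []) (replicate i x ++ replicate j c) Z (Sx ∷ Sx ∷ Sc ∷ SW i j) (here refl)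
        (there (there (here refl))) x≁c
        (trans (cong (λ h → z ∙ x ∙ x ∙ h) (sym (Wc i j))) e)
          (trans (cong (λ h → k + (3 + h)) (lenW i j)) len))

    exact-xcc : ∀ {z k} i j → Cent z k → z ∙ W (suc i) (2 + j) ≡ ε → k + (3 + (i + j)) ≡ M → 3 + ℓ
      ((x ∙ c ∙ c) ⁻¹) ≡ M
    exact-xcc {z} {k} i j Z e len = subst (λ h → 3 + ℓ ((x ∙ c ∙ h) ⁻¹) ≡ M) (identityʳ c)
      (exact (x ∷ c ∷ c ∷ []) (replicate i x ++ replicate j c) Z (Sx ∷ Sc ∷ Sc ∷ SW i j) (here refl)
        (there (here refl)) x≁c
        (trans (cong (λ h → z ∙ x ∙ h) (sym (trans (Wc i (suc j)) (cong (c ∙_) (Wc i j))))) e)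
          (trans (cong (λ h → k + (3 + h)) (lenW i j)) len))

    xxc≢xcc : x ∙ x ∙ c ≢ x ∙ c ∙ c
    xxc≢xcc e = x≢c (cancelʳ (cancelˡ e))

    -- A shorter circuit d t would give the short bad circuit x x t.
    square-m : ∀ {d} → S′ d → d ~ c → x ∙ x ≡ d → M ≤ suc (m d)
    square-m {d} Sd d~c refl with M ℕₚ.≤? suc (m d)
    ... | yes le = le
    ... | no nle with m-complete d
    ...   | z , k , [] , Z , [] , e , len = ⊥-elim
      (Cent-letter Z (proj₁ Sd) (trans (cong (z ∙_) (sym (identityʳ d))) e) (proj₂ Sd))
    ...   | z , k , s ∷ t , Z , Ss ∷ St , e , len = ⊥-elim
      (IH Z (Sx ∷ Sx ∷ Ss ∷ St) (trans (cong (z ∙_) (sym (assoc x x _))) e)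
              (subst (_< M) (trans (cong suc (sym len)) (sym (ℕₚ.+-suc k _))) (ℕₚ.≰⇒> nle))
              (inj₁ (x , s , here refl , there (there (here refl)) , λ x~s → x≁c
                (~-trans Sx Sd Sc (~-trans Sx Ss Sd x~s s~d) d~c))))
      where
      s~d : s ~ d
      s~d = good~ Z (Sd ∷ Ss ∷ St) e (subst (_< M) (sym len) (ℕₚ.≤-trans (ℕₚ.n≤1+n _) (ℕₚ.≰⇒> nle)))
        (there (here refl)) (here refl)

    -- With `square-m`, the relation gives `m c = r + 1`. A circuit through `x` shorter than
    -- `x x c^r` would lie in the class of `x`: two copies of `x` would contract to `c` and give too
    -- short a circuit through `c`, one copy is excluded by `partner-word` or by the involution. So
    -- `m x = r + 2`, and `x ~ c` after all.
    square-is-QP : x ∙ x ≡ c → ∀ r → pow c (suc r) ≡ ε → suc (suc r) ≡ M → ⊥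
    square-is-QP xx r o len = x≁c (inj₂
      (inj₁ (xx , trans (cong (pow c) mc) o , trans mx (cong suc (sym mc)))))
      where
      mc : m c ≡ suc r
      mc = ≤-antisym (order-≥ {c} {r} (proj₁ Sc) o)
        (ℕₚ.≤-pred (≤-trans (≤-reflexive len) (square-m Sc ~-refl xx)))
      mx≤ : m x ≤ 2 + r
      mx≤ = subst (λ h → m x ≤ 2 + h) (length-replicate r)
        (m-upper one (Sx ∷ Sx ∷ Allₚ.replicate⁺ r Sc)
          (trans (identityˡ _) (trans (merge (pow c r) xx) o)) (here refl))
      mx : m x ≡ 2 + r
      mx with m≤n⇒m<n∨m≡n mx≤
      ... | inj₂ e = e
      ... | inj₁ lt with m-complete x
      ...   | z , k , t , Z , St , e , lt′ = ⊥-elim (cases (∈-or-avoids x t))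
        where
        bound : k + length (x ∷ t) < M
        bound = subst₂ _<_ (sym lt′) len lt
        ~x : ∀ {s} → s ∈ t → s ~ x
        ~x p = good~ Z (Sx ∷ St) e bound (there p) (here refl)
        cases : (x ∈ t) ⊎ (∀ {s} → s ∈ t → s ≢ x) → ⊥
        cases (inj₁ p) with pull p St ~x
        ... | t′ , St′ , front , _ , l′ , _ = <-irrefl mc (≤-trans
                (s≤s (m-upper₁ Z St′ (trans (cong (z ∙_) (sym (merge (ev t′) xx)))
                  (trans (cong (λ h → z ∙ x ∙ h) (sym front)) e))))
                (≤-trans (≤-reflexive (trans (sym (ℕₚ.+-suc k _))
                  (trans (cong (λ h → k + suc h) (sym l′)) lt′))) (ℕₚ.≤-pred lt)))
        cases (inj₂ ≢x) with avoiding Sx St ~x ≢x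
        ... | inj₁ refl = Cent-letter Z (proj₁ Sx) (trans (cong (z ∙_) (sym (identityʳ x))) e)
          (proj₂ Sx)
        ... | inj₂ (d , d∈t , pure) = by-cent Z e bound lt′
          where
          by-cent : ∀ {z k} → Cent z k → z ∙ x ∙ ev t ≡ ε → k + length (x ∷ t) < M → k + suc (length t)
            ≡ m x → ⊥
          by-cent one e _ l = partner-word {q = length t} Sx (All.lookup St d∈t) (~-sym (~x d∈t))
            (λ q → ≢x d∈t (sym q))
            (trans (cong (λ h → x ∙ ev h) (sym pure)) (trans (sym (identityˡ _)) e)) (sym l)
          by-cent (inv Sa aa) e b _ = S′≢inv Sc aa
            (trans (sym xx) (good² Sa aa (Sx ∷ St) e b (here refl)))

    -- A shorter word for `xxc` leaves a shorter circuit that contains `c` and is not bad. If the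
    -- word consists of letters of `S′`, no `x` is left over and the circuit lies in the class of
    -- `c`; if it is the involution times such a letter, `x` and `c` are both square roots of the
    -- involution.
    double : ∀ i j → W (2 + i) (2 + j) ≡ ε → 4 + (i + j) ≡ M → ℓ (x ∙ x ∙ c) ≤ 2 → ⊥
    double i j E len le = cases (ℓ≤2-cases le)
      where
      g : G
      g = x ∙ x ∙ c
      ex : 3 + ℓ (g ⁻¹) ≡ M
      ex = exact-xxc i (suc j) one (trans (identityˡ _) E) (trans (cong (3 +_) (ℕₚ.+-suc i j)) len)
      gW : g ∙ W i (suc j) ≡ ε
      gW = trans (assoc x _ _) (trans (cong (x ∙_) (assoc x c _))
        (trans (cong (λ h → x ∙ x ∙ h) (sym (Wc i (suc j)))) E))
      i≡0 : ∀ i → (∀ {s} → s ∈ replicate i x → s ~ c) → i ≡ 0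
      i≡0 zero _ = refl
      i≡0 (suc i) f = ⊥-elim (x≁c (f (here refl)))
      xxc≡c : g ≢ c
      xxc≡c e = proj₂ Sx (fixˡ (trans (assoc x x c) e))
      xx≡ : ∀ {d} → g ≡ d ∙ c → x ∙ x ≡ d
      xx≡ e = cancelʳ (trans (assoc x x c) e)
      contra-sq : ∀ {d} → i ≡ 0 → S′ d → d ~ c → d ≢ c → g ≡ d ∙ c → ⊥
      contra-sq {d} refl Sd d~c d≢c e = partner-word {q = suc (suc j)} Sd Sc d~c d≢c dW
        (≤-antisym (subst (λ h → m d ≤ suc h) (length-replicate (suc (suc j)))
          (m≤ (Allₚ.replicate⁺ (suc (suc j)) (proj₁ Sc)) dW))
                   (ℕₚ.≤-pred (≤-trans (≤-reflexive len) (square-m Sd d~c (xx≡ e)))))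
        where
        dW : d ∙ pow c (suc (suc j)) ≡ ε
        dW = trans (sym (assoc d c _)) (trans (cong (_∙ pow c (suc j)) (sym e)) gW)
      cases : g ≡ ε ⊎ S g ⊎ ℓ g ≡ 2 → ⊥
      cases (inj₁ e) = M≢3 e ex len
      cases (inj₂ (inj₁ Sg)) with (g ∙ g) ≟ ε
      ... | yes gg = small i j (ℕₚ.+-cancelˡ-≡ 4 (i + j) 0
        (trans len (trans (sym ex) (cong (2 +_) (m≡2 Sg Sg gg))))) gW
        where
        small : ∀ i j → i + j ≡ 0 → g ∙ W i (suc j) ≡ ε → ⊥
        small zero zero _ e = inv≢S′ Sg gg Sc (trans (cong (g ∙_) (sym (identityʳ c))) e)
      ... | no ngg = done (g ≟ c)
        where
        Sg′ : S′ g
        Sg′ = Sg , ngg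
        cl : ∀ {s} → s ∈ g ∷ replicate i x ++ replicate (suc j) c → s ~ c
        cl p = good~ one (Sg′ ∷ SW i (suc j)) (trans (identityˡ _) gW) (short₁ 1 i j (below 1 len)) p
          (there (c∈ i j))
        done : Dec (g ≡ c) → ⊥
        done (yes e) = xxc≡c e
        done (no n) = fin i (i≡0 i (λ p → cl (there (∈-++⁺ˡ p)))) gW len
          where
          fin : ∀ i → i ≡ 0 → g ∙ W i (suc j) ≡ ε → 4 + (i + j) ≡ M → ⊥
          fin zero _ gW len = partner-word {q = suc j} Sg′ Sc (cl (here refl)) n gW
            (suc-injective (suc-injective (trans ex (sym len))))
      cases (inj₂ (inj₂ l)) with two-letters l
      ... | inj₁ (b , s , Sb , bb , Ss , e) = x≢c
        (root-unique Sb bb Sx Sc (xx≡ (trans e (cong (b ∙_) s≡c))) (sq (there (c∈ i j))))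
        where
        sq : ∀ {y} → y ∈ s ∷ replicate i x ++ replicate (suc j) c → y ∙ y ≡ b
        sq = good² Sb bb (Ss ∷ SW i (suc j))
          (trans (sym (assoc b s _)) (trans (cong (_∙ W i (suc j)) (sym e)) gW))
            (short₁ 2 i j (≤-reflexive len))
        s≡c : s ≡ c
        s≡c = root-unique Sb bb Ss Sc (sq (here refl)) (sq (there (c∈ i j)))
      ... | inj₂ (v , w , Sv , Sw , e) = done (v ≟ c) (w ≟ c)
        where
        vwW : v ∙ w ∙ W i (suc j) ≡ ε
        vwW = trans (sym (assoc v w _)) (trans (cong (_∙ W i (suc j)) (sym e)) gW)
        cl : ∀ {s} → s ∈ v ∷ w ∷ replicate i x ++ replicate (suc j) c → s ~ c
        cl p = good~ one (Sv ∷ Sw ∷ SW i (suc j)) (trans (identityˡ _) vwW)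
          (short₁ 2 i j (≤-reflexive len)) p (there (there (c∈ i j)))
        i0 : i ≡ 0
        i0 = i≡0 i (λ p → cl (there (there (∈-++⁺ˡ p))))
        v~c : v ~ c
        v~c = cl (here refl)
        w~c : w ~ c
        w~c = cl (there (here refl))
        root : ∀ {d} → S′ d → d ~ c → d ≢ c → d ∙ d ≡ c
        root _ (inj₁ q) n = ⊥-elim (n q)
        root _ (inj₂ (inj₁ q)) _ = proj₁ q
        root {d} Sd d~c@(inj₂ (inj₂ q)) _ = ⊥-elim (IH one (Sx ∷ Sx ∷ Sd ∷ SW i j)
          (trans (identityˡ _) (trans (cong (λ h → x ∙ x ∙ h)
            (trans (sym (merge (W i j) (proj₁ q))) (sym (trans (Wc i (suc j)) (cong (c ∙_) (Wc i j))))))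
              E))
          (short 3 i j (≤-reflexive len))
            (inj₁ (x , d , here refl , there (there (here refl)) , λ r → x≁c (~-trans Sx Sd Sc r d~c))))
        done : Dec (v ≡ c) → Dec (w ≡ c) → ⊥
        done (yes v≡c) (yes w≡c) = fin i i0 vwW len
          where
          fin : ∀ i → i ≡ 0 → v ∙ w ∙ W i (suc j) ≡ ε → 4 + (i + j) ≡ M → ⊥
          fin zero _ vwW len = square-is-QP (xx≡ (trans e (cong₂ _∙_ v≡c w≡c))) (2 + j)
            (trans (cong₂ (λ p q → p ∙ q ∙ W 0 (suc j)) (sym v≡c) (sym w≡c)) vwW) len
        done (no v≢c) (yes w≡c) = contra-sq i0 Sv v~c v≢c (trans e (cong (v ∙_) w≡c))
        done (yes v≡c) (no w≢c) = contra-sq i0 Sw w~c w≢c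
          (trans e (trans (~-comm (~-trans Sv Sc Sw v~c (~-sym w~c))) (cong (w ∙_) v≡c)))
        done (no v≢c) (no w≢c) = xxc≡c
          (trans e (trans (cong (v ∙_) (partner-unique Sc Sw Sv w~c w≢c v~c v≢c)) (root Sv v~c v≢c)))

    -- With a single `x` there is no factor `xxc`, and `xc` is compared with `cc` instead. If `cc`
    -- has length 2 and a complement shorter than expected, then `cc` is the involution or a power
    -- relation for `c` contradicts `no-order`; otherwise thinness gives `xc = cc`.
    single : ∀ j → W 1 (suc j) ≡ ε → 2 + j ≡ M → ⊥
    single zero E len = adj-≢ε Axc (trans (cong (x ∙_) (sym (identityʳ c))) E)
    single (suc j) E len = cases (ℓ≤2-cases (ℓ₂≤2 (proj₁ Sc) (proj₁ Sc)))
      where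
      E₁ : ε ∙ x ∙ pow c (2 + j) ≡ ε
      E₁ = trans (identityˡ _) E
      nsq : ∀ {d} → S′ d → d ~ c → c ∙ c ≢ d
      nsq = no-square {n = j} one Sx Sc x≁c E₁ len
      nord : ∀ {q} → 1 ≤ q → q ≤ 2 + j → pow c q ≢ ε
      nord {q} = no-order {n = 2 + j} one Sx Sc x≁c E₁ len {q}
      xu : x ∙ (c ∙ c) ∙ pow c j ≡ ε
      xu = trans (cong (x ∙_) (assoc c c _)) E
      cases : c ∙ c ≡ ε ⊎ S (c ∙ c) ⊎ ℓ (c ∙ c) ≡ 2 → ⊥
      cases (inj₁ e) = proj₂ Sc e
      cases (inj₂ (inj₁ Su)) with ((c ∙ c) ∙ (c ∙ c)) ≟ ε
      ... | yes uu = x≢c (root-unique Su uu Sx Sc (good² Su uu (Sx ∷ Allₚ.replicate⁺ j Sc)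
              (trans (Cent-swap (inv Su uu) x _) xu)
                (≤-reflexive (trans (cong (3 +_) (length-replicate j)) len)) (here refl)) refl)
      ... | no nuu = fin j xu (≤-reflexive (trans (cong (3 +_) (length-replicate j)) len))
        where
        fin : ∀ j → x ∙ (c ∙ c) ∙ pow c j ≡ ε → 3 + length (replicate j c) ≤ M → ⊥
        fin zero xu _ = proj₂ Sx (subst (λ h → x ∙ h ≡ ε) (sym (mutually-inverse⇒≡ (proj₁ Sx) Su xu′))
          xu′)
          where
          xu′ : x ∙ c ∙ c ≡ ε
          xu′ = trans (cong (x ∙_) (sym (identityʳ _))) xu
        fin (suc j) xu le = x≁c (good~ one (Sx ∷ (Su , nuu) ∷ Allₚ.replicate⁺ (suc j) Sc)
          (trans (identityˡ _) xu) le
          (here refl) (there (there (here refl))))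
      cases (inj₂ (inj₂ l)) with m≤n⇒m<n∨m≡n up
        where
        up : 2 + ℓ ((c ∙ c) ⁻¹) ≤ M
        up = ≤-trans (s≤s (s≤s (upper one (Sx ∷ Allₚ.replicate⁺ j Sc)
          (trans (identityˡ _) (trans (sym (swap _ (comm-∙ xc xc))) xu)))))
          (≤-reflexive (trans (cong (3 +_) (length-replicate j)) len))
      ... | inj₂ eq = x≢c (cancelʳ (thin (trans (adj-ℓ Axc) (sym l))
        (suc-injective (suc-injective (trans (adj-exact Axc) (sym eq))))))
      ... | inj₁ lt with complete (c ∙ c)
      ...   | a , _ , t , inv Sa aa , St , e , lt′ with trans (sym l) (S⇒ℓ≡1 (subst S (sym cc≡a) Sa))
        where
        cc≡a : c ∙ c ≡ a
        cc≡a = good² Sa aa (Sc ∷ Sc ∷ St) (trans (cong (a ∙_) (sym (assoc c c _))) e)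
          (≤-trans (s≤s (s≤s (s≤s lt′))) lt) (here refl)
      ...     | ()
      cases (inj₂ (inj₂ l)) | inj₁ lt | _ , _ , t , one , St , e , lt′ = absurd
        (class-order Sc (Sc ∷ St) (λ p → good~ one (Sc ∷ Sc ∷ St) ecc bound (there p) (here refl))
          (trans (sym (identityˡ _)) ecc) nsq)
        where
        ecc : ε ∙ ev (c ∷ c ∷ t) ≡ ε
        ecc = trans (cong (ε ∙_) (sym (assoc c c _))) e
        bound : 2 + length t < M
        bound = ≤-trans (s≤s (s≤s (s≤s lt′))) lt
        absurd : ∃[ q ] (1 ≤ q × q ≤ suc (suc (length t)) × pow c q ≡ ε) → ⊥
        absurd (q , p , le , o) = nord {q} p
          (≤-trans le (ℕₚ.≤-pred (subst (suc (suc (length t)) <_) (sym len) bound))) o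

  module InvPair {x c} (Axc : Adj x c) (xc : x ∙ c ≡ c ∙ x) {a} (Sa : S a) (aa : a ∙ a ≡ ε) where
    open Pair Axc xc public
    open Adj Axc using () renaming (Sx to Sx; Sy to Sc; x≁y to x≁c)

    Z : Cent a 1
    Z = inv Sa aa

    ac-comm : ∀ g → a ∙ g ≡ g ∙ a
    ac-comm = central Sa aa

    aaˡ : ∀ g → a ∙ a ∙ g ≡ g
    aaˡ g = trans (merge g aa) (identityˡ g)

    -- A shorter completion either keeps `a` or brings a second copy that cancels it; in both cases
    -- `x` and `c` stay in a shorter circuit.
    exact-axc : ∀ i j → a ∙ W (suc i) (suc j) ≡ ε → 3 + (i + j) ≡ M → 3 + ℓ ((a ∙ x ∙ c) ⁻¹) ≡ M
    exact-axc i j e len with m≤n⇒m<n∨m≡n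
      (≤-trans (ℕₚ.+-monoʳ-≤ 3 (upper one (SW i j) (trans (identityˡ _) axcW)))
        (≤-reflexive (trans (cong (3 +_) (lenW i j)) len)))
      where
      axcW : (a ∙ x ∙ c) ∙ W i j ≡ ε
      axcW = trans (assoc a _ _) (trans (cong (a ∙_) (trans (assoc x c _) (cong (x ∙_) (sym (Wc i j)))))
        e)
    ... | inj₂ eq = eq
    ... | inj₁ lt with complete (a ∙ x ∙ c)
    ...   | _ , _ , t , one , St , e′ , l′ = ⊥-elim (IH Z (Sx ∷ Sc ∷ St)
              (trans (sym (trans (identityˡ _) (trans (assoc a _ _) (cong (a ∙_) (assoc x c _))))) e′)
              (≤-trans (s≤s (s≤s (s≤s (s≤s l′)))) lt)
                (inj₁ (x , c , here refl , there (here refl) , x≁c)))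
    ...   | b , _ , t , inv Sb bb , St , e′ , l′ = ⊥-elim (IH one (Sx ∷ Sc ∷ St)
              (trans (identityˡ _) (trans (sym
                (trans (cong₂ (λ p q → p ∙ q) (involution-unique Sb Sa bb aa)
                  (trans (assoc a _ _) (cong (a ∙_) (assoc x c _)))) (aaˡ _))) e′))
              (≤-trans (s≤s (s≤s (s≤s (≤-trans (ℕₚ.n≤1+n _) l′)))) (≤-trans (ℕₚ.n≤1+n _) lt))
                (inj₁ (x , c , here refl , there (here refl) , x≁c)))

    axc≢xxc : a ∙ x ∙ c ≢ x ∙ x ∙ c
    axc≢xxc e = S′≢inv Sx aa (sym (cancelʳ e))

    axc≢xcc : a ∙ x ∙ c ≢ x ∙ c ∙ c
    axc≢xcc e = S′≢inv Sc aa (sym (cancelʳ (cancelˡ (trans (sym (Cent-swap Z x c)) e))))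

    -- Contracting `xxc` to a letter leaves a shorter circuit with the involution, all of whose
    -- letters are its unique square root; so `xxc = c`.
    double-xxc∉S : ∀ i j → a ∙ W (2 + i) (2 + j) ≡ ε → 5 + (i + j) ≡ M → ¬ S (x ∙ x ∙ c)
    double-xxc∉S i j E len Sg = proj₂ Sx (fixˡ (trans (assoc x x c) g≡c))
      where
      g : G
      g = x ∙ x ∙ c
      ex : 3 + ℓ (g ⁻¹) ≡ M
      ex = exact-xxc i (suc j) Z E (trans (cong (4 +_) (ℕₚ.+-suc i j)) len)
      gg : g ∙ g ≢ ε
      gg q with trans (sym (cong (2 +_) (m≡2 Sg Sg q))) (trans ex (sym len))
      ... | ()
      gW : a ∙ g ∙ W i (suc j) ≡ ε
      gW = trans (cong (a ∙_) (trans (assoc x _ _)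
        (trans (cong (x ∙_) (assoc x c _)) (cong (λ h → x ∙ x ∙ h) (sym (Wc i (suc j))))))) E
      sq : ∀ {y} → y ∈ g ∷ replicate i x ++ replicate (suc j) c → y ∙ y ≡ a
      sq = good² Sa aa ((Sg , gg) ∷ SW i (suc j)) gW (short₁ 2 i j (below 1 len))
      g≡c : g ≡ c
      g≡c = root-unique Sa aa (Sg , gg) Sc (sq (here refl)) (sq (there (c∈ i j)))

    -- Both exponents are at least 2, so after contracting `axc` to a letter the shorter circuit
    -- still contains `x` and `c`.
    double-axc∉S : ∀ i j → a ∙ W (2 + i) (2 + j) ≡ ε → 5 + (i + j) ≡ M → ¬ S (a ∙ x ∙ c)
    double-axc∉S i j E len Sg = IH one ((Sg , gg) ∷ SW (suc i) (suc j)) (trans (identityˡ _) gW)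
      (short₁ 1 (suc i) j (below 1 len)) (inj₁ (x , c , there (here refl) , there (c∈ (suc i) j) , x≁c))
      where
      g : G
      g = a ∙ x ∙ c
      ex : 3 + ℓ (g ⁻¹) ≡ M
      ex = exact-axc (suc i) (suc j) E (trans (cong (4 +_) (ℕₚ.+-suc i j)) len)
      gg : g ∙ g ≢ ε
      gg q with trans (sym (cong (2 +_) (m≡2 Sg Sg q))) (trans ex (sym len))
      ... | ()
      gW : g ∙ W (suc i) (suc j) ≡ ε
      gW = trans (assoc a _ _) (trans
        (cong (a ∙_) (trans (assoc x c _) (cong (x ∙_) (sym (Wc (suc i) (suc j)))))) E)

    module Single (j : ℕ) (E : a ∙ W 1 (2 + j) ≡ ε) (len : 4 + j ≡ M) where
      nsq : ∀ {d} → S′ d → d ~ c → c ∙ c ≢ d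
      nsq = no-square {n = j} Z Sx Sc x≁c E len

      nord : ∀ {q} → 1 ≤ q → q ≤ 2 + j → pow c q ≢ ε
      nord {q} = no-order {n = 2 + j} Z Sx Sc x≁c E len {q}

      root : ∀ {d} → S′ d → d ~ c → d ≢ c → QP d c
      root _ (inj₁ q) n = ⊥-elim (n q)
      root _ (inj₂ (inj₁ q)) _ = q
      root Sd d~c@(inj₂ (inj₂ q)) _ = ⊥-elim (nsq Sd d~c (proj₁ q))

      ex-axc : 3 + ℓ ((a ∙ x ∙ c) ⁻¹) ≡ M
      ex-axc = exact-axc 0 (suc j) E len

      ex-xcc : 3 + ℓ ((x ∙ c ∙ c) ⁻¹) ≡ M
      ex-xcc = exact-xcc 0 j Z E len

      ltr : ∀ r n → suc r + n ≤ M → r + length (replicate n c) < M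
      ltr r n le = subst (λ h → suc (r + h) ≤ M) (sym (length-replicate n)) le

      -- Since `c²` is not a letter of its class, `d` is a square root of `c`. Then `m c = m d - 1`
      -- is at most `n`, and the relation `c^(m c) = ε` contradicts `no-order`.
      partner-absurd : ∀ {d} n → n ≤ 2 + j → S′ d → d ~ c → d ≢ c → d ∙ pow c n ≡ ε → ⊥
      partner-absurd {d} n le Sd d~c d≢c e with root Sd d~c d≢c
      ... | _ , oc , md = nord {m c} (s≤s z≤n)
        (≤-trans (ℕₚ.≤-pred (subst₂ _≤_ md (cong suc (length-replicate n))
          (m≤ (Allₚ.replicate⁺ n (proj₁ Sc)) e))) le) oc

      axc : ℓ (a ∙ x ∙ c) ≤ 2 → ⊥
      axc le = cases (ℓ≤2-cases le)
        where
        g : G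
        g = a ∙ x ∙ c
        gW : g ∙ pow c (suc j) ≡ ε
        gW = trans (assoc a _ _) (trans (cong (a ∙_) (assoc x c _)) E)
        g≡ : ∀ {d} → g ≡ d ∙ c → a ∙ x ≡ d
        g≡ e = cancelʳ (trans (assoc a x c) e)
        ax≢ε : a ∙ x ≢ ε
        ax≢ε = inv≢S′ Sa aa Sx
        cases : g ≡ ε ⊎ S g ⊎ ℓ g ≡ 2 → ⊥
        cases (inj₁ e) = M≢3 e ex-axc len
        cases (inj₂ (inj₁ Sg)) with (g ∙ g) ≟ ε
        ... | yes gg = small j (ℕₚ.+-cancelˡ-≡ 4 j 0
          (trans len (trans (sym ex-axc) (cong (2 +_) (m≡2 Sg Sg gg))))) gW
          where
          small : ∀ j → j ≡ 0 → g ∙ pow c (suc j) ≡ ε → ⊥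
          small zero _ e = inv≢S′ Sg gg Sc (trans (cong (g ∙_) (sym (identityʳ c))) e)
        ... | no ngg = done (g ≟ c)
          where
          g~c : g ~ c
          g~c = good~ one ((Sg , ngg) ∷ Allₚ.replicate⁺ (suc j) Sc) (trans (identityˡ _) gW)
            (ltr 1 (suc j) (below 1 len)) (here refl) (there (here refl))
          done : Dec (g ≡ c) → ⊥
          done (yes e) = ax≢ε (fixˡ (trans (assoc a x c) e))
          done (no n) = partner-absurd (suc j) (ℕₚ.n≤1+n _) (Sg , ngg) g~c n gW
        cases (inj₂ (inj₂ l)) with two-letters l
        ... | inj₁ (b , s , Sb , bb , Ss , e) = adj-∉S Axc
          (subst S (sym (cancelˡ (trans e (cong (_∙ s) (involution-unique Sb Sa bb aa))))) (proj₁ Ss))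
        ... | inj₂ (v , w , Sv , Sw , e) = done (v ≟ c) (w ≟ c)
          where
          vwW : v ∙ w ∙ pow c (suc j) ≡ ε
          vwW = trans (sym (assoc v w _)) (trans (cong (_∙ pow c (suc j)) (sym e)) gW)
          cl : ∀ {s} → s ∈ v ∷ w ∷ replicate (suc j) c → s ~ c
          cl p = good~ one (Sv ∷ Sw ∷ Allₚ.replicate⁺ (suc j) Sc) (trans (identityˡ _) vwW)
            (ltr 2 (suc j) (≤-reflexive len)) p (there (there (here refl)))
          v~c : v ~ c
          v~c = cl (here refl)
          w~c : w ~ c
          w~c = cl (there (here refl))
          done : Dec (v ≡ c) → Dec (w ≡ c) → ⊥
          -- Here `ax = c`, hence `xx = cc`, and the circuit `c c c^(j+1)` becomes the bad circuit
          -- `x x c^(j+1)`, shorter than `M`.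
          done (yes v≡c) (yes w≡c) = IH one (Sx ∷ Sx ∷ Allₚ.replicate⁺ (suc j) Sc)
            (trans (identityˡ _) (trans (merge (pow c (suc j))
              (trans (sym (aaˡ _)) (trans (cong (a ∙_) (Cent-swap Z x x))
                (trans (sym (assoc a x _)) (cong₂ _∙_ ax≡c ax≡c)))))
              (trans (assoc c c _) (trans (cong₂ (λ p q → p ∙ q ∙ pow c (suc j)) (sym v≡c) (sym w≡c))
                vwW))))
            (ltr 2 (suc j) (≤-reflexive len))
              (inj₁ (x , c , here refl , there (there (here refl)) , x≁c))
            where
            ax≡c : a ∙ x ≡ c
            ax≡c = g≡ (trans e (cong₂ _∙_ v≡c w≡c))
          done (no v≢c) (yes w≡c) = partner-absurd (2 + j) ≤-refl Sv v~c v≢c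
            (trans (cong (λ h → v ∙ h ∙ pow c (suc j)) (sym w≡c)) vwW)
          done (yes v≡c) (no w≢c) = partner-absurd (2 + j) ≤-refl Sw w~c w≢c
            (trans (cong (λ h → w ∙ h ∙ pow c (suc j)) (sym v≡c))
              (trans (swap _ (~-comm (~-trans Sw Sc Sv w~c (~-sym v~c)))) vwW))
          done (no v≢c) (no w≢c) = ax≢ε (fixˡ
            (trans (assoc a x c) (trans e (trans (cong (v ∙_) (partner-unique Sc Sw Sv w~c w≢c v~c v≢c))
              (proj₁ (root Sv v~c v≢c))))))

      -- When `xcc` is the involution itself, contracting it leaves only `aa`, from which no bad
      -- circuit arises. Instead `m x` and `m c` are 3 and 4 in some order, and `a` times the letter
      -- with value 4 is compared with `xc`.
      module Four (len₄ : 4 ≡ M) (E₄ : a ∙ x ∙ c ∙ c ≡ ε) where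
        in-circuit : ∀ {s} → s ∈ x ∷ c ∷ c ∷ [] → m s ≤ 4
        in-circuit = m-upper Z (Sx ∷ Sc ∷ Sc ∷ []) (trans (cong (λ h → a ∙ x ∙ c ∙ h) (identityʳ c)) E₄)

        type-xc : ℓ ((x ∙ c) ⁻¹) ≡ 2
        type-xc = suc-injective (suc-injective (trans (adj-exact Axc) (sym len₄)))

        -- The same argument applies to ax (with rest cc) and to ac (with rest xc).
        contra : ∀ {s r} → S′ s → m s ≡ 4 → S′ r → m r ≡ 3 → a ∙ s ≢ x ∙ c → (a ∙ s ≡ r → m s ≤ 3) →
          (∃[ p ] ∃[ q ] (S′ p × S′ q × (a ∙ s) ∙ p ∙ q ≡ ε)) → ⊥
        contra {s} {r} Ss ms Sr mr ≢xc ≤3 (p , q , Sp , Sq , e) = cases (ℓ≤2-cases (ℓ₂≤2 Sa (proj₁ Ss)))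
          where
          lower : 2 ≤ ℓ ((a ∙ s) ⁻¹)
          lower with close (a ∙ s)
          ... | t , St , e′ , l = ℕₚ.≤-pred (ℕₚ.≤-pred (subst₂ _≤_ ms (cong (2 +_) l)
                (m≤∈ {w = a ∷ s ∷ t} (Sa ∷ proj₁ Ss ∷ St) (trans (sym (assoc a s _)) e′)
                  (there (here refl)))))
          inv2 : ℓ ((a ∙ s) ⁻¹) ≡ 2
          inv2 = ≤-antisym (ℓ⁻¹≤ (proj₁ Sp ∷ proj₁ Sq ∷ [])
            (trans (cong (λ h → (a ∙ s) ∙ p ∙ h) (identityʳ q)) e)) lower
          cases : a ∙ s ≡ ε ⊎ S (a ∙ s) ⊎ ℓ (a ∙ s) ≡ 2 → ⊥
          cases (inj₁ e) = inv≢S′ Sa aa Ss e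
          cases (inj₂ (inj₁ Sas)) = <-irrefl refl
            (subst (_≤ 3) ms (≤3 (m-inj Sas (proj₁ Sr) (trans (cong suc inv2) (sym mr)))))
          cases (inj₂ (inj₂ l)) = ≢xc (thin (trans l (sym (adj-ℓ Axc))) (trans inv2 (sym type-xc)))

        three-or-four : ∀ {s} → S′ s → s ∈ x ∷ c ∷ c ∷ [] → m s ≡ 3 ⊎ m s ≡ 4
        three-or-four Ss p with m≤n⇒m<n∨m≡n (S′⇒m≥3 Ss)
        ... | inj₂ e = inj₁ (sym e)
        ... | inj₁ lt = inj₂ (≤-antisym (in-circuit p) lt)

        ccc : ∀ {s r} → a ∙ s ≡ r → s ∙ s ≡ r ∙ r
        ccc {s} {r} refl = sym (trans (assoc a s _)
          (trans (cong (a ∙_) (sym (Cent-swap Z s s))) (aaˡ _)))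

        absurd : ⊥
        absurd with three-or-four Sx (here refl) | three-or-four Sc (there (here refl))
        ... | inj₁ mx | inj₁ mc = x≢c (m-inj (proj₁ Sx) (proj₁ Sc) (trans mx (sym mc)))
        ... | inj₂ mx | inj₂ mc = x≢c (m-inj (proj₁ Sx) (proj₁ Sc) (trans mx (sym mc)))
        ... | inj₁ mx | inj₂ mc = contra Sc mc Sx mx
              (λ e → S′≢inv Sx aa (sym (cancelʳ e)))
              (λ ac≡x → order-≥ {c} {2} (proj₁ Sc) (trans (cong (λ h → c ∙ c ∙ h) (identityʳ c))
                (trans (sym (aaˡ _)) (trans (cong (a ∙_)
                  (trans (sym (assoc a c _)) (cong (_∙ (c ∙ c)) ac≡x))) E₄))))
              (x , c , Sx , Sc , trans (assoc a c _) (trans (cong (a ∙_) (swap c (sym xc))) E₄))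
        ... | inj₂ mx | inj₁ mc = contra Sx mx Sc mc
              (λ e → S′≢inv Sc aa (sym (cancelˡ (trans (sym (ac-comm x)) e))))
              (λ ax≡c → m-upper one (Sx ∷ Sx ∷ Sc ∷ [])
                (trans (identityˡ _) (trans (cong (λ h → x ∙ x ∙ h) (identityʳ c))
                (trans (merge c (ccc ax≡c)) (trans (assoc c c c)
                  (trans (cong (_∙ (c ∙ c)) (sym ax≡c)) (trans (assoc a x _) E₄)))))) (here refl))
              (c , c , Sc , Sc , trans (assoc a x _) E₄)

      xcc : ℓ (x ∙ c ∙ c) ≤ 2 → ⊥
      xcc le = cases (ℓ≤2-cases le)
        where
        g : G
        g = x ∙ c ∙ c
        gW : a ∙ g ∙ pow c j ≡ ε
        gW = trans (cong (a ∙_) (trans (assoc x _ _) (cong (x ∙_) (assoc c c _)))) E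
        cases : g ≡ ε ⊎ S g ⊎ ℓ g ≡ 2 → ⊥
        cases (inj₁ e) = M≢3 e ex-xcc len
        cases (inj₂ (inj₁ Sg)) with (g ∙ g) ≟ ε
        ... | yes gg = small j (ℕₚ.+-cancelˡ-≡ 4 j 0
          (trans len (trans (sym ex-xcc) (cong (2 +_) (m≡2 Sg Sg gg))))) gW len
          where
          small : ∀ j → j ≡ 0 → a ∙ g ∙ pow c j ≡ ε → 4 + j ≡ M → ⊥
          small zero _ e l = Four.absurd l (trans (cong (a ∙_) (sym (identityʳ g))) e)
        ... | no ngg = fin j gW len (ltr 2 j (below 1 len))
          where
          Sg′ : S′ g
          Sg′ = Sg , ngg
          fin : ∀ j → a ∙ g ∙ pow c j ≡ ε → 4 + j ≡ M → suc (length (g ∷ replicate j c)) < M → ⊥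
          fin zero e l lt with trans l (trans (sym ex-xcc)
            (cong (2 +_) (root⇒m≡3 Sa aa Sg′ (good² Sa aa (Sg′ ∷ []) e lt (here refl)))))
          ... | ()
          fin (suc j) e l lt = adj-≢ε Axc
            (fixˡ (trans (assoc x c c) (root-unique Sa aa Sg′ Sc (sq (here refl))
              (sq (there (here refl))))))
            where
            sq : ∀ {y} → y ∈ g ∷ replicate (suc j) c → y ∙ y ≡ a
            sq = good² Sa aa (Sg′ ∷ Allₚ.replicate⁺ (suc j) Sc) e lt
        cases (inj₂ (inj₂ l)) with two-letters l
        ... | inj₁ (b , s , Sb , bb , Ss , e) = fin j sW ≤-refl (ltr 1 j (below 2 len))
          where
          e′ : g ≡ a ∙ s
          e′ = trans e (cong (_∙ s) (involution-unique Sb Sa bb aa))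
          sW : s ∙ pow c j ≡ ε
          sW = trans (sym (aaˡ _)) (trans
            (cong (a ∙_) (trans (sym (assoc a s _)) (cong (_∙ pow c j) (sym e′)))) gW)
          fin : ∀ i → s ∙ pow c i ≡ ε → i ≤ j → 1 + length (replicate i c) < M → ⊥
          fin zero e _ _ = S′≢ε Ss (trans (sym (identityʳ s)) e)
          fin (suc i) sW le lt with s ≟ c
          ... | yes s≡c = adj-∉S Axc (subst S
            (sym (cancelʳ (trans (assoc x c c) (trans e′ (cong (a ∙_) s≡c))))) Sa)
          ... | no s≢c = partner-absurd (suc i) (≤-trans le (ℕₚ.m≤n+m j 2)) Ss
                (good~ one (Ss ∷ Allₚ.replicate⁺ (suc i) Sc) (trans (identityˡ _) sW) lt (here refl)
                  (there (here refl))) s≢c sW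
        ... | inj₂ (v , w , Sv , Sw , e) = contra
          where
          sq : ∀ {y} → y ∈ v ∷ w ∷ replicate j c → y ∙ y ≡ a
          sq = good² Sa aa (Sv ∷ Sw ∷ Allₚ.replicate⁺ j Sc)
            (trans (cong (a ∙_) (trans (sym (assoc v w _)) (cong (_∙ pow c j) (sym e)))) gW)
              (ltr 3 j (≤-reflexive len))
          g≡a : g ≡ a
          g≡a = trans e (trans (cong (v ∙_)
            (root-unique Sa aa Sw Sv (sq (there (here refl))) (sq (here refl)))) (sq (here refl)))
          contra : ⊥
          contra with trans (sym l) (S⇒ℓ≡1 (subst S (sym g≡a) Sa))
          ... | ()

      absurd : ⊥
      absurd with ℓ (a ∙ x ∙ c) ℕₚ.≤? 2 | ℓ (x ∙ c ∙ c) ℕₚ.≤? 2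
      ... | yes p | _ = axc p
      ... | no _ | yes q = xcc q
      ... | no p | no q = axc≢xcc (thin
            (trans (≤-antisym (ℓ₃≤3 Sa (proj₁ Sx) (proj₁ Sc)) (ℕₚ.≰⇒> p))
              (sym (≤-antisym (ℓ₃≤3 (proj₁ Sx) (proj₁ Sc) (proj₁ Sc)) (ℕₚ.≰⇒> q))))
            (ℕₚ.+-cancelˡ-≡ 3 _ _ (trans ex-axc (sym ex-xcc))))

  Adj-swap : ∀ {x c} → Adj x c → x ∙ c ≡ c ∙ x → Adj c x
  Adj-swap (adjacent Sx Sc n {z} t Z St e l) xc = adjacent Sc Sx (λ q → n (~-sym q)) t Z St
    (trans (cong (z ∙_) (swap (ev t) (sym xc))) e) l

  no-commuting-pair : ∀ {x c} → Adj x c → x ∙ c ≡ c ∙ x → ⊥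
  no-commuting-pair {x} {c} Axc xc = go P.powers
    where
    Acx : Adj c x
    Acx = Adj-swap Axc xc
    module P = Pair Axc xc
    module Q = Pair Acx (sym xc)
    open Adj Axc using () renaming (Sx to Sx; Sy to Sc)
    W-swap : ∀ i j → P.W i j ≡ Q.W j i
    W-swap i j = trans (P.W≡ i j) (trans
      (comm-ev {w = replicate j c} (Allₚ.replicate⁺ j (sym (comm-pow i (sym xc))))) (sym (Q.W≡ j i)))
    go : P.Powers → ⊥
    go (z , k , i , j , Z , e , len) = by-cent i j Z e len
      where
      by-cent : ∀ {z k} i j → Cent z k → z ∙ P.W (suc i) (suc j) ≡ ε → k + (2 + i + j) ≡ M → ⊥
      by-cent zero j one e len = P.single j (trans (sym (identityˡ _)) e) len
      by-cent i@(suc _) zero one e len = Q.single i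
        (trans (sym (W-swap (suc i) 1)) (trans (sym (identityˡ _)) e))
          (trans (cong (2 +_) (sym (ℕₚ.+-identityʳ i))) len)
      by-cent (suc i) (suc j) one e len = both (ℓ (x ∙ x ∙ c) ℕₚ.≤? 2) (ℓ (c ∙ c ∙ x) ℕₚ.≤? 2)
        where
        E : P.W (2 + i) (2 + j) ≡ ε
        E = trans (sym (identityˡ _)) e
        len′ : 4 + (i + j) ≡ M
        len′ = trans (cong (3 +_) (sym (ℕₚ.+-suc i j))) len
        xcc≡ccx : x ∙ c ∙ c ≡ c ∙ c ∙ x
        xcc≡ccx = trans (comm-∙ xc xc) (assoc c c x)
        both : Dec (ℓ (x ∙ x ∙ c) ≤ 2) → Dec (ℓ (c ∙ c ∙ x) ≤ 2) → ⊥
        both (yes p) _ = P.double i j E len′ p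
        both (no _) (yes q) = Q.double j i (trans (sym (W-swap (2 + i) (2 + j))) E)
          (trans (cong (4 +_) (ℕₚ.+-comm j i)) len′) q
        both (no p) (no q) = P.xxc≢xcc (thin
          (trans (≤-antisym (ℓ₃≤3 (proj₁ Sx) (proj₁ Sx) (proj₁ Sc)) (ℕₚ.≰⇒> p))
                 (sym (≤-antisym (ℓ₃≤3 (proj₁ Sx) (proj₁ Sc) (proj₁ Sc))
                   (subst (λ h → 3 ≤ ℓ h) (sym xcc≡ccx) (ℕₚ.≰⇒> q)))))
          (ℕₚ.+-cancelˡ-≡ 3 _ _ (trans (P.exact-xxc i (suc j) one e len)
            (sym (P.exact-xcc (suc i) j one e len′)))))
      by-cent zero zero (inv Sa aa) e len = P.x≢c
        (m-inj (proj₁ Sx) (proj₁ Sc) (trans (three Sx (here refl))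
          (sym (three Sc (there (here refl))))))
        where
        three : ∀ {s} → S′ s → s ∈ x ∷ c ∷ [] → m s ≡ 3
        three Ss p = ≤-antisym (m-upper (inv Sa aa) (Sx ∷ Sc ∷ []) e p) (S′⇒m≥3 Ss)
      by-cent zero (suc j) (inv Sa aa) e len = InvPair.Single.absurd Axc xc Sa aa j e len
      by-cent {z} (suc i) zero (inv Sa aa) e len = InvPair.Single.absurd Acx (sym xc) Sa aa i
        (trans (cong (z ∙_) (sym (W-swap (2 + i) 1))) e)
          (trans (cong (4 +_) (sym (ℕₚ.+-identityʳ i))) len)
      by-cent {a} (suc i) (suc j) (inv Sa aa) e len = pigeon (ℓ gA ℕₚ.≤? 2) (ℓ gX ℕₚ.≤? 2)
        (ℓ gC ℕₚ.≤? 2)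
        where
        module I = InvPair Axc xc Sa aa
        module J = InvPair Acx (sym xc) Sa aa
        gA gX gC : G
        gA = a ∙ x ∙ c
        gX = x ∙ x ∙ c
        gC = x ∙ c ∙ c
        len′ : 5 + (i + j) ≡ M
        len′ = trans (cong (4 +_) (sym (ℕₚ.+-suc i j))) len
        eA : 3 + ℓ (gA ⁻¹) ≡ M
        eA = I.exact-axc (suc i) (suc j) e len
        eX : 3 + ℓ (gX ⁻¹) ≡ M
        eX = I.exact-xxc i (suc j) (inv Sa aa) e len
        eC : 3 + ℓ (gC ⁻¹) ≡ M
        eC = I.exact-xcc (suc i) j (inv Sa aa) e len′
        same : ∀ {g h} → 3 + ℓ (g ⁻¹) ≡ M → 3 + ℓ (h ⁻¹) ≡ M → ℓ g ≡ ℓ h → g ≡ h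
        same p q r = thin r (ℕₚ.+-cancelˡ-≡ 3 _ _ (trans p (sym q)))
        two : ∀ {g} → 3 + ℓ (g ⁻¹) ≡ M → ¬ S g → ℓ g ≤ 2 → ℓ g ≡ 2
        two p ns le with ℓ≤2-cases le
        ... | inj₁ q = ⊥-elim (M≢3 q p len′)
        ... | inj₂ (inj₁ s) = ⊥-elim (ns s)
        ... | inj₂ (inj₂ l) = l
        ccx∉S : ¬ S (c ∙ c ∙ x)
        ccx∉S = J.double-xxc∉S j i (trans (cong (a ∙_) (sym (W-swap (2 + i) (2 + j)))) e)
          (trans (cong (5 +_) (ℕₚ.+-comm j i)) len′)
        2A : ℓ gA ≤ 2 → ℓ gA ≡ 2
        2A = two eA (I.double-axc∉S i j e len′)
        2X : ℓ gX ≤ 2 → ℓ gX ≡ 2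
        2X = two eX (I.double-xxc∉S i j e len′)
        2C : ℓ gC ≤ 2 → ℓ gC ≡ 2
        2C = two eC (λ s → ccx∉S (subst S (trans (comm-∙ xc xc) (assoc c c x)) s))
        3A : ¬ ℓ gA ≤ 2 → ℓ gA ≡ 3
        3A p = ≤-antisym (ℓ₃≤3 Sa (proj₁ Sx) (proj₁ Sc)) (ℕₚ.≰⇒> p)
        3X : ¬ ℓ gX ≤ 2 → ℓ gX ≡ 3
        3X p = ≤-antisym (ℓ₃≤3 (proj₁ Sx) (proj₁ Sx) (proj₁ Sc)) (ℕₚ.≰⇒> p)
        3C : ¬ ℓ gC ≤ 2 → ℓ gC ≡ 3
        3C p = ≤-antisym (ℓ₃≤3 (proj₁ Sx) (proj₁ Sc) (proj₁ Sc)) (ℕₚ.≰⇒> p)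
        -- Each of the three elements has length 2 or 3, so two of them share it; their inverse
        -- lengths agree, and thinness identifies them.
        pigeon : Dec (ℓ gA ≤ 2) → Dec (ℓ gX ≤ 2) → Dec (ℓ gC ≤ 2) → ⊥
        pigeon (yes p) (yes q) _ = I.axc≢xxc (same eA eX (trans (2A p) (sym (2X q))))
        pigeon (no p) (no q) _ = I.axc≢xxc (same eA eX (trans (3A p) (sym (3X q))))
        pigeon (yes p) (no _) (yes r) = I.axc≢xcc (same eA eC (trans (2A p) (sym (2C r))))
        pigeon (no p) (yes _) (no r) = I.axc≢xcc (same eA eC (trans (3A p) (sym (3C r))))
        pigeon (yes _) (no q) (no r) = P.xxc≢xcc (same eX eC (trans (3X q) (sym (3C r))))
        pigeon (no _) (yes q) (yes r) = P.xxc≢xcc (same eX eC (trans (2X q) (sym (2C r))))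

  no-adj : ∀ {x y} → ¬ Adj x y
  no-adj A with commuting 0 t Z Sx Sy St x≁y circ len
    where open Adj A
  ... | _ , _ , A′ , xc = no-commuting-pair A′ xc

  -- As `~` is transitive, on the way from `h` to an inequivalent letter some consecutive pair is
  -- inequivalent.
  find-adj : ∀ h t {y} → All S′ (h ∷ t) → y ∈ t → ¬ h ~ y → ∃[ u ] ∃[ p ] ∃[ q ] ∃[ w ]
    (h ∷ t ≡ u ++ p ∷ q ∷ w × ¬ p ~ q)
  find-adj h (s ∷ t) {y} (Sh ∷ Ss ∷ St) y∈ n with h ~? s
  ... | no n′ = [] , h , s , t , refl , n′
  ... | yes h~s with y∈
  ...   | here refl = ⊥-elim (n h~s)
  ...   | there y∈t with find-adj s t (Ss ∷ St) y∈t (λ q → n (~-trans Sh Ss (All.lookup St y∈t) h~s q))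
  ...     | u , p , q , w , e , n′ = h ∷ u , p , q , w , cong (h ∷_) e , n′

  one-class : ∀ {z k v} → Cent z k → All S′ v → z ∙ ev v ≡ ε → k + length v ≡ M → ∀ {x y} → x ∈ v → y ∈
    v → x ~ y
  one-class {z} {k} {h ∷ t} Z Sv e len {x} {y} x∈ y∈ = ~-trans (All.lookup Sv x∈)
    (All.lookup Sv (here refl)) (All.lookup Sv y∈) (~-sym (h~ x∈)) (h~ y∈)
    where
    h~ : ∀ {s} → s ∈ h ∷ t → h ~ s
    h~ (here refl) = ~-refl
    h~ {s} (there p) with h ~? s
    ... | yes q = q
    ... | no n with find-adj h t Sv p n
    ...   | u , p′ , q , w , eq , n′ = ⊥-elim
      (no-adj (mkAdj u w Z (subst (All S′) eq Sv) n′ (subst (λ l → z ∙ ev l ≡ ε) eq e)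
        (trans (cong (λ l → k + length l) (sym eq)) len)))

  -- Parity of the involution in a circuit within one class

  module Odd {a} (Sa : S a) (aa : a ∙ a ≡ ε) where
    Z : Cent a 1
    Z = inv Sa aa

    a≢ε : a ≢ ε
    a≢ε refl = ε∉S Sa

    aaˡ : ∀ g → a ∙ a ∙ g ≡ g
    aaˡ g = trans (merge g aa) (identityˡ g)

    -- Apart from short circuits, a circuit through `x` of length below `M` would give `x² = a` or a
    -- power relation shortening `a x^q`; hence `m x = M`. Then `xx` and `ax` have length 2 and
    -- inverse length `M - 2`, so `x = a`.
    pure-odd : ∀ {x} q → S′ x → x ∙ x ≢ a → a ∙ pow x q ≡ ε → suc q ≡ M → ⊥
    pure-odd zero Sx n e len = a≢ε (trans (sym (identityʳ a)) e)
    pure-odd {x} 1 Sx n e len = inv≢S′ Sa aa Sx (trans (cong (a ∙_) (sym (identityʳ x))) e)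
    pure-odd {x} 2 Sx n e len = n (trans (sym (aaˡ _))
      (trans (cong (a ∙_) (trans (cong (λ h → a ∙ x ∙ h) (sym (identityʳ x))) e)) (identityʳ a)))
    pure-odd {x} (suc (suc (suc q))) Sx n e len = S′≢inv Sx aa (cancelʳ (thin (trans ℓxx (sym ℓax))
        (suc-injective (suc-injective (trans exact-xx (sym exact-ax))))))
      where
      nsq : ∀ {d} → S′ d → x ∙ x ≢ d
      nsq {d} Sd refl = IH Z (Sd ∷ Allₚ.replicate⁺ (suc q) Sx) (trans (cong (a ∙_) (assoc x x _)) e)
        (≤-reflexive (trans (cong (4 +_) (length-replicate q)) len))
          (inj₂ (a≢ε , x , there (here refl) , n))
      nord : ∀ {r} → 1 ≤ r → r ≤ 3 + q → pow x r ≢ ε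
      nord {r} 1≤r r≤ o = go (3 + q ∸ r) (trans (cong (a ∙_) (sym (pow-drop {x} {r} {3 + q} o r≤))) e)
        (ℕₚ.∸-monoʳ-< 1≤r r≤)
        where
        go : ∀ s → a ∙ pow x s ≡ ε → s < 3 + q → ⊥
        go zero e _ = a≢ε (trans (sym (identityʳ a)) e)
        go (suc s) e lt = IH Z (Allₚ.replicate⁺ (suc s) Sx) e
          (≤-trans (s≤s (s≤s (≤-reflexive (length-replicate (suc s)))))
            (≤-trans (s≤s lt) (≤-reflexive len)))
          (inj₂ (a≢ε , x , here refl , n))
      mx≤ : m x ≤ M
      mx≤ = subst (m x ≤_) (trans (cong (4 +_) (length-replicate q)) len)
        (m-upper Z (Allₚ.replicate⁺ (3 + q) Sx) e (here refl))
      M≤mx : M ≤ m x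
      M≤mx with m≤n⇒m<n∨m≡n mx≤
      ... | inj₂ eq = ≤-reflexive (sym eq)
      ... | inj₁ lt with m-complete x
      ...   | b , _ , t , inv Sb bb , St , e′ , l = ⊥-elim
        (n (trans (good² Sb bb (Sx ∷ St) e′ (subst (_< M) (sym l) lt) (here refl))
          (involution-unique Sb Sa bb aa)))
      ...   | _ , _ , t , one , St , e′ , l with class-order Sx St
        (λ p → good~ one (Sx ∷ St) e′ bound (there p) (here refl)) (trans (sym (identityˡ _)) e′)
          (λ Sd _ → nsq Sd)
        where
        bound : suc (length t) < M
        bound = subst (_< M) (sym l) lt
      ...     | r , 1≤r , r≤ , o = ⊥-elim
        (nord {r} 1≤r (ℕₚ.≤-pred (≤-trans (s≤s (≤-trans r≤ (≤-reflexive l)))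
          (≤-trans lt (≤-reflexive (sym len))))) o)
      lower₂ : ∀ g → S g → M ≤ 2 + ℓ ((g ∙ x) ⁻¹)
      lower₂ g Sg with close (g ∙ x)
      ... | t , St , e′ , l = ≤-trans M≤mx
        (≤-trans (m≤∈ {w = g ∷ x ∷ t} (Sg ∷ proj₁ Sx ∷ St) (trans (sym (assoc g x _)) e′)
          (there (here refl))) (≤-reflexive (cong (2 +_) l)))
      exact-xx : 2 + ℓ ((x ∙ x) ⁻¹) ≡ M
      exact-xx = ≤-antisym (≤-trans (s≤s
        (s≤s (upper Z (Allₚ.replicate⁺ (suc q) Sx) (trans (cong (a ∙_) (assoc x x _)) e))))
        (≤-reflexive (trans (cong (4 +_) (length-replicate q)) len))) (lower₂ x (proj₁ Sx))
      exact-ax : 2 + ℓ ((a ∙ x) ⁻¹) ≡ M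
      exact-ax = ≤-antisym (≤-trans (s≤s
        (s≤s (upper one (Allₚ.replicate⁺ (2 + q) Sx) (trans (identityˡ _) (trans (assoc a x _) e)))))
        (≤-reflexive (trans (cong (4 +_) (length-replicate q)) len))) (lower₂ a Sa)
      ¬Sxx : ¬ S (x ∙ x)
      ¬Sxx Su with ((x ∙ x) ∙ (x ∙ x)) ≟ ε
      ... | yes uu = n (involution-unique Su Sa uu aa)
      ... | no nuu = nsq (Su , nuu) refl
      ℓxx : ℓ (x ∙ x) ≡ 2
      ℓxx with ℓ≤2-cases (ℓ₂≤2 (proj₁ Sx) (proj₁ Sx))
      ... | inj₁ e = ⊥-elim (proj₂ Sx e)
      ... | inj₂ (inj₁ s) = ⊥-elim (¬Sxx s)
      ... | inj₂ (inj₂ l) = l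
      ℓax : ℓ (a ∙ x) ≡ 2
      ℓax with ℓ≤2-cases (ℓ₂≤2 Sa (proj₁ Sx))
      ... | inj₁ e = ⊥-elim (inv≢S′ Sa aa Sx e)
      ... | inj₂ (inj₂ l) = l
      ... | inj₂ (inj₁ s) = ⊥-elim (<-irrefl refl (≤-trans (≤-reflexive len) (≤-trans M≤mx
            (subst (m x ≤_) (cong (3 +_) (length-replicate q))
              (m≤∈ {w = (a ∙ x) ∷ replicate (2 + q) x} (s ∷ Allₚ.replicate⁺ (2 + q) (proj₁ Sx))
                (trans (assoc a x _) e) (there (here refl)))))))

    -- A square root `w` of the involution has `m w = 3`, so the relation would read `w³ = aw = ε`.
    QP-square : ∀ {w} → S′ w → pow w (m w) ≡ ε → w ∙ w ≢ a
    QP-square {w} Sw o ww = inv≢S′ Sa aa Sw (begin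
      a ∙ w          ≡⟨ cong (_∙ w) ww ⟨
      (w ∙ w) ∙ w    ≡⟨ assoc w w w ⟩
      w ∙ w ∙ w      ≡⟨ cong (λ h → w ∙ w ∙ h) (identityʳ w) ⟨
      pow w 3        ≡⟨ cong (pow w) (root⇒m≡3 Sa aa Sw ww) ⟨
      pow w (m w)    ≡⟨ o ⟩
      ε              ∎)
      where open ≡-Reasoning

    -- Two copies of `y` contract to `w`; the shorter circuit gives `w² = a`, against `QP-square`. A
    -- single copy gives `a y w^q = ε`: either `w^(m w)` can be deleted, or `m w = q + 1`, so that
    -- `ay = w`, and squaring gives `w = w²`.
    pair-odd : ∀ {v y w} → All S′ v → (∀ {s r} → s ∈ v → r ∈ v → s ~ r) → a ∙ ev v ≡ ε → suc (length v)
      ≡ M →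
      y ∈ v → w ∈ v → QP y w → y ≢ w → ⊥
    pair-odd {v} {y} {w} Sv cl e len y∈ w∈ (yy , ow , my) y≢w with pull y∈ Sv (λ p → cl p y∈)
    ... | v₁ , Sv₁ , front , _ , l₁ , sub₁ = cases (∈-or-avoids y v₁)
      where
      Sy : S′ y
      Sy = All.lookup Sv y∈
      Sw : S′ w
      Sw = All.lookup Sv w∈
      e₁ : a ∙ y ∙ ev v₁ ≡ ε
      e₁ = trans (cong (a ∙_) (sym front)) e
      cases : (y ∈ v₁) ⊎ (∀ {s} → s ∈ v₁ → s ≢ y) → ⊥
      cases (inj₁ p) with pull p Sv₁ (λ q → cl (sub₁ q) y∈)
      ... | v₂ , Sv₂ , front₂ , _ , l₂ , _ = QP-square Sw ow (good² Sa aa (Sw ∷ Sv₂)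
              (trans (cong (a ∙_) (trans (sym (merge (ev v₂) yy)) (cong (y ∙_) (sym front₂)))) e₁)
              (≤-reflexive (trans (cong (2 +_) (sym l₂)) (trans (cong suc (sym l₁)) len))) (here refl))
      cases (inj₂ ≢y) with avoiding Sy Sv₁ (λ p → cl (sub₁ p) y∈) ≢y
      ... | inj₁ refl = inv≢S′ Sa aa Sy (trans (cong (a ∙_) (sym (identityʳ y))) e₁)
      ... | inj₂ (d , d∈ , pure) = fin
        where
        d≡w : d ≡ w
        d≡w = partner-unique Sy (All.lookup Sv₁ d∈) Sw (cl (sub₁ d∈) y∈) (≢y d∈) (cl w∈ y∈)
          (λ q → y≢w (sym q))
        q : ℕ
        q = length v₁
        e₂ : a ∙ y ∙ pow w q ≡ ε
        e₂ = trans (cong (λ h → a ∙ y ∙ h)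
          (trans (cong (λ h → pow h q) (sym d≡w)) (cong ev (sym pure)))) e₁
        len₂ : 2 + q ≡ M
        len₂ = trans (cong suc (sym l₁)) len
        mw≤ : m w ≤ suc q
        mw≤ = ℕₚ.≤-pred (subst (_≤ 2 + q) my (subst (λ h → m y ≤ 2 + h) (length-replicate q)
          (m-upper Z (Sy ∷ Allₚ.replicate⁺ q Sw) e₂ (here refl))))
        fin : ⊥
        fin with m≤n⇒m<n∨m≡n mw≤
        ... | inj₁ lt = IH Z (Sy ∷ Allₚ.replicate⁺ (q ∸ m w) Sw)
              (trans (cong (λ h → a ∙ y ∙ h) (sym (pow-drop {w} {m w} {q} ow (ℕₚ.≤-pred lt)))) e₂)
              (≤-trans (s≤s (s≤s (s≤s (≤-reflexive (length-replicate (q ∸ m w))))))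
                (≤-trans (s≤s (s≤s (ℕₚ.∸-monoʳ-< {q} (s≤s z≤n) (ℕₚ.≤-pred lt)))) (≤-reflexive len₂)))
              (inj₂ (a≢ε , y , here refl , λ h → S′≢inv Sw aa (trans (sym yy) h)))
        ... | inj₂ eq = S′≢ε Sw (fixʳ (trans (cong₂ _∙_ (sym ay) (sym ay))
          (trans (trans (assoc a y _) (trans (cong (a ∙_) (sym (Cent-swap Z y y))) (aaˡ _))) yy)))
          where
          ay : a ∙ y ≡ w
          ay = cancelʳ (trans (assoc a y (pow w q)) (trans e₂ (sym (trans (cong (pow w) (sym eq)) ow))))

    no-odd : ∀ {v x} → All S′ v → a ∙ ev v ≡ ε → suc (length v) ≡ M → x ∈ v → x ∙ x ≢ a → ⊥
    no-odd {v} {x} Sv e len x∈ n with pure? x v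
    ... | inj₁ pure = pure-odd (length v) (All.lookup Sv x∈) n
      (trans (cong (λ h → a ∙ ev h) (sym pure)) e) len
    ... | inj₂ (d , d∈ , d≢x) with one-class Z Sv e len d∈ x∈
    ...   | inj₁ q = d≢x q
    ...   | inj₂ (inj₁ q) = pair-odd Sv (one-class Z Sv e len) e len d∈ x∈ q d≢x
    ...   | inj₂ (inj₂ q) = pair-odd Sv (one-class Z Sv e len) e len x∈ d∈ q (λ h → d≢x (sym h))

  no-bad-M : ∀ {z k v} → Cent z k → All S′ v → z ∙ ev v ≡ ε → k + length v ≡ M → ¬ Bad z v
  no-bad-M Z Sv e len (inj₁ (x , y , x∈ , y∈ , n)) = n (one-class Z Sv e len x∈ y∈)
  no-bad-M one Sv e len (inj₂ (n , _)) = n refl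
  no-bad-M (inv Sa aa) Sv e len (inj₂ (_ , x , x∈ , n)) = Odd.no-odd Sa aa Sv e len x∈ n

module _ (T : ThinGroup) where
  open Letters T

  no-bad : ∀ {z k v} → Cent z k → All S′ v → z ∙ ev v ≡ ε → ¬ Bad z v
  no-bad Z Sv e = <-rec
    (λ M → ∀ {z k v} → Cent z k → All S′ v → z ∙ ev v ≡ ε → k + length v ≡ M → ¬ Bad z v)
    (λ M rec → Minimal.no-bad-M T M (λ Z Sv e lt → rec lt Z Sv e refl)) _ Z Sv e refl

-- Generating sets of thin groups

-- Within the classification, finiteness of the group enters only as `search`, the decidability of
-- existential statements.
module Classification (T : ThinGroup)
  (search : ∀ {P : ThinGroup.G T → Set} → (∀ g → Dec (P g)) → Dec (∃ P)) where
  open Letters T public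

  record Cyclic (n : ℕ) (L : List ℕ) : Set where
    field
      y         : G
      order     : pow y n ≡ ε
      minimal   : ∀ i → 0 < i → i < n → pow y i ≢ ε
      generates : ∀ g → ∃[ i ] g ≡ pow y i
      S⇒        : ∀ {g} → S g → ∃[ s ] (s ∈ L × g ≡ pow y s)
      ⇒S        : ∀ {s} → s ∈ L → S (pow y s)

  record Split (n : ℕ) (L : List (ℕ × ℕ)) : Set where
    field
      a y       : G
      aa        : a ∙ a ≡ ε
      ay        : a ∙ y ≡ y ∙ a
      order     : pow y n ≡ ε
      minimal   : ∀ i → 0 < i → i < n → pow y i ≢ ε
      disjoint  : ∀ i → a ≢ pow y i
      generates : ∀ g → ∃[ e ] ∃[ i ] g ≡ pow a e ∙ pow y i
      S⇒        : ∀ {g} → S g → ∃[ s ] (s ∈ L × g ≡ pow a (proj₁ s) ∙ pow y (proj₂ s))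
      ⇒S        : ∀ {s} → s ∈ L → S (pow a (proj₁ s) ∙ pow y (proj₂ s))

  Classes : Set
  Classes = (∃[ n ] (2 ≤ n × Cyclic n (1 ∷ [])))
    ⊎ (∃[ n ] (2 ≤ n × Cyclic (2 * n) (1 ∷ 2 ∷ [])))
    ⊎ (∃[ n ] (3 ≤ n × Split n ((1 , 0) ∷ (0 , 1) ∷ [])))
    ⊎ (∃[ n ] (3 ≤ n × Split (2 * n) ((1 , 0) ∷ (0 , 1) ∷ (0 , 2) ∷ [])))

  pow-1 : ∀ x → x ≡ pow x 1
  pow-1 x = sym (identityʳ x)

  Cyclic-generates : ∀ {y} {L : List ℕ} → (∀ {g} → S g → ∃[ s ] (s ∈ L × g ≡ pow y s)) → ∀ g → ∃[ i ] g
    ≡ pow y i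
  Cyclic-generates {y} S⇒ g with geodesic g
  ... | w , Sw , refl , _ = go w Sw
    where
    go : ∀ w → All S w → ∃[ i ] ev w ≡ pow y i
    go [] [] = 0 , refl
    go (x ∷ w) (Sx ∷ Sw) with S⇒ Sx | go w Sw
    ... | s , _ , e | i , e′ = s + i , trans (cong₂ _∙_ e e′) (sym (pow-+ y s i))

  Split-generates : ∀ {a y} {L : List (ℕ × ℕ)} → a ∙ y ≡ y ∙ a →
    (∀ {g} → S g → ∃[ s ] (s ∈ L × g ≡ pow a (proj₁ s) ∙ pow y (proj₂ s))) → ∀ g → ∃[ e ] ∃[ i ] g ≡ pow
      a e ∙ pow y i
  Split-generates {a} {y} ay S⇒ g with geodesic g
  ... | w , Sw , refl , _ = go w Sw
    where
    pow-comm : ∀ i j → pow a i ∙ pow y j ≡ pow y j ∙ pow a i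
    pow-comm i j = comm-ev {w = replicate j y} (Allₚ.replicate⁺ j (sym (comm-pow i (sym ay))))
    go : ∀ w → All S w → ∃[ e ] ∃[ i ] ev w ≡ pow a e ∙ pow y i
    go [] [] = 0 , 0 , sym (identityˡ ε)
    go (x ∷ w) (Sx ∷ Sw) with S⇒ Sx | go w Sw
    ... | (s₁ , s₂) , _ , p | e , i , p′ = s₁ + e , s₂ + i , (begin
      x ∙ ev w                                        ≡⟨ cong₂ _∙_ p p′ ⟩
      (pow a s₁ ∙ pow y s₂) ∙ pow a e ∙ pow y i       ≡⟨ assoc (pow a s₁) _ _ ⟩
      pow a s₁ ∙ pow y s₂ ∙ pow a e ∙ pow y i         ≡⟨ cong (pow a s₁ ∙_)
        (swap _ (sym (pow-comm e s₂))) ⟩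
      pow a s₁ ∙ pow a e ∙ pow y s₂ ∙ pow y i         ≡⟨ assoc (pow a s₁) _ _ ⟨
      (pow a s₁ ∙ pow a e) ∙ pow y s₂ ∙ pow y i       ≡⟨ cong₂ _∙_ (sym (pow-+ a s₁ e))
        (sym (pow-+ y s₂ i)) ⟩
      pow a (s₁ + e) ∙ pow y (s₂ + i)                 ∎)
      where open ≡-Reasoning

  -- Completing `xy` puts the two letters on a common circuit, and no circuit is bad.
  S′-class : ∀ {x y} → S′ x → S′ y → x ~ y
  S′-class {x} {y} Sx Sy with x ~? y
  ... | yes q = q
  ... | no n with complete (ev (x ∷ y ∷ []))
  ...   | z , k , t , Z , St , e , _ = ⊥-elim (no-bad T Z (Sx ∷ Sy ∷ St)
            (trans (cong (z ∙_) (ev-++ (x ∷ y ∷ []) t)) e)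
              (inj₁ (x , y , here refl , there (here refl) , n)))

  S-cases : ∀ {g} → S g → g ∙ g ≡ ε ⊎ S′ g
  S-cases {g} Sg with (g ∙ g) ≟ ε
  ... | yes e = inj₁ e
  ... | no n = inj₂ (Sg , n)

  -- Otherwise `a x^i` would be a circuit with one involution, although `x² ≠ a`.
  disjoint′ : ∀ {a x} → S a → a ∙ a ≡ ε → S′ x → x ∙ x ≢ a → ∀ i → a ≢ pow x i
  disjoint′ Sa aa Sx n zero e = ε∉S (subst S e Sa)
  disjoint′ {a} {x} Sa aa Sx n (suc i) e = no-bad T (inv Sa aa) (Allₚ.replicate⁺ (suc i) Sx)
    (trans (cong (a ∙_) (sym e)) aa) (inj₂ ((λ { refl → ε∉S Sa }) , x , here refl , n))

  -- A shortest circuit through `x` cannot contain the involution, and `x` is the only other letter,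
  -- so the circuit is a power of `x`.
  pure-order : ∀ {x} → S′ x → (∀ {d} → S′ d → d ≡ x) → (∀ {a} → S a → a ∙ a ≡ ε → x ∙ x ≢ a) → pow x
    (m x) ≡ ε
  pure-order {x} Sx only n with m-complete x
  ... | a , _ , t , inv Sa aa , St , e , l = ⊥-elim
    (no-bad T (inv Sa aa) (Sx ∷ St) e (inj₂ ((λ { refl → ε∉S Sa }) , x , here refl , n Sa aa)))
  ... | _ , _ , t , one , St , e , l with pure? x t
  ...   | inj₁ pure = trans (cong (pow x) (sym l))
    (trans (cong (λ h → x ∙ ev h) (sym pure)) (trans (sym (identityˡ _)) e))
  ...   | inj₂ (d , d∈ , d≢x) = ⊥-elim (d≢x (only (All.lookup St d∈)))

  order-minimal : ∀ {x} → S x → ∀ i → 0 < i → i < m x → pow x i ≢ ε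
  order-minimal Sx (suc i) _ lt o = <-irrefl refl (≤-trans lt (order-≥ {q = i} Sx o))

  one-letter : ∀ {x} → S′ x → (∀ {d} → S′ d → d ≡ x) → Classes
  one-letter {x} Sx only with search (λ a → S? a ×-dec ((a ∙ a) ≟ ε))
  ... | no none = inj₁ (m x , S⇒m≥2 (proj₁ Sx) , record
    { y = x
    ; order = pure-order Sx only (λ Sa aa _ → none (_ , Sa , aa))
    ; minimal = order-minimal (proj₁ Sx)
    ; generates = Cyclic-generates S⇒
    ; S⇒ = S⇒
    ; ⇒S = λ { (here refl) → subst S (pow-1 x) (proj₁ Sx) } })
    where
    S⇒ : ∀ {g} → S g → ∃[ s ] (s ∈ 1 ∷ [] × g ≡ pow x s)
    S⇒ Sg with S-cases Sg
    ... | inj₁ gg = ⊥-elim (none (_ , Sg , gg))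
    ... | inj₂ Sg′ = 1 , here refl , trans (only Sg′) (pow-1 x)
  ... | yes (a , Sa , aa) with (x ∙ x) ≟ a
  -- Here `x` has order 4 and `S` consists of `x` and `x²`: the member `n = 2` of the second family.
  ...   | yes xx = inj₂ (inj₁ (2 , s≤s (s≤s z≤n) , record
    { y = x
    ; order = trans (pow-+ x 2 2) (trans (cong₂ _∙_ xx′ xx′) aa)
    ; minimal = min
    ; generates = Cyclic-generates S⇒
    ; S⇒ = S⇒
    ; ⇒S = λ { (here refl) → subst S (pow-1 x) (proj₁ Sx) ; (there (here refl)) → subst S (sym xx′) Sa }
      }))
    where
    xx′ : pow x 2 ≡ a
    xx′ = trans (cong (x ∙_) (identityʳ x)) xx
    min : ∀ i → 0 < i → i < 4 → pow x i ≢ ε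
    min 1 _ _ e = S′≢ε Sx (trans (pow-1 x) e)
    min 2 _ _ e = proj₂ Sx (trans (cong (x ∙_) (pow-1 x)) e)
    min 3 _ _ e = S′≢inv Sx aa (mutually-inverse⇒≡ (proj₁ Sx) Sa (trans (cong (x ∙_) (sym xx′)) e))
    min (suc (suc (suc (suc _)))) _ (s≤s (s≤s (s≤s (s≤s ())))) _
    S⇒ : ∀ {g} → S g → ∃[ s ] (s ∈ 1 ∷ 2 ∷ [] × g ≡ pow x s)
    S⇒ Sg with S-cases Sg
    ... | inj₁ gg = 2 , there (here refl) , trans (involution-unique Sg Sa gg aa) (sym xx′)
    ... | inj₂ Sg′ = 1 , here refl , trans (only Sg′) (pow-1 x)
  ...   | no xx≢a = inj₂ (inj₂ (inj₁ (m x , S′⇒m≥3 Sx , record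
    { a = a ; y = x ; aa = aa ; ay = central Sa aa x
    ; order = pure-order Sx only (λ Sb bb xx → xx≢a (trans xx (involution-unique Sb Sa bb aa)))
    ; minimal = order-minimal (proj₁ Sx)
    ; disjoint = disjoint′ Sa aa Sx xx≢a
    ; generates = Split-generates (central Sa aa x) S⇒
    ; S⇒ = S⇒
    ; ⇒S = λ { (here refl) → subst S a≡ Sa ; (there (here refl)) → subst S x≡ (proj₁ Sx) } })))
    where
    a≡ : a ≡ pow a 1 ∙ pow x 0
    a≡ = trans (pow-1 a) (sym (identityʳ _))
    x≡ : x ≡ pow a 0 ∙ pow x 1
    x≡ = trans (pow-1 x) (sym (identityˡ _))
    S⇒ : ∀ {g} → S g → ∃[ s ] (s ∈ (1 , 0) ∷ (0 , 1) ∷ [] × g ≡ pow a (proj₁ s) ∙ pow x (proj₂ s))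
    S⇒ Sg with S-cases Sg
    ... | inj₁ gg = _ , here refl , trans (involution-unique Sg Sa gg aa) a≡
    ... | inj₂ Sg′ = _ , there (here refl) , trans (only Sg′) x≡

  half : ∀ i → ∃[ j ] (i ≡ j + j ⊎ i ≡ suc (j + j))
  half zero = 0 , inj₁ refl
  half (suc i) with half i
  ... | j , inj₁ refl = j , inj₂ refl
  ... | j , inj₂ refl = suc j , inj₁ (cong suc (sym (ℕₚ.+-suc j j)))

  two-letters-class : ∀ {y w} → S′ y → S′ w → y ≢ w → QP y w → Classes
  two-letters-class {y} {w} Sy Sw y≢w (yy , ow , my) = go (search (λ a → S? a ×-dec ((a ∙ a) ≟ ε)))
    where
    w≡ : w ≡ pow y 2
    w≡ = trans (sym yy) (cong (y ∙_) (pow-1 y))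
    pow-double : ∀ j → pow y (j + j) ≡ pow w j
    pow-double j = trans (pow-+ y j j) (trans (sym (pow-∙ j refl)) (cong (λ h → pow h j) yy))
    ord : pow y (2 * m w) ≡ ε
    ord = trans (cong (λ h → pow y (m w + h)) (ℕₚ.+-identityʳ (m w))) (trans (pow-double (m w)) ow)
    halve : ∀ j → j + j < 2 * m w → j < m w
    halve j lt with suc j ℕₚ.≤? m w
    ... | yes p = p
    ... | no np = ⊥-elim (<-irrefl refl
      (≤-trans lt (≤-trans (≤-reflexive (cong (m w +_) (ℕₚ.+-identityʳ (m w))))
        (ℕₚ.+-mono-≤ (ℕₚ.≮⇒≥ np) (ℕₚ.≮⇒≥ np)))))
    min : ∀ i → 0 < i → i < 2 * m w → pow y i ≢ ε
    min i 0<i lt o with half i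
    ... | zero , inj₁ refl = <-irrefl refl 0<i
    ... | suc j , inj₁ refl = order-minimal (proj₁ Sw) (suc j) (s≤s z≤n) (halve (suc j) lt)
      (trans (sym (pow-double (suc j))) o)
    -- An odd exponent `2j + 1` amounts to the circuit `y w^j`, so `m w + 1 = m y ≤ j + 1`, against
    -- `j < m w`.
    ... | j , inj₂ refl = <-irrefl refl
      (≤-trans (halve j (≤-trans (ℕₚ.n≤1+n _) lt))
        (ℕₚ.≤-pred (subst₂ _≤_ my (cong suc (length-replicate j))
          (m≤ (Allₚ.replicate⁺ j (proj₁ Sw)) (trans (cong (y ∙_) (sym (pow-double j))) o)))))
    S′-cases : ∀ {g} → S′ g → g ≡ y ⊎ g ≡ w
    S′-cases {g} Sg with g ≟ y
    ... | yes e = inj₁ e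
    ... | no n = inj₂ (partner-unique Sy Sg Sw (S′-class Sg Sy) n (S′-class Sw Sy) (λ e → y≢w (sym e)))
    go : Dec (∃[ a ] (S a × a ∙ a ≡ ε)) → Classes
    go (no none) = inj₂ (inj₁ (m w , S⇒m≥2 (proj₁ Sw) , record
      { y = y ; order = ord ; minimal = min
      ; generates = Cyclic-generates S⇒
      ; S⇒ = S⇒
      ; ⇒S = λ { (here refl) → subst S (pow-1 y) (proj₁ Sy) ; (there (here refl)) → subst S w≡
        (proj₁ Sw) } }))
      where
      S⇒ : ∀ {g} → S g → ∃[ s ] (s ∈ 1 ∷ 2 ∷ [] × g ≡ pow y s)
      S⇒ Sg with S-cases Sg
      ... | inj₁ gg = ⊥-elim (none (_ , Sg , gg))
      ... | inj₂ Sg′ with S′-cases Sg′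
      ...   | inj₁ e = 1 , here refl , trans e (pow-1 y)
      ...   | inj₂ e = 2 , there (here refl) , trans e w≡
    go (yes (a , Sa , aa)) = inj₂ (inj₂ (inj₂ (m w , S′⇒m≥3 Sw , record
      { a = a ; y = y ; aa = aa ; ay = central Sa aa y
      ; order = ord ; minimal = min
      ; disjoint = disjoint′ Sa aa Sy (λ e → S′≢inv Sw aa (trans (sym yy) e))
      ; generates = Split-generates (central Sa aa y) S⇒
      ; S⇒ = S⇒
      ; ⇒S = λ { (here refl) → subst S a≡ Sa ; (there (here refl)) → subst S
        (trans (pow-1 y) (sym (identityˡ _))) (proj₁ Sy)
               ; (there (there (here refl))) → subst S (trans w≡ (sym (identityˡ _))) (proj₁ Sw) } })))
      where
      a≡ : a ≡ pow a 1 ∙ pow y 0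
      a≡ = trans (pow-1 a) (sym (identityʳ _))
      S⇒ : ∀ {g} → S g → ∃[ s ] (s ∈ (1 , 0) ∷ (0 , 1) ∷ (0 , 2) ∷ [] × g ≡ pow a (proj₁ s) ∙ pow y
        (proj₂ s))
      S⇒ Sg with S-cases Sg
      ... | inj₁ gg = _ , here refl , trans (involution-unique Sg Sa gg aa) a≡
      ... | inj₂ Sg′ with S′-cases Sg′
      ...   | inj₁ e = _ , there (here refl) , trans e (trans (pow-1 y) (sym (identityˡ _)))
      ...   | inj₂ e = _ , there (there (here refl)) , trans e (trans w≡ (sym (identityˡ _)))

  S′? : ∀ x → Dec (S′ x)
  S′? x = S? x ×-dec ¬? ((x ∙ x) ≟ ε)

  involutions-only : ∀ {g} → g ≢ ε → (∀ {x} → ¬ S′ x) → Classes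
  involutions-only {g} g≢ε none with geodesic g
  ... | [] , _ , e , _ = ⊥-elim (g≢ε (sym e))
  -- The involutory letter is unique, so the group is ℤ₂: the directed cycle with `n = 2`.
  ... | a ∷ _ , Sa ∷ _ , _ , _ = inj₁ (2 , s≤s (s≤s z≤n) , record
    { y = a ; order = trans (cong (a ∙_) (identityʳ a)) (inv-of Sa) ; minimal = min
    ; generates = Cyclic-generates S⇒ ; S⇒ = S⇒
    ; ⇒S = λ { (here refl) → subst S (pow-1 a) Sa } })
    where
    inv-of : ∀ {x} → S x → x ∙ x ≡ ε
    inv-of Sx with S-cases Sx
    ... | inj₁ xx = xx
    ... | inj₂ Sx′ = ⊥-elim (none Sx′)
    min : ∀ i → 0 < i → i < 2 → pow a i ≢ ε
    min 1 _ _ e = ε∉S (subst S (trans (pow-1 a) e) Sa)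
    min (suc (suc _)) _ (s≤s (s≤s ())) _
    S⇒ : ∀ {g} → S g → ∃[ s ] (s ∈ 1 ∷ [] × g ≡ pow a s)
    S⇒ Sg = 1 , here refl , trans (involution-unique Sg Sa (inv-of Sg) (inv-of Sa)) (pow-1 a)

  classify : ∀ {g} → g ≢ ε → Classes
  classify g≢ε with search S′?
  ... | no none = involutions-only g≢ε (λ Sx → none (_ , Sx))
  ... | yes (x , Sx) with search (λ d → S′? d ×-dec ¬? (d ≟ x))
  ...   | no none = one-letter Sx only
    where
    only : ∀ {d} → S′ d → d ≡ x
    only {d} Sd with d ≟ x
    ... | yes e = e
    ... | no n = ⊥-elim (none (d , Sd , n))
  ...   | yes (d , Sd , d≢x) with S′-class Sd Sx
  ...     | inj₁ e = ⊥-elim (d≢x e)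
  ...     | inj₂ (inj₁ q) = two-letters-class Sd Sx d≢x q
  ...     | inj₂ (inj₂ q) = two-letters-class Sx Sd (λ e → d≢x (sym e)) q

-- Walks, distances and isomorphisms

true⇒T : ∀ {b} → b ≡ true → T b
true⇒T = Equivalence.from T-≡

T⇒true : ∀ {b} → T b → b ≡ true
T⇒true = Equivalence.to T-≡

bool-ext : ∀ {b c} → (b ≡ true → c ≡ true) → (c ≡ true → b ≡ true) → b ≡ c
bool-ext {false} {false} _ _ = refl
bool-ext {false} {true} _ g with g refl
... | ()
bool-ext {true} f _ = sym (f refl)

CayZ-adj⁻ : ∀ {n L} {x y : Fin (suc n)} → adj (CayZ (suc n) L) x y ≡ true → ∃[ s ]
  (s ∈ L × toℕ y ≡ (toℕ x + s) % suc n)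
CayZ-adj⁻ e with find (any⁻ _ _ (true⇒T e))
... | s , s∈ , p = s , s∈ , toWitness p

CayZ-adj⁺ : ∀ {n L} {x y : Fin (suc n)} {s} → s ∈ L → toℕ y ≡ (toℕ x + s) % suc n → adj (CayZ (suc n) L)
  x y ≡ true
CayZ-adj⁺ s∈ e = T⇒true (any⁺ _ (lose s∈ (fromWitness e)))

dec-∧⁻ : ∀ {P Q : Set} (p? : Dec P) (q? : Dec Q) → T (⌊ p? ⌋ ∧ ⌊ q? ⌋) → P × Q
dec-∧⁻ (yes p) (yes q) _ = p , q

dec-∧⁺ : ∀ {P Q : Set} (p? : Dec P) (q? : Dec Q) → P → Q → T (⌊ p? ⌋ ∧ ⌊ q? ⌋)
dec-∧⁺ (yes _) (yes _) _ _ = _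
dec-∧⁺ (yes _) (no n) _ q = ⊥-elim (n q)
dec-∧⁺ (no n) _ p _ = ⊥-elim (n p)

CayZ2Zn-adj⁻ : ∀ {n L} {x y : Fin (2 * suc n)} → adj (CayZ2Zn (suc n) L) x y ≡ true →
  ∃[ s ] (s ∈ L × toℕ y / suc n ≡ (toℕ x / suc n + proj₁ s) % 2 × toℕ y % suc n ≡
    (toℕ x % suc n + proj₂ s) % suc n)
CayZ2Zn-adj⁻ e with find (any⁻ _ _ (true⇒T e))
... | s , s∈ , p = s , s∈ , dec-∧⁻ (_ ℕₚ.≟ _) (_ ℕₚ.≟ _) p

CayZ2Zn-adj⁺ : ∀ {n L} {x y : Fin (2 * suc n)} {s} → s ∈ L → toℕ y / suc n ≡ (toℕ x / suc n + proj₁ s) %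
  2 →
  toℕ y % suc n ≡ (toℕ x % suc n + proj₂ s) % suc n → adj (CayZ2Zn (suc n) L) x y ≡ true
CayZ2Zn-adj⁺ s∈ e₁ e₂ = T⇒true (any⁺ _ (lose s∈ (dec-∧⁺ (_ ℕₚ.≟ _) (_ ℕₚ.≟ _) e₁ e₂)))

least : ∀ {P : ℕ → Set} → (∀ n → Dec (P n)) → ∀ k → P k → ∃[ d ] (P d × (∀ j → P j → d ≤ j))
least P? zero p = 0 , p , λ _ _ → z≤n
least {P} P? (suc k) p with P? 0
... | yes p₀ = 0 , p₀ , λ _ _ → z≤n
... | no ¬p₀ with least (λ n → P? (suc n)) k p
...   | d , q , min = suc d , q , λ { zero r → ⊥-elim (¬p₀ r) ; (suc j) r → s≤s (min j r) }

module Distance (Γ : Digraph) where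
  V : Set
  V = Fin (N Γ)

  walk? : ∀ k (x y : V) → Dec (Walk Γ x y k)
  walk? zero x y with x ≟ᶠ y
  ... | yes refl = yes nil
  ... | no n = no λ { nil → n refl }
  walk? (suc k) x y = map′ (λ (z , e , w) → cons e w) (λ { (cons e w) → _ , e , w })
    (any? (λ z → (adj Γ x z ≟ᵇ true) ×-dec walk? k z y))

  dist : StronglyConnected Γ → ∀ x y → ∃[ d ] IsDist Γ x y d
  dist sc x y with sc x y
  ... | k , w = least (λ n → walk? n x y) k w

  IsDist-unique : ∀ {x y d e} → IsDist Γ x y d → IsDist Γ x y e → d ≡ e
  IsDist-unique (w , min) (w′ , min′) = ℕₚ.≤-antisym (min _ w′) (min′ _ w)

module _ {Γ Δ : Digraph} (ι : Iso Γ Δ) where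
  private
    f = Bijection.to (proj₁ ι)

  iso-inj : ∀ {x y} → f x ≡ f y → x ≡ y
  iso-inj = Bijection.injective (proj₁ ι)

  walk-map : ∀ {x y k} → Walk Γ x y k → Walk Δ (f x) (f y) k
  walk-map nil = nil
  walk-map (cons e w) = cons (trans (sym (proj₂ ι _ _)) e) (walk-map w)

  walk-unmap : ∀ {k} x y → Walk Δ (f x) (f y) k → Walk Γ x y k
  walk-unmap x y w = go refl refl w
    where
    -- The endpoints are freed from the form `f x`, `f y`, so that the walk can be matched on.
    go : ∀ {x p q k} → p ≡ f x → q ≡ f y → Walk Δ p q k → Walk Γ x y k
    go p≡ q≡ nil with iso-inj (trans (sym p≡) q≡)
    ... | refl = nil
    go {x} refl q≡ (cons {y = p′} e w) with Bijection.strictlySurjective (proj₁ ι) p′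
    ... | z , refl = cons (trans (proj₂ ι x z) e) (go refl q≡ w)

  IsDist-map : ∀ {x y d} → IsDist Γ x y d → IsDist Δ (f x) (f y) d
  IsDist-map (w , min) = walk-map w , λ k w′ → min k (walk-unmap _ _ w′)

-- The bijection is supplied from residues to vertices, where it is a formula in powers of
-- generators; the isomorphism is its inverse.
mkIso : ∀ {Γ Δ} (h : Fin (N Δ) → Fin (N Γ)) → (∀ {i j} → h i ≡ h j → i ≡ j) → (∀ v → ∃[ i ] h i ≡ v) →
  (∀ i j → adj Δ i j ≡ adj Γ (h i) (h j)) → Iso Γ Δ
mkIso {Γ} h inj surj ad = record
  { to = to
  ; cong = λ { refl → refl }
  ; bijective = (λ e → trans (sym (proj₂ (surj _))) (trans (cong h e) (proj₂ (surj _)))) ,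
                λ i → h i , λ { refl → inj (proj₂ (surj (h i))) } } ,
  λ x y → sym (trans (ad (to x) (to y)) (cong₂ (adj Γ) (proj₂ (surj x)) (proj₂ (surj y))))
  where
  to = λ v → proj₁ (surj v)

-- The regular group of automorphisms

singleton-unique : ∀ {n} {W : Subset n} {x y} → ∣ W ∣ ≡ 1 → x ∈ˢ W → y ∈ˢ W → x ≡ y
singleton-unique {W = W} {x} {y} e x∈ y∈ with x ≟ᶠ y
... | yes eq = eq
... | no n = ⊥-elim (ℕₚ.n≮0 (≤-trans (x∈p⇒∣p-x∣<∣p∣ (x∈p∧x≢y⇒x∈p-y y∈ (λ eq → n (sym eq))))
  (ℕₚ.≤-pred (subst (∣ W - x ∣ <_) e (x∈p⇒∣p-x∣<∣p∣ x∈)))))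

CayleyFamilies : Digraph → Set
CayleyFamilies Γ = (∃[ n ] (2 ≤ n × Iso Γ (CayZ n (1 ∷ []))))
  ⊎ (∃[ n ] (2 ≤ n × Iso Γ (CayZ (2 * n) (1 ∷ 2 ∷ []))))
  ⊎ (∃[ n ] (3 ≤ n × Iso Γ (CayZ2Zn n ((1 , 0) ∷ (0 , 1) ∷ []))))
  ⊎ (∃[ n ] (3 ≤ n × Iso Γ (CayZ2Zn (2 * n) ((1 , 0) ∷ (0 , 1) ∷ (0 , 2) ∷ []))))

module RegularGroup (Γ : Digraph) (loopless : Loopless Γ) (sc : StronglyConnected Γ)
  (vt : VertexTransitive Γ)
  (o : Fin (N Γ))
  (resolves : ∀ {u v d e} → IsDist Γ o u d → IsDist Γ o v d → IsDist Γ u o e → IsDist Γ v o e → u ≡ v)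
    where
  open Distance Γ

  ∂ : V → V → ℕ
  ∂ x y = proj₁ (dist sc x y)

  ∂-dist : ∀ x y → IsDist Γ x y (∂ x y)
  ∂-dist x y = proj₂ (dist sc x y)

  -- The resolving property speaks of distances only, so products of automorphisms can be compared
  -- as isometries.
  Isometry : (V → V) → Set
  Isometry f = ∀ x y → ∂ (f x) (f y) ≡ ∂ x y

  -- The chosen automorphism taking `o` to `x`, read as left translation by `x`; `F` is the group
  -- multiplication on the vertices.
  F : V → V → V
  F x = Bijection.to (proj₁ (proj₁ (vt o x)))

  aut-isometry : (φ : Automorphism Γ) → Isometry (Bijection.to (proj₁ φ))
  aut-isometry φ x y = IsDist-unique (∂-dist _ _) (IsDist-map {Γ} {Γ} φ (∂-dist x y))

  F-isometry : ∀ x → Isometry (F x)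
  F-isometry x = aut-isometry (proj₁ (vt o x))

  F-base : ∀ x → F x o ≡ x
  F-base x = proj₂ (vt o x)

  resolves-at : ∀ c {u v} → ∂ c u ≡ ∂ c v → ∂ u c ≡ ∂ v c → u ≡ v
  resolves-at c {u} {v} e₁ e₂ with vt c o
  ... | φ , refl = iso-inj {Γ} {Γ} φ (resolves
    (IsDist-map {Γ} {Γ} φ (∂-dist c u))
      (subst (IsDist Γ _ _) (sym e₁) (IsDist-map {Γ} {Γ} φ (∂-dist c v)))
    (IsDist-map {Γ} {Γ} φ (∂-dist u c))
      (subst (IsDist Γ _ _) (sym e₂) (IsDist-map {Γ} {Γ} φ (∂-dist v c))))

  -- `f u` and `g u` have the same two distances to the common image of `o`, and every vertex
  -- resolves.
  isometry-unique : ∀ {f g} → Isometry f → Isometry g → f o ≡ g o → ∀ u → f u ≡ g u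
  isometry-unique {f} {g} If Ig e u = resolves-at (f o)
    (trans (If o u) (trans (sym (Ig o u)) (cong (λ h → ∂ h (g u)) (sym e))))
    (trans (If u o) (trans (sym (Ig u o)) (cong (∂ (g u)) (sym e))))

  F-assoc : ∀ x y z → F (F x y) z ≡ F x (F y z)
  F-assoc x y = isometry-unique (F-isometry (F x y))
    (λ u v → trans (F-isometry x _ _) (F-isometry y u v))
      (trans (F-base (F x y)) (cong (F x) (sym (F-base y))))

  F-idˡ : ∀ y → F o y ≡ y
  F-idˡ = isometry-unique (F-isometry o) (λ _ _ → refl) (F-base o)

  F⁻¹ : V → V
  F⁻¹ x = proj₁ (Bijection.strictlySurjective (proj₁ (proj₁ (vt o x))) o)

  F-invʳ : ∀ x → F x (F⁻¹ x) ≡ o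
  F-invʳ x = proj₂ (Bijection.strictlySurjective (proj₁ (proj₁ (vt o x))) o)

  F-invˡ : ∀ x → F (F⁻¹ x) x ≡ o
  F-invˡ x = begin
    F y x              ≡⟨ cong (F y) (F-base x) ⟨
    F y (F x o)        ≡⟨ cong (λ h → F y (F x h)) (F-invʳ y) ⟨
    F y (F x (F y z))  ≡⟨ cong (F y) (F-assoc x y z) ⟨
    F y (F (F x y) z)  ≡⟨ cong (λ h → F y (F h z)) (F-invʳ x) ⟩
    F y (F o z)        ≡⟨ cong (F y) (F-idˡ z) ⟩
    F y z              ≡⟨ F-invʳ y ⟩
    o                  ∎
    where
    open ≡-Reasoning
    y = F⁻¹ x
    z = F⁻¹ y

  S : V → Set
  S g = adj Γ o g ≡ true

  F-adj : ∀ x g → adj Γ x (F x g) ≡ adj Γ o g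
  F-adj x g = trans (cong (λ h → adj Γ h (F x g)) (sym (F-base x))) (sym (proj₂ (proj₁ (vt o x)) o g))

  ev : List V → V
  ev = foldr F o

  walk⇒word : ∀ {x y k} → Walk Γ x y k → ∃[ w ] (All S w × F x (ev w) ≡ y × length w ≡ k)
  walk⇒word {x} nil = [] , [] , F-base x , refl
  walk⇒word {x} (cons {y = z} e w) with walk⇒word w
  ... | l , Sl , eq , len = s ∷ l , trans (sym (F-adj x s)) (trans (cong (adj Γ x) xs) e) ∷ Sl ,
        trans (sym (F-assoc x s (ev l))) (trans (cong (λ h → F h (ev l)) xs) eq) , cong suc len
    where
    s = F (F⁻¹ x) z
    xs : F x s ≡ z
    xs = trans (sym (F-assoc x _ z)) (trans (cong (λ h → F h z) (F-invʳ x)) (F-idˡ z))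

  word⇒walk : ∀ x {w} → All S w → Walk Γ x (F x (ev w)) (length w)
  word⇒walk x [] = subst (λ h → Walk Γ x h 0) (sym (F-base x)) nil
  word⇒walk x {s ∷ w} (Ss ∷ Sw) = cons (trans (F-adj x s) Ss)
    (subst (λ h → Walk Γ (F x s) h (length w)) (F-assoc x s (ev w)) (word⇒walk (F x s) Sw))

  -- Left translation by `g` takes the pair `o`, `F⁻¹ g` to `g`, `o`. Thus thinness is the resolving
  -- property of `o`.
  ∂-inv : ∀ g → ∂ o (F⁻¹ g) ≡ ∂ g o
  ∂-inv g = trans (sym (F-isometry g o (F⁻¹ g))) (cong₂ ∂ (F-base g) (F-invʳ g))

  thinGroup : ThinGroup
  thinGroup = record
    { G = V ; _∙_ = F ; ε = o ; _⁻¹ = F⁻¹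
    ; isGroup = record
      { isMonoid = record
        { isSemigroup = record
          { isMagma = record { isEquivalence = isEquivalence ; ∙-cong = cong₂ F }
          ; assoc = F-assoc }
        ; identity = F-idˡ , F-base }
      ; inverse = F-invˡ , F-invʳ
      ; ⁻¹-cong = cong F⁻¹ }
    ; _≟_ = _≟ᶠ_
    ; S = S ; S? = λ g → adj Γ o g ≟ᵇ true
    ; ε∉S = λ e → false≢true (trans (sym (loopless o)) e)
    ; ℓ = ∂ o
    ; geodesic = λ g →
      let w , Sw , e , l = walk⇒word (proj₁ (∂-dist o g)) in
      w , Sw , trans (sym (F-idˡ (ev w))) e , l
    ; ℓ-ev≤ = λ {w} Sw → proj₂ (∂-dist o (ev w)) _
      (subst (λ h → Walk Γ o h (length w)) (F-idˡ (ev w)) (word⇒walk o Sw))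
    ; thin = λ {g} {h} e₁ e₂ → resolves-at o e₁ (trans (sym (∂-inv g)) (trans e₂ (∂-inv h))) }
    where
    false≢true : false ≢ true
    false≢true ()

  open Classification thinGroup any? hiding (S; ev)

  quotient : ∀ x y → ∃[ g ] F x g ≡ y
  quotient x y = F (F⁻¹ x) y , trans (sym (F-assoc x _ y))
    (trans (cong (λ h → F h y) (F-invʳ x)) (F-idˡ y))

  pow-* : ∀ {x n} k → pow x n ≡ o → pow x (k * n) ≡ o
  pow-* zero e = refl
  pow-* {x} {n} (suc k) e = trans (pow-+ x n (k * n)) (trans (cong₂ F e (pow-* {x} {n} k e)) (F-idˡ o))

  pow-% : ∀ {x n} i → pow x (suc n) ≡ o → pow x i ≡ pow x (i % suc n)
  pow-% {x} {n} i e = begin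
    pow x i                                             ≡⟨ cong (pow x) (m≡m%n+[m/n]*n i (suc n)) ⟩
    pow x (i % suc n + i / suc n * suc n)               ≡⟨ pow-+ x (i % suc n) _ ⟩
    F (pow x (i % suc n)) (pow x (i / suc n * suc n))   ≡⟨ cong (F _) (pow-* {x} {suc n} (i / suc n) e)
      ⟩
    F (pow x (i % suc n)) o                             ≡⟨ F-base _ ⟩
    pow x (i % suc n)                                   ∎
    where open ≡-Reasoning

  pow-inj : ∀ {x n} → (∀ i → 0 < i → i < n → pow x i ≢ o) → ∀ {i j} → i < n → j < n → pow x i ≡ pow x j
    → i ≡ j
  pow-inj {x} {n} min {i} {j} i< j< e = compare (ℕₚ.<-cmp i j)
    where
    distinct : ∀ {i j} → i < j → j < n → pow x i ≢ pow x j
    distinct {i} {j} lt j< e = min (j ∸ i) (ℕₚ.m<n⇒0<n∸m lt) (≤-trans (s≤s (ℕₚ.m∸n≤m j i)) j<)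
      (fixʳ (trans (sym (pow-+ x i (j ∸ i))) (trans (cong (pow x) (ℕₚ.m+[n∸m]≡n (ℕₚ.<⇒≤ lt))) (sym e))))
    compare : Tri (i < j) (i ≡ j) (j < i) → i ≡ j
    compare (tri≈ _ eq _) = eq
    compare (tri< lt _ _) = ⊥-elim (distinct lt j< e)
    compare (tri> _ _ lt) = ⊥-elim (distinct lt i< (sym e))

  Cyclic⇒Iso : ∀ {n L} → Cyclic (suc n) L → Iso Γ (CayZ (suc n) L)
  Cyclic⇒Iso {n} {L} C = mkIso h (λ e → toℕ-injective (pow-inj minimal (toℕ<n _) (toℕ<n _) e)) surj
    (λ i j → bool-ext (fwd i j) (bwd i j))
    where
    open Cyclic C
    h : Fin (suc n) → V
    h i = pow y (toℕ i)
    surj : ∀ v → ∃[ i ] h i ≡ v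
    surj v with generates v
    ... | i , refl = fromℕ< (m%n<n i (suc n)) , trans (cong (pow y) (toℕ-fromℕ< (m%n<n i (suc n))))
      (sym (pow-% i order))
    fwd : ∀ i j → adj (CayZ (suc n) L) i j ≡ true → adj Γ (h i) (h j) ≡ true
    fwd i j e with CayZ-adj⁻ {n} {L} {i} {j} e
    ... | s , s∈ , eq = trans (cong (adj Γ (h i))
      (trans (cong (pow y) eq) (trans (sym (pow-% (toℕ i + s) order)) (pow-+ y (toℕ i) s))))
                          (trans (F-adj (h i) (pow y s)) (⇒S s∈))
    bwd : ∀ i j → adj Γ (h i) (h j) ≡ true → adj (CayZ (suc n) L) i j ≡ true
    bwd i j e with quotient (h i) (h j)
    ... | g , eq with S⇒ {g} (trans (sym (F-adj (h i) g)) (trans (cong (adj Γ (h i)) eq) e))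
    ...   | s , s∈ , refl = CayZ-adj⁺ {n} {L} {i} {j} s∈
      (pow-inj minimal (toℕ<n j) (m%n<n (toℕ i + s) (suc n))
            (trans (sym eq) (trans (sym (pow-+ y (toℕ i) s)) (pow-% (toℕ i + s) order))))

  Split⇒Iso : ∀ {n L} → Split (suc n) L → Iso Γ (CayZ2Zn (suc n) L)
  Split⇒Iso {n} {L} C = mkIso h inj surj (λ i j → bool-ext (fwd i j) (bwd i j))
    where
    open Split C
    open ≡-Reasoning
    n′ : ℕ
    n′ = suc n
    P : ℕ → ℕ → V
    P e i = F (pow a e) (pow y i)
    aa′ : pow a 2 ≡ o
    aa′ = trans (cong (F a) (F-base a)) aa
    P-% : ∀ e i → P e i ≡ P (e % 2) (i % n′)
    P-% e i = cong₂ F (pow-% e aa′) (pow-% i order)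
    P-+ : ∀ e i s t → F (P e i) (P s t) ≡ P (e + s) (i + t)
    P-+ e i s t = begin
      F (P e i) (P s t)                                      ≡⟨ F-assoc (pow a e) _ _ ⟩
      F (pow a e) (F (pow y i) (F (pow a s) (pow y t)))      ≡⟨ cong (F (pow a e))
        (swap _ (comm-ev-pow s i)) ⟩
      F (pow a e) (F (pow a s) (F (pow y i) (pow y t)))      ≡⟨ F-assoc (pow a e) _ _ ⟨
      F (F (pow a e) (pow a s)) (F (pow y i) (pow y t))      ≡⟨ cong₂ F (pow-+ a e s) (pow-+ y i t) ⟨
      P (e + s) (i + t)                                      ∎
      where
      comm-ev-pow : ∀ s i → F (pow y i) (pow a s) ≡ F (pow a s) (pow y i)
      comm-ev-pow s i = comm-pow s (sym (comm-pow i ay))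
    P-inj : ∀ {e e′ i i′} → e < 2 → e′ < 2 → i < n′ → i′ < n′ → P e i ≡ P e′ i′ → e ≡ e′ × i ≡ i′
    P-inj {0} {0} _ _ p q eq = refl , pow-inj minimal p q (trans (sym (F-idˡ _)) (trans eq (F-idˡ _)))
    P-inj {1} {1} _ _ p q eq = refl , pow-inj minimal p q (cancelˡ eq)
    P-inj {1} {0} {i} {i′} _ _ p q eq = ⊥-elim (no-mix i i′ (ℕₚ.<⇒≤ p) eq)
      where
      no-mix : ∀ i i′ → i ≤ n′ → P 1 i ≡ P 0 i′ → ⊥
      no-mix i i′ le eq = disjoint (i′ + (n′ ∸ i)) (begin
        a                                       ≡⟨ F-base a ⟨
        F a o                                   ≡⟨ F-base _ ⟨
        F (pow a 1) o                           ≡⟨ cong (F (pow a 1)) order ⟨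
        F (pow a 1) (pow y n′)                  ≡⟨ cong (λ k → F (pow a 1) (pow y k)) (ℕₚ.m+[n∸m]≡n le)
          ⟨
        F (pow a 1) (pow y (i + (n′ ∸ i)))      ≡⟨ cong (F (pow a 1)) (pow-+ y i _) ⟩
        F (pow a 1) (F (pow y i) (pow y (n′ ∸ i)))  ≡⟨ F-assoc (pow a 1) _ _ ⟨
        F (P 1 i) (pow y (n′ ∸ i))              ≡⟨ cong (λ k → F k (pow y (n′ ∸ i)))
          (trans eq (F-idˡ _)) ⟩
        F (pow y i′) (pow y (n′ ∸ i))           ≡⟨ pow-+ y i′ _ ⟨
        pow y (i′ + (n′ ∸ i))                   ∎)
    P-inj {0} {1} e< e′< p q eq with P-inj {1} {0} e′< e< q p (sym eq)
    ... | () , _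
    P-inj {suc (suc _)} (s≤s (s≤s ())) _ _ _ _
    P-inj {_} {suc (suc _)} _ (s≤s (s≤s ())) _ _ _
    h : Fin (2 * n′) → V
    h v = P (toℕ v / n′) (toℕ v % n′)
    q<2 : ∀ (v : Fin (2 * n′)) → toℕ v / n′ < 2
    q<2 v = m<n*o⇒m/o<n {toℕ v} {2} {n′} (toℕ<n v)
    r<n : ∀ (v : Fin (2 * n′)) → toℕ v % n′ < n′
    r<n v = m%n<n (toℕ v) n′
    inj : ∀ {v w} → h v ≡ h w → v ≡ w
    inj {v} {w} e with P-inj (q<2 v) (q<2 w) (r<n v) (r<n w) e
    ... | e₁ , e₂ = toℕ-injective (trans (m≡m%n+[m/n]*n (toℕ v) n′)
      (trans (cong₂ (λ q r → r + q * n′) e₁ e₂) (sym (m≡m%n+[m/n]*n (toℕ w) n′))))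
    surj : ∀ v → ∃[ i ] h i ≡ v
    surj v with generates v
    ... | e , i , refl = fromℕ< lt , trans
      (cong₂ P (trans (cong (_/ n′) (toℕ-fromℕ< lt)) div) (trans (cong (_% n′) (toℕ-fromℕ< lt)) mod))
        (sym (P-% e i))
      where
      r q : ℕ
      r = i % n′
      q = e % 2
      lt : r + q * n′ < 2 * n′
      lt = ≤-trans (ℕₚ.+-monoˡ-< (q * n′) (m%n<n i n′)) (ℕₚ.*-monoˡ-≤ n′ (m%n<n e 2))
      mod : (r + q * n′) % n′ ≡ r
      mod = trans ([m+kn]%n≡m%n r q n′) (m<n⇒m%n≡m (m%n<n i n′))
      div : (r + q * n′) / n′ ≡ q
      div = trans (+-distrib-/-∣ʳ r (divides-refl q))
        (cong₂ _+_ (m<n⇒m/n≡0 (m%n<n i n′)) (m*n/n≡m q n′))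
    fwd : ∀ i j → adj (CayZ2Zn n′ L) i j ≡ true → adj Γ (h i) (h j) ≡ true
    fwd i j e with CayZ2Zn-adj⁻ {n} {L} {i} {j} e
    ... | (s , t) , s∈ , e₁ , e₂ = trans
          (cong (adj Γ (h i)) (trans (cong₂ P e₁ e₂)
            (trans (sym (P-% (toℕ i / n′ + s) (toℕ i % n′ + t)))
              (sym (P-+ (toℕ i / n′) (toℕ i % n′) s t)))))
          (trans (F-adj (h i) (P s t)) (⇒S s∈))
    bwd : ∀ i j → adj Γ (h i) (h j) ≡ true → adj (CayZ2Zn n′ L) i j ≡ true
    bwd i j e with quotient (h i) (h j)
    ... | g , eq with S⇒ {g} (trans (sym (F-adj (h i) g)) (trans (cong (adj Γ (h i)) eq) e))
    ...   | (s , t) , s∈ , refl with P-inj (q<2 j) (m%n<n (toℕ i / n′ + s) 2) (r<n j)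
      (m%n<n (toℕ i % n′ + t) n′)
                (trans (sym eq) (trans (P-+ (toℕ i / n′) (toℕ i % n′) s t)
                  (P-% (toℕ i / n′ + s) (toℕ i % n′ + t))))
    ...     | e₁ , e₂ = CayZ2Zn-adj⁺ {n} {L} {i} {j} s∈ e₁ e₂

  families : ∀ {g} → g ≢ o → CayleyFamilies Γ
  families g≢o with classify g≢o
  ... | inj₁ (suc n , le , C) = inj₁ (suc n , le , Cyclic⇒Iso C)
  ... | inj₂ (inj₁ (suc n , le , C)) = inj₂ (inj₁ (suc n , le , Cyclic⇒Iso C))
  ... | inj₂ (inj₂ (inj₁ (suc n , le , C))) = inj₂ (inj₂ (inj₁ (suc n , le , Split⇒Iso C)))
  ... | inj₂ (inj₂ (inj₂ (suc n , le , C))) = inj₂ (inj₂ (inj₂ (suc n , le , Split⇒Iso C)))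

two-vertices : ∀ {n} → 2 ≤ n → ∃[ u ] ∃[ v ] (_≢_ {A = Fin n} u v)
two-vertices 2≤n = fromℕ< (≤-trans (s≤s z≤n) 2≤n) , fromℕ< 2≤n ,
  λ e → case trans (sym (toℕ-fromℕ< _)) (trans (cong toℕ e) (toℕ-fromℕ< 2≤n)) of λ ()

module _ (Γ : Digraph) (2≤N : 2 ≤ N Γ) (loopless : Loopless Γ) (sc : StronglyConnected Γ)
  (vt : VertexTransitive Γ) where
  -- The single element `o` of `W` resolves every pair, and one of two distinct vertices differs
  -- from it, which gives the nontrivial group element that the classification asks for.
  dim1⇒families : WeakMetricDim Γ 1 → CayleyFamilies Γ
  dim1⇒families ((W , res , size) , _) with two-vertices 2≤N
  ... | u , v , u≢v with res u v u≢v
  ...   | o , o∈ , _ = choose (u ≟ᶠ o)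
    where
    open Distance Γ
    resolves : ∀ {u v d e} → IsDist Γ o u d → IsDist Γ o v d → IsDist Γ u o e → IsDist Γ v o e → u ≡ v
    resolves {u} {v} a b c d with u ≟ᶠ v
    ... | yes e = e
    ... | no n with res u v n
    ...   | w , w∈ , differ with singleton-unique size w∈ o∈
    ...     | refl with differ
    ...       | inj₁ (_ , _ , p , q , ne) = ⊥-elim (ne (trans (IsDist-unique p a) (IsDist-unique b q)))
    ...       | inj₂ (_ , _ , p , q , ne) = ⊥-elim (ne (trans (IsDist-unique p c) (IsDist-unique d q)))
    open RegularGroup Γ loopless sc vt o resolves using (families)
    choose : Dec (u ≡ o) → CayleyFamilies Γ
    choose (no n) = families n
    choose (yes e) = families {v} (λ e′ → u≢v (trans e (sym e′)))

-- Distances in the Cayley digraphs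

Resolved : (Δ : Digraph) → Fin (N Δ) → Set
Resolved Δ o = ∀ {u v d e} → IsDist Δ o u d → IsDist Δ o v d → IsDist Δ u o e → IsDist Δ v o e → u ≡ v

Iso-Resolved : ∀ {Γ Δ} → Iso Γ Δ → ∃ (Resolved Δ) → ∃ (Resolved Γ)
Iso-Resolved {Γ} {Δ} ι (o , res) with Bijection.strictlySurjective (proj₁ ι) o
... | o′ , refl = o′ , λ a b c d → iso-inj {Γ} {Δ} ι
  (res (IsDist-map {Γ} {Δ} ι a) (IsDist-map {Γ} {Δ} ι b) (IsDist-map {Γ} {Δ} ι c)
    (IsDist-map {Γ} {Δ} ι d))

Resolved⇒dim1 : ∀ {Γ} → StronglyConnected Γ → (∃[ u ] ∃[ v ] (u ≢ v)) → ∃ (Resolved Γ) → WeakMetricDim Γ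
  1
Resolved⇒dim1 {Γ} sc (p , q , p≢q) (o , res) = (⁅ o ⁆ , resolving , ∣⁅x⁆∣≡1 o) , at-least-one
  where
  open Distance Γ
  resolving : WeaklyResolving Γ ⁅ o ⁆
  resolving u v u≢v with dist sc o u | dist sc o v | dist sc u o | dist sc v o
  ... | d , Du | d′ , Dv | e , Eu | e′ , Ev with d ℕₚ.≟ d′ | e ℕₚ.≟ e′
  ...   | no n | _ = o , x∈⁅x⁆ o , inj₁ (d , d′ , Du , Dv , n)
  ...   | yes _ | no n = o , x∈⁅x⁆ o , inj₂ (e , e′ , Eu , Ev , n)
  ...   | yes refl | yes refl = ⊥-elim (u≢v (res Du Dv Eu Ev))
  at-least-one : ∀ W → WeaklyResolving Γ W → 1 ≤ ∣ W ∣
  at-least-one W r with r p q p≢q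
  ... | w , w∈ , _ = ≤-trans (s≤s z≤n) (x∈p⇒∣p-x∣<∣p∣ w∈)

-- `κ i` is the least number of steps with sum `i`, the sum being taken in ℕ and not modulo
-- anything.
record Cost (Step : ℕ → Set) : Set where
  field
    κ      : ℕ → ℕ
    κ-zero : κ 0 ≡ 0
    κ-mono : ∀ {i j} → i ≤ j → κ i ≤ κ j
    κ-step : ∀ {s} i → Step s → κ (i + s) ≤ suc (κ i)
    κ-down : ∀ i → ∃[ j ] ∃[ s ] (Step s × suc i ≡ j + s × κ (suc i) ≡ suc (κ j) × j ≤ i)

module _ {V : Set} (R : V → V → Set) (o : V) where
  data Reach : V → ℕ → Set where
    start : Reach o 0
    snoc  : ∀ {v w k} → Reach v k → R v w → Reach w (suc k)

-- The two coordinates of the vertices of a Cayley digraph of ℤ_E ⊕ ℤ_(1+m).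
record Labels (V : Set) (R : V → V → Set) (E m : ℕ) (Step : ℕ → Set) : Set where
  field
    α β    : V → ℕ
    α<     : ∀ v → α v < E
    β<     : ∀ v → β v < suc m
    label-inj : ∀ {u v} → α u ≡ α v → β u ≡ β v → u ≡ v
    vertex : ∀ {e i} → e < E → i < suc m → ∃[ v ] (α v ≡ e × β v ≡ i)
    stepβ  : ∀ {v w s} → Step s → α w ≡ α v → β w ≡ (β v + s) % suc m → R v w
    -- With `E = 1` every `α` is 0 and the first hypothesis cannot hold, so the record also covers
    -- cyclic groups.
    stepα  : ∀ {v w} → α w ≡ (α v + 1) % 2 → β w ≡ β v → R v w
    step⁻  : ∀ {v w} → R v w → (∃[ s ] (Step s × α w ≡ α v × β w ≡ (β v + s) % suc m)) ⊎
      (α w ≡ (α v + 1) % 2 × β w ≡ β v)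

negate : ℕ → ℕ → ℕ
negate m b = (suc m ∸ b) % suc m

negate< : ∀ m b → negate m b < suc m
negate< m b = m%n<n (suc m ∸ b) (suc m)

+-negate : ∀ m {b} → b < suc m → (negate m b + b) % suc m ≡ 0
+-negate m {b} b< = begin
  ((suc m ∸ b) % suc m + b) % suc m                   ≡⟨ cong (λ h → ((suc m ∸ b) % suc m + h) % suc m)
    (m<n⇒m%n≡m b<) ⟨
  ((suc m ∸ b) % suc m + b % suc m) % suc m           ≡⟨ %-distribˡ-+ (suc m ∸ b) b (suc m) ⟨
  (suc m ∸ b + b) % suc m                             ≡⟨ cong (_% suc m) (ℕₚ.m∸n+n≡m (ℕₚ.<⇒≤ b<)) ⟩
  suc m % suc m                                       ≡⟨ n%n≡0 (suc m) ⟩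
  0                                                   ∎
  where open ≡-Reasoning

%-absorb : ∀ x {k} m → k % suc m ≡ 0 → (x + k) % suc m ≡ x % suc m
%-absorb x {k} m e = begin
  (x + k) % suc m                     ≡⟨ %-distribˡ-+ x k (suc m) ⟩
  (x % suc m + k % suc m) % suc m     ≡⟨ cong (λ h → (x % suc m + h) % suc m) e ⟩
  (x % suc m + 0) % suc m             ≡⟨ cong (_% suc m) (ℕₚ.+-identityʳ (x % suc m)) ⟩
  x % suc m % suc m                   ≡⟨ m%n%n≡m%n x (suc m) ⟩
  x % suc m                           ∎
  where open ≡-Reasoning

%-reduceʳ : ∀ x y m → (x + y % suc m) % suc m ≡ (x + y) % suc m
%-reduceʳ x y m = trans (%-distribˡ-+ x (y % suc m) (suc m))
  (trans (cong (λ h → (x % suc m + h) % suc m) (m%n%n≡m%n y (suc m))) (sym (%-distribˡ-+ x y (suc m))))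

negate-step : ∀ m {b b′} s → b < suc m → b′ < suc m → b′ ≡ (b + s) % suc m → negate m b ≡
  (negate m b′ + s) % suc m
negate-step m {b} {b′} s b< b′< e = sym (begin
  (g′ + s) % suc m                      ≡⟨ %-absorb (g′ + s) m (+-negate m b<) ⟨
  (g′ + s + (g + b)) % suc m            ≡⟨ cong (_% suc m)
    (solve 4 (λ g′ s g b → g′ :+ s :+ (g :+ b) := g :+ g′ :+ (b :+ s)) refl g′ s g b) ⟩
  (g + g′ + (b + s)) % suc m            ≡⟨ %-reduceʳ (g + g′) (b + s) m ⟨
  (g + g′ + (b + s) % suc m) % suc m    ≡⟨ cong (λ h → (g + g′ + h) % suc m) e ⟨
  (g + g′ + b′) % suc m                 ≡⟨ cong (_% suc m) (ℕₚ.+-assoc g g′ b′) ⟩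
  (g + (g′ + b′)) % suc m               ≡⟨ %-absorb g m (+-negate m b′<) ⟩
  g % suc m                             ≡⟨ m<n⇒m%n≡m (negate< m b) ⟩
  g                                     ∎)
  where
  open ≡-Reasoning
  g g′ : ℕ
  g = negate m b
  g′ = negate m b′

negate-involutive : ∀ m {b} → b < suc m → negate m (negate m b) ≡ b
negate-involutive m {b} b< = begin
  negate m g                          ≡⟨ m<n⇒m%n≡m (negate< m g) ⟨
  negate m g % suc m                  ≡⟨ %-absorb (negate m g) m (+-negate m b<) ⟨
  (negate m g + (g + b)) % suc m      ≡⟨ cong (_% suc m)
    (trans (sym (ℕₚ.+-assoc (negate m g) g b)) (ℕₚ.+-comm (negate m g + g) b)) ⟩
  (b + (negate m g + g)) % suc m      ≡⟨ %-absorb b m (+-negate m (negate< m b)) ⟩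
  b % suc m                           ≡⟨ m<n⇒m%n≡m b< ⟩
  b                                   ∎
  where
  open ≡-Reasoning
  g = negate m b

flip-mod2 : ∀ {x y} → x < 2 → y < 2 → y ≡ (x + 1) % 2 → x ≡ (y + 1) % 2
flip-mod2 {0} {1} _ _ _ = refl
flip-mod2 {1} {0} _ _ _ = refl
flip-mod2 {suc (suc _)} (s≤s (s≤s ())) _ _

-- Inversion in the group reverses all arcs.
flip-Labels : ∀ {V R E m Step} → E ≤ 2 → Labels V R E m Step → Labels V (flip R) E m Step
flip-Labels {m = m} E≤2 L = record
  { α = α ; β = λ v → negate m (β v) ; α< = α< ; β< = λ v → negate< m (β v)
  ; label-inj = λ e₁ e₂ → label-inj e₁ (neg-inj e₂)
  ; vertex = λ {e} {i} e< i< →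
    let v , p , q = vertex e< (negate< m i) in
    v , p , trans (cong (negate m) q) (negate-involutive m i<)
  ; stepβ = λ {v} {w} {s} st e₁ e₂ → stepβ st (sym e₁) (unneg {w} {v} {s} e₂)
  ; stepα = λ {v} {w} e₁ e₂ → stepα (flip-mod2 (≤-trans (α< v) E≤2) (≤-trans (α< w) E≤2) e₁)
    (sym (neg-inj e₂))
  ; step⁻ = λ {v} {w} r → back {v} {w} (step⁻ r) }
  where
  open Labels L
  neg-inj : ∀ {u v} → negate m (β u) ≡ negate m (β v) → β u ≡ β v
  neg-inj {u} {v} e = trans (sym (negate-involutive m (β< u)))
    (trans (cong (negate m) e) (negate-involutive m (β< v)))
  unneg : ∀ {w v s} → negate m (β w) ≡ (negate m (β v) + s) % suc m → β v ≡ (β w + s) % suc m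
  unneg {w} {v} {s} e = trans (sym (negate-involutive m (β< v)))
    (trans (negate-step m s (negate< m (β v)) (negate< m (β w)) e)
      (cong (λ h → (h + s) % suc m) (negate-involutive m (β< w))))
  back : ∀ {v w} → (∃[ s ] (_ × α v ≡ α w × β v ≡ (β w + s) % suc m)) ⊎
    (α v ≡ (α w + 1) % 2 × β v ≡ β w) → _
  back {v} {w} (inj₁ (s , st , e₁ , e₂)) = inj₁ (s , st , sym e₁ , negate-step m s (β< w) (β< v) e₂)
  back {v} {w} (inj₂ (e₁ , e₂)) = inj₂
    (flip-mod2 (≤-trans (α< w) E≤2) (≤-trans (α< v) E≤2) e₁ , cong (negate m) (sym e₂))

module Distances {V R E m Step} (E≤2 : E ≤ 2) (L : Labels V R E m Step) (C : Cost Step)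
  {o} (αo : Labels.α L o ≡ 0) (βo : Labels.β L o ≡ 0) where
  open Labels L
  open Cost C

  φ : V → ℕ
  φ v = α v + κ (β v)

  α-step≤ : ∀ {x y} → x < 2 → y ≡ (x + 1) % 2 → y ≤ suc x
  α-step≤ {0} _ refl = ≤-refl
  α-step≤ {1} _ refl = z≤n
  α-step≤ {suc (suc _)} (s≤s (s≤s ())) _

  -- Before reduction modulo `suc m` a step raises `κ` by at most one, and reduction cannot raise
  -- it, because `κ` is monotone.
  φ-step : ∀ {v w} → R v w → φ w ≤ suc (φ v)
  φ-step {v} {w} r with step⁻ r
  ... | inj₁ (s , st , e₁ , e₂) = ≤-trans (ℕₚ.+-mono-≤ (≤-reflexive e₁)
          (≤-trans (κ-mono (≤-trans (≤-reflexive e₂) (m%n≤m (β v + s) (suc m)))) (κ-step (β v) st)))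
            (≤-reflexive (ℕₚ.+-suc (α v) _))
  ... | inj₂ (e₁ , e₂) = ℕₚ.+-mono-≤ (α-step≤ (≤-trans (α< v) E≤2) e₁) (≤-reflexive (cong κ e₂))

  φ≤ : ∀ {v k} → Reach R o v k → φ v ≤ k
  φ≤ start = ≤-reflexive (cong₂ _+_ αo (trans (cong κ βo) κ-zero))
  φ≤ (snoc r e) = ≤-trans (φ-step e) (s≤s (φ≤ r))

  -- The path descends by `κ-down` and never wraps around; `n` bounds `β v` to make the recursion
  -- structural.
  reachβ : ∀ n v → β v ≤ n → α v ≡ 0 → Reach R o v (κ (β v))
  reachβ n v le α0 with β v in eq
  ... | zero = subst₂ (Reach R o) (label-inj (trans αo (sym α0)) (trans βo (sym eq))) (sym κ-zero) start
  reachβ (suc n) v (s≤s le) α0 | suc i with κ-down i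
  ...   | j , s , st , e , ke , j≤i with vertex {0} {j} (≤-trans (s≤s z≤n) (α< v))
    (≤-trans (s≤s j≤i) (≤-trans (≤-reflexive (sym eq)) (ℕₚ.<⇒≤ (β< v))))
  ...     | u , αu , βu = subst (Reach R o v) (sym ke) (snoc
            (subst (λ h → Reach R o u (κ h)) βu
              (reachβ n u (≤-trans (≤-reflexive βu) (≤-trans j≤i le)) αu))
            (stepβ st (trans α0 (sym αu)) (trans (sym (m<n⇒m%n≡m (β< v)))
              (cong (_% suc m) (trans eq (trans e (cong (_+ s) (sym βu))))))))

  reach : ∀ v → Reach R o v (φ v)
  reach v with α v in eq
  ... | 0 = reachβ (β v) v ≤-refl eq
  ... | suc (suc _) = ⊥-elim (too-big (≤-trans (≤-reflexive (cong suc (sym eq))) (≤-trans (α< v) E≤2)))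
    where
    too-big : ∀ {k} → suc (suc (suc k)) ≤ 2 → ⊥
    too-big (s≤s (s≤s ()))
  ... | 1 with vertex {0} {β v} (≤-trans (s≤s z≤n) (α< v)) (β< v)
  ...   | u , αu , βu = snoc (subst (λ h → Reach R o u (κ h)) βu (reachβ (β u) u ≤-refl αu))
            (stepα (trans eq (cong (λ h → (h + 1) % 2) (sym αu))) (sym βu))

module CayleyResolved (Δ : Digraph) {E m Step} (E≤2 : E ≤ 2)
  (L : Labels (Fin (N Δ)) (λ x y → adj Δ x y ≡ true) E m Step) (C : Cost Step)
  (o : Fin (N Δ)) (αo : Labels.α L o ≡ 0) (βo : Labels.β L o ≡ 0) where
  open Labels L
  open Cost C

  private
    module From = Distances E≤2 L C {o} αo βo
    -- Distances to the origin are distances from it in the reversed digraph, where the second label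
    -- is negated.
    module To = Distances E≤2 (flip-Labels E≤2 L) C {o} αo (trans (cong (negate m) βo) (n%n≡0 (suc m)))

  walk⇒reach : ∀ {u v k l} → Reach (λ x y → adj Δ x y ≡ true) o u k → Walk Δ u v l → Reach
    (λ x y → adj Δ x y ≡ true) o v (l + k)
  walk⇒reach r nil = r
  walk⇒reach {k = k} {suc l} r (cons e w) = subst (Reach _ o _) (ℕₚ.+-suc l k) (walk⇒reach (snoc r e) w)

  walk-snoc : ∀ {u v w k} → Walk Δ u v k → adj Δ v w ≡ true → Walk Δ u w (suc k)
  walk-snoc nil e = cons e nil
  walk-snoc (cons e′ p) e = cons e′ (walk-snoc p e)

  reach⇒walk : ∀ {v k} → Reach (λ x y → adj Δ x y ≡ true) o v k → Walk Δ o v k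
  reach⇒walk start = nil
  reach⇒walk (snoc r e) = walk-snoc (reach⇒walk r) e

  walk⇒reachᵒ : ∀ {v k} → Walk Δ v o k → Reach (flip (λ x y → adj Δ x y ≡ true)) o v k
  walk⇒reachᵒ nil = start
  walk⇒reachᵒ (cons e w) = snoc (walk⇒reachᵒ w) e

  reach⇒walkᵒ : ∀ {v k} → Reach (flip (λ x y → adj Δ x y ≡ true)) o v k → Walk Δ v o k
  reach⇒walkᵒ start = nil
  reach⇒walkᵒ (snoc r e) = cons e (reach⇒walkᵒ r)

  dist-from : ∀ {v d} → IsDist Δ o v d → d ≡ α v + κ (β v)
  dist-from {v} {d} (w , min) = ≤-antisym (min _ (reach⇒walk (From.reach v)))
    (From.φ≤ (subst (Reach _ o v) (ℕₚ.+-identityʳ d) (walk⇒reach start w)))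

  dist-to : ∀ {v d} → IsDist Δ v o d → d ≡ α v + κ (negate m (β v))
  dist-to {v} {d} (w , min) = ≤-antisym (min _ (reach⇒walkᵒ (To.reach v))) (To.φ≤ (walk⇒reachᵒ w))

  resolved : (∀ {u v} → α u + κ (β u) ≡ α v + κ (β v) → α u + κ (negate m (β u)) ≡ α v + κ
    (negate m (β v)) →
      α u ≡ α v × β u ≡ β v) → ∃ (Resolved Δ)
  resolved sep = o , λ {u} {v} a b c d →
    let p , q = sep {u} {v} (trans (sym (dist-from a)) (dist-from b)) (trans (sym (dist-to c)) (dist-to d)) in
    label-inj p q

one-cost : Cost (_∈ 1 ∷ [])
one-cost = record
  { κ = λ i → i ; κ-zero = refl ; κ-mono = λ le → le
  ; κ-step = λ { i (here refl) → ≤-reflexive (ℕₚ.+-comm i 1) }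
  ; κ-down = λ i → i , 1 , here refl , ℕₚ.+-comm 1 i , refl , ≤-refl }

half-cost : Cost (_∈ 1 ∷ 2 ∷ [])
half-cost = record
  { κ = ⌈_/2⌉ ; κ-zero = refl ; κ-mono = ℕₚ.⌈n/2⌉-mono
  ; κ-step = λ { i (here refl) → ≤-trans (≤-reflexive (cong ⌈_/2⌉ (ℕₚ.+-comm i 1)))
    (s≤s (ℕₚ.⌊n/2⌋≤⌈n/2⌉ i))
               ; i (there (here refl)) → ≤-reflexive (cong ⌈_/2⌉ (ℕₚ.+-comm i 2)) }
  ; κ-down = λ { zero → 0 , 1 , here refl , refl , refl , z≤n
               ; (suc i) → i , 2 , there (here refl) , ℕₚ.+-comm 2 i , refl , ℕₚ.n≤1+n i } }

CayZ-Labels : ∀ m L → Labels (Fin (suc m)) (λ x y → adj (CayZ (suc m) L) x y ≡ true) 1 m (_∈ L)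
CayZ-Labels m L = record
  { α = λ _ → 0 ; β = toℕ ; α< = λ _ → s≤s z≤n ; β< = toℕ<n
  ; label-inj = λ _ e → toℕ-injective e
  ; vertex = λ { {zero} _ i< → fromℕ< i< , refl , toℕ-fromℕ< i< ; {suc _} (s≤s ()) _ }
  ; stepβ = λ {v} {w} s∈ _ e → CayZ-adj⁺ {m} {L} {v} {w} s∈ e
  ; stepα = λ ()
  ; step⁻ = λ {v} {w} r → let s , s∈ , e = CayZ-adj⁻ {m} {L} {v} {w} r in inj₁ (s , s∈ , refl , e) }

CayZ2Zn-Labels : ∀ m L → Labels (Fin (2 * suc m))
  (λ x y → adj (CayZ2Zn (suc m) ((1 , 0) ∷ map (0 ,_) L)) x y ≡ true) 2 m (_∈ L)
CayZ2Zn-Labels m L = record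
  { α = α ; β = β ; α< = α< ; β< = β<
  ; label-inj = λ {u} {v} e₁ e₂ → toℕ-injective (trans (m≡m%n+[m/n]*n (toℕ u) (suc m))
      (trans (cong₂ (λ q r → r + q * suc m) e₁ e₂) (sym (m≡m%n+[m/n]*n (toℕ v) (suc m)))))
  ; vertex = vertex
  ; stepβ = λ {v} {w} {s} s∈ e₁ e₂ → CayZ2Zn-adj⁺ {m} {S} {v} {w} (there (∈-map⁺ (0 ,_) s∈))
    (trans e₁ (sym (α-stay v))) e₂
  ; stepα = λ {v} {w} e₁ e₂ → CayZ2Zn-adj⁺ {m} {S} {v} {w} (here refl) e₁ (trans e₂ (sym (β-stay v)))
  ; step⁻ = λ {v} {w} r → back v w (CayZ2Zn-adj⁻ {m} {S} {v} {w} r) }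
  where
  S : List (ℕ × ℕ)
  S = (1 , 0) ∷ map (0 ,_) L
  α β : Fin (2 * suc m) → ℕ
  α v = toℕ v / suc m
  β v = toℕ v % suc m
  α< : ∀ v → α v < 2
  α< v = m<n*o⇒m/o<n {toℕ v} {2} {suc m} (toℕ<n v)
  β< : ∀ v → β v < suc m
  β< v = m%n<n (toℕ v) (suc m)
  α-stay : ∀ v → (α v + 0) % 2 ≡ α v
  α-stay v = trans (cong (_% 2) (ℕₚ.+-identityʳ (α v))) (m<n⇒m%n≡m (α< v))
  β-stay : ∀ v → (β v + 0) % suc m ≡ β v
  β-stay v = trans (cong (_% suc m) (ℕₚ.+-identityʳ (β v))) (m<n⇒m%n≡m (β< v))
  vertex : ∀ {e i} → e < 2 → i < suc m → ∃[ v ] (α v ≡ e × β v ≡ i)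
  vertex {e} {i} e< i< = fromℕ< lt ,
    trans (cong (_/ suc m) (toℕ-fromℕ< lt))
      (trans (+-distrib-/-∣ʳ i (divides-refl e)) (cong₂ _+_ (m<n⇒m/n≡0 i<) (m*n/n≡m e (suc m)))) ,
    trans (cong (_% suc m) (toℕ-fromℕ< lt)) (trans ([m+kn]%n≡m%n i e (suc m)) (m<n⇒m%n≡m i<))
    where
    lt : i + e * suc m < 2 * suc m
    lt = ≤-trans (ℕₚ.+-monoˡ-< (e * suc m) i<) (ℕₚ.*-monoˡ-≤ (suc m) e<)
  back : ∀ v w → ∃[ s ] (s ∈ S × α w ≡ (α v + proj₁ s) % 2 × β w ≡ (β v + proj₂ s) % suc m) →
    (∃[ s ] (s ∈ L × α w ≡ α v × β w ≡ (β v + s) % suc m)) ⊎ (α w ≡ (α v + 1) % 2 × β w ≡ β v)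
  back v w (_ , here refl , e₁ , e₂) = inj₂ (e₁ , trans e₂ (β-stay v))
  back v w (_ , there p , e₁ , e₂) with ∈-map⁻ (0 ,_) p
  ... | t , t∈ , refl = inj₁ (t , t∈ , trans e₁ (α-stay v) , e₂)

-- Separating the vertices by their distances from and to the origin

negate-suc : ∀ m b → negate m (suc b) ≡ m ∸ b
negate-suc m b = m<n⇒m%n≡m (s≤s (ℕₚ.m∸n≤m m b))

-- On nonzero residues `κ b + κ (negate m b)` is `n` or `n + 1`, and at 0 it is 0. Two vertices with
-- different `α` and the same two distances would have sums differing by 2: too much for nonzero
-- residues, and a sum of 2 is excluded by `3 ≤ n`.
module Separation {m : ℕ} (κ : ℕ → ℕ)
  (inj : ∀ {b b′} → b < suc m → b′ < suc m → κ b ≡ κ b′ → κ (negate m b) ≡ κ (negate m b′) → b ≡ b′)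
  (κ0 : κ 0 ≡ 0) {n} (3≤n : 3 ≤ n)
  (low : ∀ {b} → suc b < suc m → n ≤ κ (suc b) + κ (negate m (suc b)))
  (high : ∀ {b} → suc b < suc m → κ (suc b) + κ (negate m (suc b)) ≤ suc n) where

  no-shift : ∀ b b′ → b < suc m → b′ < suc m → suc (κ b) ≡ κ b′ → suc (κ (negate m b)) ≡ κ (negate m b′)
    → ⊥
  no-shift b zero _ _ e _ with trans e κ0
  ... | ()
  no-shift zero (suc b′) _ b′< e e′ = <-irrefl refl (≤-trans 3≤n (≤-trans (low b′<) (≤-reflexive (begin
    κ (suc b′) + κ (negate m (suc b′))   ≡⟨ cong₂ _+_ e e′ ⟨
    suc (κ 0) + suc (κ (negate m 0))     ≡⟨ cong₂ (λ p q → suc p + suc q) κ0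
      (trans (cong κ (n%n≡0 (suc m))) κ0) ⟩
    2                                    ∎))))
    where open ≡-Reasoning
  no-shift (suc b) (suc b′) b< b′< e e′ = <-irrefl refl (begin-strict
    suc n                                              <⟨ ℕₚ.n<1+n _ ⟩
    2 + n                                              ≤⟨ s≤s (s≤s (low b<)) ⟩
    2 + (κ (suc b) + κ (negate m (suc b)))             ≡⟨ cong suc (ℕₚ.+-suc (κ (suc b)) _) ⟨
    suc (κ (suc b)) + suc (κ (negate m (suc b)))       ≡⟨ cong₂ _+_ e e′ ⟩
    κ (suc b′) + κ (negate m (suc b′))                 ≤⟨ high b′< ⟩
    suc n                                              ∎)
    where open ℕₚ.≤-Reasoning

  separate : ∀ {a a′ b b′} → a < 2 → a′ < 2 → b < suc m → b′ < suc m → a + κ b ≡ a′ + κ b′ →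
    a + κ (negate m b) ≡ a′ + κ (negate m b′) → a ≡ a′ × b ≡ b′
  separate {0} {0} _ _ b< b′< e e′ = refl , inj b< b′< e e′
  separate {1} {1} _ _ b< b′< e e′ = refl , inj b< b′< (suc-injective e) (suc-injective e′)
  separate {1} {0} _ _ b< b′< e e′ = ⊥-elim (no-shift _ _ b< b′< e e′)
  separate {0} {1} _ _ b< b′< e e′ = ⊥-elim (no-shift _ _ b′< b< (sym e) (sym e′))
  separate {suc (suc _)} (s≤s (s≤s ())) _ _ _ _ _
  separate {_} {suc (suc _)} _ (s≤s (s≤s ())) _ _ _ _

half-sum : ∀ n x y → x + y ≡ n + n → ⌈ x /2⌉ + ⌊ y /2⌋ ≡ n
half-sum n zero y e = trans (cong ⌊_/2⌋ e) (sym (ℕₚ.n≡⌊n+n/2⌋ n))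
half-sum (suc n) 1 y e = cong suc
  (trans (cong ⌊_/2⌋ (trans (suc-injective e) (ℕₚ.+-suc n n))) (sym (ℕₚ.n≡⌈n+n/2⌉ n)))
half-sum (suc n) (suc (suc x)) y e = cong suc
  (half-sum n x y (suc-injective (trans (suc-injective e) (ℕₚ.+-suc n n))))

module Halving (n : ℕ) where
  -- Chosen so that `suc m` is definitionally `2 * suc n`.
  m : ℕ
  m = n + suc (n + 0)

  -- The two residues add up to the even modulus, so the ceiling of half of one and the floor of
  -- half of the other add up to half the modulus. Hence the cost of the negative determines the
  -- floor of half of `suc b`, while its own cost is the ceiling, and floor and ceiling add up to
  -- `suc b`.
  half-negate : ∀ {b} → suc b < suc m → ⌈ negate m (suc b) /2⌉ + ⌊ suc b /2⌋ ≡ suc n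
  half-negate {b} b< = half-sum (suc n) _ (suc b) (begin
    negate m (suc b) + suc b  ≡⟨ cong (_+ suc b) (negate-suc m b) ⟩
    m ∸ b + suc b             ≡⟨ ℕₚ.+-suc (m ∸ b) b ⟩
    suc (m ∸ b + b)           ≡⟨ cong suc (ℕₚ.m∸n+n≡m (ℕₚ.≤-trans (ℕₚ.n≤1+n b) (ℕₚ.≤-pred b<))) ⟩
    suc m                     ≡⟨ cong (λ h → suc (n + suc h)) (ℕₚ.+-identityʳ n) ⟩
    suc n + suc n             ∎)
    where open ≡-Reasoning

  inj : ∀ {b b′} → b < suc m → b′ < suc m → ⌈ b /2⌉ ≡ ⌈ b′ /2⌉ → ⌈ negate m b /2⌉ ≡ ⌈ negate m b′ /2⌉ →
    b ≡ b′
  inj {zero} {zero} _ _ _ _ = refl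
  inj {suc b} {suc b′} b< b′< e e′ = begin
    suc b                             ≡⟨ ℕₚ.⌊n/2⌋+⌈n/2⌉≡n (suc b) ⟨
    ⌊ suc b /2⌋ + ⌈ suc b /2⌉         ≡⟨ cong₂ _+_ floor≡ e ⟩
    ⌊ suc b′ /2⌋ + ⌈ suc b′ /2⌉       ≡⟨ ℕₚ.⌊n/2⌋+⌈n/2⌉≡n (suc b′) ⟩
    suc b′                            ∎
    where
    open ≡-Reasoning
    floor≡ : ⌊ suc b /2⌋ ≡ ⌊ suc b′ /2⌋
    floor≡ = ℕₚ.+-cancelˡ-≡ ⌈ negate m (suc b) /2⌉ _ _
      (trans (half-negate b<) (sym (trans (cong (_+ ⌊ suc b′ /2⌋) e′) (half-negate b′<))))

  low : ∀ {b} → suc b < suc m → suc n ≤ ⌈ suc b /2⌉ + ⌈ negate m (suc b) /2⌉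
  low {b} b< = begin
    suc n                                      ≡⟨ half-negate b< ⟨
    ⌈ negate m (suc b) /2⌉ + ⌊ suc b /2⌋       ≤⟨ ℕₚ.+-monoʳ-≤ _ (ℕₚ.⌊n/2⌋≤⌈n/2⌉ (suc b)) ⟩
    ⌈ negate m (suc b) /2⌉ + ⌈ suc b /2⌉       ≡⟨ ℕₚ.+-comm ⌈ negate m (suc b) /2⌉ _ ⟩
    ⌈ suc b /2⌉ + ⌈ negate m (suc b) /2⌉       ∎
    where open ℕₚ.≤-Reasoning

  high : ∀ {b} → suc b < suc m → ⌈ suc b /2⌉ + ⌈ negate m (suc b) /2⌉ ≤ suc (suc n)
  high {b} b< = begin
    ⌈ suc b /2⌉ + ⌈ negate m (suc b) /2⌉           ≤⟨ ℕₚ.+-monoˡ-≤ _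
      (ℕₚ.⌊n/2⌋-mono (ℕₚ.n≤1+n (suc (suc b)))) ⟩
    suc ⌊ suc b /2⌋ + ⌈ negate m (suc b) /2⌉       ≡⟨ cong suc (ℕₚ.+-comm ⌊ suc b /2⌋ _) ⟩
    suc (⌈ negate m (suc b) /2⌉ + ⌊ suc b /2⌋)     ≡⟨ cong suc (half-negate b<) ⟩
    suc (suc n)                                    ∎
    where open ℕₚ.≤-Reasoning

cycle-resolved : ∀ n → ∃ (Resolved (CayZ (suc n) (1 ∷ [])))
cycle-resolved n = CayleyResolved.resolved (CayZ (suc n) (1 ∷ [])) {1} {n} (s≤s z≤n) (CayZ-Labels n _)
  one-cost Fin.zero refl refl
  (λ e _ → refl , e)

squared-cycle-resolved : ∀ n → ∃ (Resolved (CayZ (2 * suc n) (1 ∷ 2 ∷ [])))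
squared-cycle-resolved n = CayleyResolved.resolved (CayZ (2 * suc n) (1 ∷ 2 ∷ [])) {1} {m} (s≤s z≤n)
  (CayZ-Labels m _) half-cost Fin.zero refl refl
  (λ {u} {v} e e′ → refl , inj (toℕ<n u) (toℕ<n v) e e′)
  where open Halving n

prism-resolved : ∀ n → 3 ≤ suc n → ∃ (Resolved (CayZ2Zn (suc n) ((1 , 0) ∷ (0 , 1) ∷ [])))
prism-resolved n 3≤n = CayleyResolved.resolved (CayZ2Zn (suc n) ((1 , 0) ∷ (0 , 1) ∷ [])) {2} {n} ≤-refl
  (CayZ2Zn-Labels n (1 ∷ [])) one-cost Fin.zero refl refl
  (λ {u} {v} → Separation.separate (λ i → i) (λ _ _ e _ → e) refl 3≤n
    (λ b< → ≤-reflexive (sym (total b<))) (λ b< → ≤-trans (≤-reflexive (total b<)) (ℕₚ.n≤1+n _))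
    (α< u) (α< v) (β< u) (β< v))
  where
  open Labels (CayZ2Zn-Labels n (1 ∷ []))
  total : ∀ {b} → suc b < suc n → suc b + negate n (suc b) ≡ suc n
  total {b} b< = trans (cong (suc b +_) (negate-suc n b))
    (cong suc (ℕₚ.m+[n∸m]≡n (≤-trans (ℕₚ.n≤1+n b) (ℕₚ.≤-pred b<))))

squared-prism-resolved : ∀ n → 3 ≤ suc n → ∃
  (Resolved (CayZ2Zn (2 * suc n) ((1 , 0) ∷ (0 , 1) ∷ (0 , 2) ∷ [])))
squared-prism-resolved n 3≤n = CayleyResolved.resolved
  (CayZ2Zn (2 * suc n) ((1 , 0) ∷ (0 , 1) ∷ (0 , 2) ∷ [])) {2} {m} ≤-refl
    (CayZ2Zn-Labels m (1 ∷ 2 ∷ [])) half-cost Fin.zero refl refl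
  (λ {u} {v} → Separation.separate {m} ⌈_/2⌉ inj refl 3≤n low high (α< u) (α< v) (β< u) (β< v))
  where
  open Halving n
  open Labels (CayZ2Zn-Labels m (1 ∷ 2 ∷ []))

theorem3p3 : (Γ : Digraph) → 2 ≤ N Γ → Loopless Γ → StronglyConnected Γ →
    VertexTransitive Γ →
    (WeakMetricDim Γ 1 ⇔
    ((∃[ n ] (2 ≤ n × Iso Γ (CayZ n (1 ∷ []))))
    ⊎ (∃[ n ] (2 ≤ n × Iso Γ (CayZ (2 * n) (1 ∷ 2 ∷ []))))
    ⊎ (∃[ n ] (3 ≤ n × Iso Γ (CayZ2Zn n ((1 , 0) ∷ (0 , 1) ∷ []))))
    ⊎ (∃[ n ] (3 ≤ n × Iso Γ (CayZ2Zn (2 * n) ((1 , 0) ∷ (0 , 1) ∷ (0 , 2) ∷ []))))))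
theorem3p3 Γ 2≤N loopless sc vt = mk⇔ (dim1⇒families Γ 2≤N loopless sc vt) backward
  where
  from-Iso : ∀ {Δ} → Iso Γ Δ → ∃ (Resolved Δ) → WeakMetricDim Γ 1
  from-Iso {Δ} ι r = Resolved⇒dim1 sc (two-vertices 2≤N) (Iso-Resolved {Γ} {Δ} ι r)
  backward : CayleyFamilies Γ → WeakMetricDim Γ 1
  backward (inj₁ (suc n , _ , ι)) = from-Iso ι (cycle-resolved n)
  backward (inj₂ (inj₁ (suc n , _ , ι))) = from-Iso ι (squared-cycle-resolved n)
  backward (inj₂ (inj₂ (inj₁ (suc n , le , ι)))) = from-Iso ι (prism-resolved n le)
  backward (inj₂ (inj₂ (inj₂ (suc n , le , ι)))) = from-Iso ι (squared-prism-resolved n le)
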